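{- Let $G$ be a connected graph of order $n\geq 4$. Then $m(-1)=n-3$ if and only if $G\in\{P_4,\ K_{n-2}\vee 2K_1\}$. In addition, each such $G$ is determined by its $\mathcal{A}$-spectrum.
   Context: $P_4$ is the path on 4 vertices, $K_{n-2}$ the complete graph on $n-2$ vertices, $2K_1$ two isolated vertices, $\vee$ the join. For a connected graph $G$, $d(u,v)$ is the distance and $\varepsilon(v)=\max_u d(u,v)$ the eccentricity. The eccentricity matrix $\mathcal{A}(G)$ is indexed by $V(G)$ with $(u,v)$-entry $d(u,v)$ if $d(u,v)=\min\{\varepsilon(u),\varepsilon(v)\}$ and $0$ otherwise; its $\mathcal{A}$-spectrum is the multiset of its eigenvalues. $m(-1)$ is the multiplicity of $-1$ in the $\mathcal{A}$-spectrum. A graph $G$ is determined by its $\mathcal{A}$-spectrum if every connected graph with the same $\mathcal{A}$-spectrum is isomorphic to $G$. -}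

module Defs where

open import Data.Nat as ℕ using (ℕ; zero; suc; _⊔_; _⊓_)
open import Data.Integer as ℤ using (ℤ; +_; -_) renaming (_+_ to _+ℤ_; _*_ to _*ℤ_)
open import Data.Fin using (Fin; zero; suc; toℕ; punchIn)
open import Data.Fin.Properties using () renaming (_≟_ to _≟F_)
open import Data.Bool using (Bool; true; false; _∧_; _∨_; not; if_then_else_)
open import Data.List using (List; []; _∷_)
open import Data.Product using (Σ; _×_; ∃)
open import Relation.Nullary using (does; ¬_)
import Relation.Binary.PropositionalEquality
open Relation.Binary.PropositionalEquality using (_≡_)
open import Function.Bundles using (_↔_; Inverse)

record Graph (n : ℕ) : Set where
  field
    adj    : Fin n → Fin n → Bool
    sym    : ∀ i j → adj i j ≡ adj j i
    irrefl : ∀ i → adj i i ≡ false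
open Graph public

_==F_ : ∀ {n} → Fin n → Fin n → Bool
i ==F j = does (i ≟F j)

anyFin : ∀ {n} → (Fin n → Bool) → Bool
anyFin {zero}  f = false
anyFin {suc n} f = f zero ∨ anyFin (λ i → f (suc i))

maxFin : ∀ {n} → (Fin n → ℕ) → ℕ
maxFin {zero}  f = 0
maxFin {suc n} f = f zero ⊔ maxFin (λ i → f (suc i))

reach : ∀ {n} → Graph n → ℕ → Fin n → Fin n → Bool
reach G zero    u v = u ==F v
reach G (suc k) u v = reach G k u v ∨ anyFin (λ w → reach G k u w ∧ adj G w v)

Connected : ∀ {n} → Graph n → Set
Connected G = ∀ u v → ∃ λ k → reach G k u v ≡ true

findDist : ∀ {n} → Graph n → Fin n → Fin n → ℕ → ℕ → ℕ
findDist G u v zero     k = k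
findDist G u v (suc f) k = if reach G k u v then k else findDist G u v f (suc k)

-- distance d(u,v) (correct for connected graphs: d(u,v) ≤ n - 1)
dist : ∀ {n} → Graph n → Fin n → Fin n → ℕ
dist {n} G u v = findDist G u v n 0

ecc : ∀ {n} → Graph n → Fin n → ℕ
ecc G u = maxFin (λ v → dist G u v)

eccMatrix : ∀ {n} → Graph n → Fin n → Fin n → ℤ
eccMatrix G u v =
  if does (dist G u v ℕ.≟ (ecc G u ⊓ ecc G v)) then + dist G u v else + 0

-- Integer polynomials as coefficient lists (lowest degree first)

Poly : Set
Poly = List ℤ

_+P_ : Poly → Poly → Poly
[]       +P q        = q
p        +P []       = p
(a ∷ p)  +P (b ∷ q)  = (a +ℤ b) ∷ (p +P q)

scaleP : ℤ → Poly → Poly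
scaleP c []      = []
scaleP c (a ∷ p) = (c *ℤ a) ∷ scaleP c p

_*P_ : Poly → Poly → Poly
[]      *P q = []
(a ∷ p) *P q = scaleP a q +P (+ 0 ∷ (p *P q))

constP : ℤ → Poly
constP c = c ∷ []

XP : Poly
XP = + 0 ∷ + 1 ∷ []

coeff : Poly → ℕ → ℤ
coeff []      i       = + 0
coeff (a ∷ p) zero    = a
coeff (a ∷ p) (suc i) = coeff p i

_≈P_ : Poly → Poly → Set
p ≈P q = ∀ i → coeff p i ≡ coeff q i

evalP : Poly → ℤ → ℤ
evalP []      x = + 0
evalP (a ∷ p) x = a +ℤ x *ℤ evalP p x

powP : Poly → ℕ → Poly
powP p zero    = constP (+ 1)
powP p (suc k) = p *P powP p k

sumFinP : ∀ {n} → (Fin n → Poly) → Poly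
sumFinP {zero}  f = []
sumFinP {suc n} f = f zero +P sumFinP (λ i → f (suc i))

signP : ℕ → ℤ
signP zero          = + 1
signP (suc zero)    = - (+ 1)
signP (suc (suc k)) = signP k

det : ∀ n → (Fin n → Fin n → Poly) → Poly
det zero    M = constP (+ 1)
det (suc n) M = sumFinP (λ j →
  scaleP (signP (toℕ j)) (M zero j *P det n (λ r c → M (suc r) (punchIn j c))))

charPoly : ∀ n → (Fin n → Fin n → ℤ) → Poly
charPoly n A = det n (λ i j →
  if i ==F j then XP +P constP (- A i j) else constP (- A i j))

-- eccentricity characteristic polynomial; two graphs have the same
-- A-spectrum iff these are equal (the eccentricity matrix is real symmetric)
eccCharPoly : ∀ {n} → Graph n → Poly
eccCharPoly {n} G = charPoly n (eccMatrix G)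

RootMult : Poly → ℤ → ℕ → Set
RootMult p r k = Σ Poly λ q →
  (p ≈P (powP (XP +P constP (- r)) k *P q)) × ¬ (evalP q r ≡ + 0)

EccMultMinusOne : ∀ {n} → Graph n → ℕ → Set
EccMultMinusOne G k = RootMult (eccCharPoly G) (- (+ 1)) k

Iso : ∀ {n m} → Graph n → Graph m → Set
Iso {n} {m} G H = Σ (Fin n ↔ Fin m) λ f →
  ∀ i j → adj H (Inverse.to f i) (Inverse.to f j) ≡ adj G i j

p4adj : Fin 4 → Fin 4 → Bool
p4adj zero (suc zero) = true
p4adj (suc zero) zero = true
p4adj (suc zero) (suc (suc zero)) = true
p4adj (suc (suc zero)) (suc zero) = true
p4adj (suc (suc zero)) (suc (suc (suc zero))) = true
p4adj (suc (suc (suc zero))) (suc (suc zero)) = true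
p4adj _ _ = false

P4 : Graph 4
P4 = record { adj = p4adj ; sym = s ; irrefl = r }
  where
  s : ∀ i j → p4adj i j ≡ p4adj j i
  s zero zero = _≡_.refl
  s zero (suc zero) = _≡_.refl
  s zero (suc (suc zero)) = _≡_.refl
  s zero (suc (suc (suc zero))) = _≡_.refl
  s (suc zero) zero = _≡_.refl
  s (suc zero) (suc zero) = _≡_.refl
  s (suc zero) (suc (suc zero)) = _≡_.refl
  s (suc zero) (suc (suc (suc zero))) = _≡_.refl
  s (suc (suc zero)) zero = _≡_.refl
  s (suc (suc zero)) (suc zero) = _≡_.refl
  s (suc (suc zero)) (suc (suc zero)) = _≡_.refl
  s (suc (suc zero)) (suc (suc (suc zero))) = _≡_.refl
  s (suc (suc (suc zero))) zero = _≡_.refl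
  s (suc (suc (suc zero))) (suc zero) = _≡_.refl
  s (suc (suc (suc zero))) (suc (suc zero)) = _≡_.refl
  s (suc (suc (suc zero))) (suc (suc (suc zero))) = _≡_.refl
  r : ∀ i → p4adj i i ≡ false
  r zero = _≡_.refl
  r (suc zero) = _≡_.refl
  r (suc (suc zero)) = _≡_.refl
  r (suc (suc (suc zero))) = _≡_.refl

-- K_{m} ∨ 2K_1 on Fin (m + 2): vertices 0 and 1 form 2K_1,
-- vertices 2, ..., m+1 form K_m, and all of them are joined:
-- distinct i, j are adjacent unless {i, j} = {0, 1}.
big : ∀ {n} → Fin n → Bool
big i = does (2 ℕ.≤? toℕ i)

kj : ∀ {n} → Fin n → Fin n → Bool
kj i j = not (i ==F j) ∧ (big i ∨ big j)

==F-refl : ∀ {n} (i : Fin n) → (i ==F i) ≡ true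
==F-refl zero = _≡_.refl
==F-refl (suc i) with i ≟F i
... | Relation.Nullary.yes _ = _≡_.refl
... | Relation.Nullary.no p = Data.Empty.⊥-elim (p _≡_.refl)
  where import Data.Empty

==F-sym : ∀ {n} (i j : Fin n) → (i ==F j) ≡ (j ==F i)
==F-sym i j with i ≟F j | j ≟F i
... | Relation.Nullary.yes _ | Relation.Nullary.yes _ = _≡_.refl
... | Relation.Nullary.no _  | Relation.Nullary.no _  = _≡_.refl
... | Relation.Nullary.yes p | Relation.Nullary.no q  = Data.Empty.⊥-elim (q (Relation.Binary.PropositionalEquality.sym p))
  where import Data.Empty
... | Relation.Nullary.no p  | Relation.Nullary.yes q = Data.Empty.⊥-elim (p (Relation.Binary.PropositionalEquality.sym q))
  where import Data.Empty

KJoin2K1 : (m : ℕ) → Graph (suc (suc m))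
KJoin2K1 m = record { adj = kj ; sym = s ; irrefl = r }
  where
  open Relation.Binary.PropositionalEquality using (cong₂)
  open import Data.Bool.Properties using (∨-comm)
  s : ∀ i j → kj i j ≡ kj j i
  s i j = cong₂ (λ a b → not a ∧ b) (==F-sym i j) (∨-comm (big i) (big j))
  r : ∀ i → kj i i ≡ false
  r i rewrite ==F-refl i = _≡_.refl

{- Put y = x + 1 and B = I + 𝒜(G), so that the characteristic polynomial of 𝒜(G) is det (y I − B).

   Since B is symmetric, y^k ∣ det (y I − B) forces rank B ≤ n − k.  This is shown by pivoting in
   symmetric matrices S = S₀ + y S₁ + … over ℤ[x]: a pivot with nonzero value at y = 0 costs rank,
   a row vanishing at y = 0 costs a factor y, and neither destroys the property that the form S₁ is
   anisotropic on ker S₀, which for y I − B says that a sum of squares is positive.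

   So m(−1) = n − 3 makes all 4 × 4 minors of B vanish.  If no vertex has eccentricity 1 and the
   diameter is 2, then B ≡ I modulo 2; if the diameter is 2 and w has eccentricity 1, then w with
   three vertices of eccentricity 2 has minor ±2; if the diameter is D ≥ 3, then the first two and
   the last two vertices of a diametral path have minor (1 − a²)(1 − b²) − D² with a, b ∈ {0, D − 1},
   which is 0 only for D = 3 and a = b = 2, and then no fifth vertex is possible.  The diameter is
   not 1, because the rank of B would be 1.

   For the converse, B has equal rows for the vertices of eccentricity 1.  -}
module Submission where

-- For real symmetric matrices, multiplicity equals corank by diagonalisation. Here only integer
-- matrices and polynomials occur, so a substitute for orthogonality is needed. Symmetry alone
-- cannot serve: the all-ones 2 × 2 matrix over the field with two elements is symmetric of rank 1,
-- yet its characteristic polynomial is the square of the variable. What excludes this over ℤ is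
-- that a nonzero vector has a nonzero sum of squares, and a weakened form of this fact is stable
-- under pivoting. Ranks are kept free of fractions as factorisations c · B = X Y with c ≠ 0.
--
-- The same bound is used for K_{n-2} ∨ 2K_1: equal rows bound m(-1) from below, and a 3 × 3 minor
-- equal to -1 bounds it from above.
--
-- Determination by the spectrum: the characteristic polynomial is monic of degree n, so a
-- cospectral graph has the same order, hence the same value m(-1) = n - 3, and is one of the two
-- graphs. They share an order only for n = 4, where their coefficients of x² are -17 and -9.

open import Algebra.Bundles using (CommutativeRing)

-- Ring solver with integer constants over an arbitrary commutative ring

module IntegerSolver {c ℓ} (R : CommutativeRing c ℓ) where

  open import Data.Nat as ℕ using (ℕ; zero; suc)
  open import Data.Integer as ℤ using (ℤ; +_; -[1+_])
  import Data.Integer.Properties as ℤ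
  open import Data.Maybe using (Maybe; just; nothing)
  open import Relation.Nullary using (yes; no)
  open import Relation.Binary.PropositionalEquality as ≡ using (_≡_)
  open import Algebra.Solver.Ring.AlmostCommutativeRing using (fromCommutativeRing; _-Raw-AlmostCommutative⟶_)
  open CommutativeRing R hiding (zero)
  open import Algebra.Properties.Ring ring using (-‿distribˡ-*; -‿distribʳ-*; -0#≈0#; -‿involutive; -‿+-comm)
  open import Algebra.Properties.Semiring.Mult semiring using (_×_; ×1-homo-*; ×-homo-+)
  open import Relation.Binary.Reasoning.Setoid setoid

  -- The separate clause for 1 lets the constants 0 and 1 of the solver evaluate to `0#` and `1#`
  -- themselves, so that solved equations match goals written with `1#`.
  nat : ℕ → Carrier
  nat zero          = 0#
  nat (suc zero)    = 1#
  nat (suc (suc n)) = 1# + nat (suc n)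

  nat≈× : ∀ n → nat n ≈ n × 1#
  nat≈× zero          = refl
  nat≈× (suc zero)    = sym (+-identityʳ 1#)
  nat≈× (suc (suc n)) = +-congˡ (nat≈× (suc n))

  nat-suc : ∀ n → nat (suc n) ≈ 1# + nat n
  nat-suc zero    = sym (+-identityʳ 1#)
  nat-suc (suc n) = refl

  nat-+ : ∀ m n → nat (m ℕ.+ n) ≈ nat m + nat n
  nat-+ m n = trans (nat≈× (m ℕ.+ n)) (trans (×-homo-+ 1# m n) (+-cong (sym (nat≈× m)) (sym (nat≈× n))))

  nat-* : ∀ m n → nat (m ℕ.* n) ≈ nat m * nat n
  nat-* m n = trans (nat≈× (m ℕ.* n)) (trans (×1-homo-* m n) (*-cong (sym (nat≈× m)) (sym (nat≈× n))))

  int : ℤ → Carrier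
  int (+ n)    = nat n
  int -[1+ n ] = - nat (suc n)

  int-⊖ : ∀ m n → int (m ℤ.⊖ n) ≈ nat m + - nat n
  int-⊖ m       zero    = sym (trans (+-congˡ -0#≈0#) (+-identityʳ _))
  int-⊖ zero    (suc n) = sym (+-identityˡ _)
  int-⊖ (suc m) (suc n) = begin
    int (suc m ℤ.⊖ suc n)              ≡⟨ ≡.cong int (ℤ.[1+m]⊖[1+n]≡m⊖n m n) ⟩
    int (m ℤ.⊖ n)                      ≈⟨ int-⊖ m n ⟩
    nat m + - nat n                    ≈⟨ +-congʳ (trans (+-congʳ (-‿inverseʳ 1#)) (+-identityˡ _)) ⟨
    1# + - 1# + nat m + - nat n        ≈⟨ +-congʳ (trans (+-assoc _ _ _) (trans (+-congˡ (+-comm _ _)) (sym (+-assoc _ _ _)))) ⟩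
    1# + nat m + - 1# + - nat n        ≈⟨ +-assoc _ _ _ ⟩
    1# + nat m + (- 1# + - nat n)      ≈⟨ +-cong (sym (nat-suc m)) (trans (-‿+-comm _ _) (-‿cong (sym (nat-suc n)))) ⟩
    nat (suc m) + - nat (suc n)        ∎

  int-neg : ∀ i → int (ℤ.- i) ≈ - int i
  int-neg (+ zero)  = sym -0#≈0#
  int-neg (+ suc n) = refl
  int-neg -[1+ n ]  = sym (-‿involutive _)

  int-+ : ∀ i j → int (i ℤ.+ j) ≈ int i + int j
  int-+ (+ m)    (+ n)    = nat-+ m n
  int-+ (+ m)    -[1+ n ] = int-⊖ m (suc n)
  int-+ -[1+ m ] (+ n)    = trans (int-⊖ n (suc m)) (+-comm _ _)
  int-+ -[1+ m ] -[1+ n ] = begin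
    - nat (suc (suc (m ℕ.+ n)))      ≈⟨ -‿cong (nat-suc (suc m ℕ.+ n)) ⟩
    - (1# + nat (suc m ℕ.+ n))       ≈⟨ -‿cong (+-congˡ (nat-+ (suc m) n)) ⟩
    - (1# + (nat (suc m) + nat n))   ≈⟨ -‿cong (trans (sym (+-assoc _ _ _)) (trans (+-congʳ (+-comm _ _)) (+-assoc _ _ _))) ⟩
    - (nat (suc m) + (1# + nat n))   ≈⟨ -‿cong (+-congˡ (nat-suc n)) ⟨
    - (nat (suc m) + nat (suc n))    ≈⟨ -‿+-comm _ _ ⟨
    - nat (suc m) + - nat (suc n)    ∎

  int-pos-* : ∀ m j → int (+ m ℤ.* j) ≈ nat m * int j
  int-pos-* m (+ n) = trans (reflexive (≡.cong int (≡.sym (ℤ.pos-* m n)))) (nat-* m n)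
  int-pos-* m -[1+ n ] = begin
    int (+ m ℤ.* -[1+ n ])          ≡⟨ ≡.cong int (ℤ.neg-distribʳ-* (+ m) (+ suc n)) ⟨
    int (ℤ.- (+ m ℤ.* + suc n))     ≈⟨ int-neg (+ m ℤ.* + suc n) ⟩
    - int (+ m ℤ.* + suc n)         ≈⟨ -‿cong (int-pos-* m (+ suc n)) ⟩
    - (nat m * nat (suc n))         ≈⟨ -‿distribʳ-* _ _ ⟩
    nat m * - nat (suc n)           ∎

  int-* : ∀ i j → int (i ℤ.* j) ≈ int i * int j
  int-* (+ m)    j = int-pos-* m j
  int-* -[1+ m ] j = begin
    int (-[1+ m ] ℤ.* j)            ≡⟨ ≡.cong int (ℤ.neg-distribˡ-* (+ suc m) j) ⟨
    int (ℤ.- (+ suc m ℤ.* j))       ≈⟨ int-neg (+ suc m ℤ.* j) ⟩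
    - int (+ suc m ℤ.* j)           ≈⟨ -‿cong (int-pos-* (suc m) j) ⟩
    - (nat (suc m) * int j)         ≈⟨ -‿distribˡ-* _ _ ⟩
    - nat (suc m) * int j           ∎

  int-morphism : ℤ.+-*-rawRing -Raw-AlmostCommutative⟶ fromCommutativeRing R
  int-morphism = record
    { ⟦_⟧    = int
    ; +-homo = int-+
    ; *-homo = int-*
    ; -‿homo = int-neg
    ; 0-homo = refl
    ; 1-homo = refl
    }

  -- Only equal integers are reported as equal: distinct ones may or may not coincide in `R`, whose
  -- characteristic is unknown.
  int-≟ : ∀ i j → Maybe (int i ≈ int j)
  int-≟ i j with i ℤ.≟ j
  ... | yes i≡j = just (reflexive (≡.cong int i≡j))
  ... | no _    = nothing

  open import Algebra.Solver.Ring ℤ.+-*-rawRing (fromCommutativeRing R) int-morphism int-≟ public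
    using (solve; _:=_; _:+_; _:*_; _:-_; :-_; con; var; Polynomial)

-- Determinants over a commutative ring

module Determinants {c ℓ} (R : CommutativeRing c ℓ) where

  open import Data.Nat as ℕ using (ℕ; zero; suc)
  import Data.Nat.Properties as ℕ
  open import Data.Fin as Fin using (Fin; zero; suc; toℕ; punchIn)
  import Data.Fin.Properties as Fin
  open import Data.Fin.Properties using (_≟_)
  open import Data.Fin.Permutation using (Permutation′; _⟨$⟩ʳ_)
  open import Data.Fin.Permutation.Components using (transpose)
  open import Data.Fin.Permutation.Transposition.List using (decompose; eval; eval-decompose)
  open import Data.Bool using (true; false; T; if_then_else_)
  import Data.Integer as ℤ
  open import Data.List using ([]; _∷_)
  open import Data.Product using (∃; _,_)
  open import Data.Sum using (_⊎_; inj₁; inj₂)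
  open import Data.Vec.Functional using (updateAt)
  open import Data.Vec.Functional.Properties using (updateAt-updates; updateAt-minimal)
  open import Function using (const; _∘_)
  open import Relation.Binary using (tri<; tri≈; tri>)
  open import Relation.Nullary using (yes; no; contradiction)
  open import Relation.Binary.PropositionalEquality as ≡ using (_≡_; _≢_)
  open CommutativeRing R hiding (zero)
  open import Algebra.Properties.Ring ring using (-‿distribˡ-*; -0#≈0#; -‿involutive)
  open import Algebra.Properties.Semiring.Sum semiring using (∑-comm; ∑-distrib-+; *-distribˡ-sum; sum-cong-≋; sum-replicate-zero)
  open import Algebra.Properties.Semiring.Sum semiring public using (sum)
  open import Relation.Binary.Reasoning.Setoid setoid
  open IntegerSolver R using (solve; _:=_; _:+_; _:*_; :-_; con)

  Mat : ℕ → Set c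
  Mat n = Fin n → Fin n → Carrier

  sg : ℕ → Carrier
  sg zero    = 1#
  sg (suc k) = - sg k

  minor : ∀ {n} → Mat (suc n) → Fin (suc n) → Mat n
  minor M j r c = M (suc r) (punchIn j c)

  det : ∀ n → Mat n → Carrier
  det zero    M = 1#
  det (suc n) M = sum (λ j → sg (toℕ j) * (M zero j * det n (minor M j)))

  laplace : ∀ {n} → Mat (suc n) → Fin (suc n) → Carrier
  laplace {n} M j = sg (toℕ j) * (M zero j * det n (minor M j))

  sum-cong : ∀ {n} (f g : Fin n → Carrier) → (∀ i → f i ≈ g i) → sum f ≈ sum g
  sum-cong f g f≈g = sum-cong-≋ f≈g

  sum-* : ∀ {n} x (f : Fin n → Carrier) → x * sum f ≈ sum (λ i → x * f i)
  sum-* x f = *-distribˡ-sum x f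

  sum-+ : ∀ {n} (f g : Fin n → Carrier) → sum (λ i → f i + g i) ≈ sum f + sum g
  sum-+ f g = ∑-distrib-+ f g

  sum-zero : ∀ {n} (f : Fin n → Carrier) → (∀ i → f i ≈ 0#) → sum f ≈ 0#
  sum-zero {n} f f≈0 = trans (sum-cong-≋ f≈0) (sum-replicate-zero n)

  det-cong : ∀ n (M N : Mat n) → (∀ i j → M i j ≈ N i j) → det n M ≈ det n N
  det-cong zero    M N M≈N = refl
  det-cong (suc n) M N M≈N = sum-cong (laplace M) (laplace N) λ j →
    *-congˡ (*-cong (M≈N zero j) (det-cong n (minor M j) (minor N j) λ r c → M≈N (suc r) (punchIn j c)))

  -- Apart from the corner term, expanding along the first row and then each minor along its first
  -- column gives the products of `M (suc i) zero` and `M zero (suc j)` with the minor lacking both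
  -- rows and both columns. The transpose gives the same double sum in the other order of summation.
  -- The induction hypothesis enters at two sizes, for the minors and for their minors.
  det-ᵀ : ∀ n (M : Mat n) → det n (λ i j → M j i) ≈ det n M
  det-ᵀ zero          M = refl
  det-ᵀ (suc zero)    M = refl
  det-ᵀ (suc (suc n)) M = +-cong (*-congˡ (*-congˡ (det-ᵀ (suc n) (minor M zero)))) (begin
      sum (λ i → - sg (toℕ i) * (M (suc i) zero * det (suc n) (minor Mᵀ (suc i))))
    ≈⟨ sum-cong _ (λ i → sum (term i)) (λ i → expand (det-ᵀ (suc n)) Mᵀ i) ⟩
      sum (λ i → sum (λ j → term i j))
    ≈⟨ ∑-comm term ⟩
      sum (λ j → sum (λ i → term i j))
    ≈⟨ sum-cong (λ j → sum (λ i → term i j)) _ (λ j → sum-cong (λ i → term i j) _ (λ i → swapped i j)) ⟩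
      sum (λ j → sum (λ i → - sg (toℕ j) * (M zero (suc j) * (sg (toℕ i) * (M (suc i) zero
        * det n (λ r c → M (suc (punchIn i c)) (suc (punchIn j r))))))))
    ≈⟨ sum-cong (λ j → laplace M (suc j)) _ (λ j → expand (det-ᵀ (suc n)) M j) ⟨
      sum (λ j → - sg (toℕ j) * (M zero (suc j) * det (suc n) (minor M (suc j)))) ∎)
    where
    Mᵀ : Mat (suc (suc n))
    Mᵀ i j = M j i
    term : Fin (suc n) → Fin (suc n) → Carrier
    term i j = - sg (toℕ i) * (M (suc i) zero * (sg (toℕ j) * (M zero (suc j)
      * det n (λ r c → M (suc (punchIn i r)) (suc (punchIn j c))))))
    expand : (∀ (K : Mat (suc n)) → det (suc n) (λ i j → K j i) ≈ det (suc n) K) → ∀ (N : Mat (suc (suc n))) j →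
      - sg (toℕ j) * (N zero (suc j) * det (suc n) (minor N (suc j))) ≈
      sum (λ i → - sg (toℕ j) * (N zero (suc j) * (sg (toℕ i) * (N (suc i) zero
        * det n (λ r c → N (suc (punchIn i c)) (suc (punchIn j r)))))))
    expand ih N j = begin
        - sg (toℕ j) * (N zero (suc j) * det (suc n) (minor N (suc j)))
      ≈⟨ *-congˡ (*-congˡ (ih (minor N (suc j)))) ⟨
        - sg (toℕ j) * (N zero (suc j) * det (suc n) (λ r c → minor N (suc j) c r))
      ≈⟨ *-congˡ (sum-* (N zero (suc j)) (laplace (λ r c → minor N (suc j) c r))) ⟩
        - sg (toℕ j) * sum (λ i → N zero (suc j) * laplace (λ r c → minor N (suc j) c r) i)
      ≈⟨ sum-* (- sg (toℕ j)) (λ i → N zero (suc j) * laplace (λ r c → minor N (suc j) c r) i) ⟩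
        _ ∎
    swapped : ∀ i j → term i j ≈ - sg (toℕ j) * (M zero (suc j) * (sg (toℕ i) * (M (suc i) zero
        * det n (λ r c → M (suc (punchIn i c)) (suc (punchIn j r))))))
    swapped i j = begin
        - s * (a * (t * (b * d)))  ≈⟨ solve 5 (λ s t a b d → (:- s :* (a :* (t :* (b :* d))) := :- t :* (b :* (s :* (a :* d))))) refl s t a b d ⟩
        - t * (b * (s * (a * d)))  ≈⟨ *-congˡ (*-congˡ (*-congˡ (*-congˡ (sym (det-ᵀ n λ r c → M (suc (punchIn i r)) (suc (punchIn j c))))))) ⟩
        - t * (b * (s * (a * det n (λ r c → M (suc (punchIn i c)) (suc (punchIn j r))))))  ∎
      where
      s = sg (toℕ i)
      t = sg (toℕ j)
      a = M (suc i) zero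
      b = M zero (suc j)
      d = det n (λ r c → M (suc (punchIn i r)) (suc (punchIn j c)))

  -- If `p` is the expanded row, the minors of the three matrices agree; otherwise linearity holds
  -- in every minor. Relating the matrices entrywise lets the hypotheses pass to minors.
  det-linear : ∀ {n} (p : Fin n) (M A B : Mat n) x y →
    (∀ j → M p j ≈ x * A p j + y * B p j) →
    (∀ i → i ≢ p → ∀ j → M i j ≈ A i j) →
    (∀ i → i ≢ p → ∀ j → M i j ≈ B i j) →
    det n M ≈ x * det n A + y * det n B
  det-linear {suc n} p M A B x y eq eqA eqB = begin
      sum (λ j → sg (toℕ j) * (M zero j * det n (minor M j)))
    ≈⟨ sum-cong (laplace M) (λ j → x * f j + y * g j) (λ j → term j p eq eqA eqB) ⟩
      sum (λ j → x * f j + y * g j)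
    ≈⟨ sum-+ (λ j → x * f j) (λ j → y * g j) ⟩
      sum (λ j → x * f j) + sum (λ j → y * g j)
    ≈⟨ +-cong (sym (sum-* x f)) (sym (sum-* y g)) ⟩
      x * sum f + y * sum g ∎
    where
    f = λ j → sg (toℕ j) * (A zero j * det n (minor A j))
    g = λ j → sg (toℕ j) * (B zero j * det n (minor B j))
    term : ∀ j p →
      (∀ j → M p j ≈ x * A p j + y * B p j) →
      (∀ i → i ≢ p → ∀ j → M i j ≈ A i j) →
      (∀ i → i ≢ p → ∀ j → M i j ≈ B i j) →
      sg (toℕ j) * (M zero j * det n (minor M j)) ≈ x * f j + y * g j
    term j zero eq eqA eqB = begin
        s * (M zero j * dM)
      ≈⟨ *-congˡ (*-congʳ (eq j)) ⟩
        s * ((x * a + y * b) * dM)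
      ≈⟨ solve 6 (λ s x y a b d → (s :* ((x :* a :+ y :* b) :* d) := x :* (s :* (a :* d)) :+ y :* (s :* (b :* d)))) refl s x y a b dM ⟩
        x * (s * (a * dM)) + y * (s * (b * dM))
      ≈⟨ +-cong (*-congˡ (*-congˡ (*-congˡ (det-cong n (minor M j) (minor A j) λ r c → eqA (suc r) (λ ()) _))))
                (*-congˡ (*-congˡ (*-congˡ (det-cong n (minor M j) (minor B j) λ r c → eqB (suc r) (λ ()) _)))) ⟩
        x * f j + y * g j ∎
      where
      s = sg (toℕ j)
      a = A zero j
      b = B zero j
      dM = det n (minor M j)
    term j (suc p) eq eqA eqB = begin
        s * (m * det n (minor M j))
      ≈⟨ *-congˡ (*-congˡ (det-linear p (minor M j) (minor A j) (minor B j) x y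
           (λ k → eq (punchIn j k))
           (λ i i≢p k → eqA (suc i) (i≢p ∘ Fin.suc-injective) _)
           (λ i i≢p k → eqB (suc i) (i≢p ∘ Fin.suc-injective) _))) ⟩
        s * (m * (x * dA + y * dB))
      ≈⟨ solve 6 (λ s m x y d e → (s :* (m :* (x :* d :+ y :* e)) := x :* (s :* (m :* d)) :+ y :* (s :* (m :* e)))) refl s m x y dA dB ⟩
        x * (s * (m * dA)) + y * (s * (m * dB))
      ≈⟨ +-cong (*-congˡ (*-congˡ (*-congʳ (eqA zero (λ ()) j))))
                (*-congˡ (*-congˡ (*-congʳ (eqB zero (λ ()) j)))) ⟩
        x * f j + y * g j ∎
      where
      s = sg (toℕ j)
      m = M zero j
      dA = det n (minor A j)
      dB = det n (minor B j)

  set : ∀ {n} → Mat n → Fin n → (Fin n → Carrier) → Mat n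
  set M p r = updateAt M p (const r)

  set-p : ∀ {n} (M : Mat n) p r j → set M p r p j ≈ r j
  set-p M p r j = reflexive (≡.cong-app (updateAt-updates p M) j)

  set-≢ : ∀ {n} (M : Mat n) p r i → i ≢ p → ∀ j → set M p r i j ≈ M i j
  set-≢ M p r i i≢p j = reflexive (≡.cong-app (updateAt-minimal i p M i≢p) j)

  det-set-linear : ∀ {n} (M : Mat n) p r r' x y →
    det n (set M p (λ j → x * r j + y * r' j)) ≈ x * det n (set M p r) + y * det n (set M p r')
  det-set-linear M p r r' x y = det-linear p _ _ _ x y
    (λ j → trans (set-p M p _ j) (+-cong (*-congˡ (sym (set-p M p r j))) (*-congˡ (sym (set-p M p r' j)))))
    (λ i i≢p j → trans (set-≢ M p _ i i≢p j) (sym (set-≢ M p _ i i≢p j)))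
    (λ i i≢p j → trans (set-≢ M p _ i i≢p j) (sym (set-≢ M p _ i i≢p j)))

  Alternates : ∀ {n} → Fin n → Fin n → Set _
  Alternates {n} p q = ∀ (M : Mat n) → (∀ j → M p j ≈ M q j) → det n M ≈ 0#

  -- Polarisation: with x in row `p` and y in row `q`, the determinants D(a+b, a+b), D(a, a) and
  -- D(b, b) vanish, hence D(a, b) + D(b, a) = 0. Alternation of this one pair is a hypothesis,
  -- because the swap of rows 0 and 1 is used to reach alternation of the other pairs.
  swap-rows : ∀ {n} {p q : Fin n} → p ≢ q → Alternates p q → (M N : Mat n) →
    (∀ j → N p j ≈ M q j) → (∀ j → N q j ≈ M p j) → (∀ i → i ≢ p → i ≢ q → ∀ j → N i j ≈ M i j) →
    det n N ≈ - det n M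
  swap-rows {n} {p} {q} p≢q alt M N Np Nq Nr = begin
      det n N                        ≈⟨ +-identityʳ _ ⟨
      det n N + 0#                   ≈⟨ +-congˡ (-‿inverseʳ _) ⟨
      det n N + (det n M + - det n M) ≈⟨ +-assoc _ _ _ ⟨
      det n N + det n M + - det n M  ≈⟨ +-congʳ N+M≈0 ⟩
      0# + - det n M                 ≈⟨ +-identityˡ _ ⟩
      - det n M                      ∎
    where
    a = M p
    b = M q
    D : (Fin n → Carrier) → (Fin n → Carrier) → Mat n
    D x y = set (set M p x) q y
    q≢p = p≢q ∘ ≡.sym
    Dp : ∀ x y j → D x y p j ≈ x j
    Dp x y j = trans (set-≢ (set M p x) q y p p≢q j) (set-p M p x j)
    Dq : ∀ x y j → D x y q j ≈ y j
    Dq x y j = set-p (set M p x) q y j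
    Dr : ∀ x y i → i ≢ p → i ≢ q → ∀ j → D x y i j ≈ M i j
    Dr x y i i≢p i≢q j = trans (set-≢ (set M p x) q y i i≢q j) (set-≢ M p x i i≢p j)
    lin₂ : ∀ x y z → det n (D x (λ j → 1# * y j + 1# * z j)) ≈ det n (D x y) + det n (D x z)
    lin₂ x y z = trans (det-set-linear (set M p x) q y z 1# 1#) (+-cong (*-identityˡ _) (*-identityˡ _))
    lin₁ : ∀ x y z → det n (D (λ j → 1# * x j + 1# * y j) z) ≈ det n (D x z) + det n (D y z)
    lin₁ x y z = trans (det-linear p _ (D x z) (D y z) 1# 1#
        (λ j → trans (Dp _ z j) (+-cong (*-congˡ (sym (Dp x z j))) (*-congˡ (sym (Dp y z j)))))
        (λ i i≢p j → off x i i≢p j) (λ i i≢p j → off y i i≢p j))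
      (+-cong (*-identityˡ _) (*-identityˡ _))
      where
      off : ∀ w i → i ≢ p → ∀ j → D (λ j → 1# * x j + 1# * y j) z i j ≈ D w z i j
      off w i i≢p j with i ≟ q
      ... | yes ≡.refl = trans (Dq _ z j) (sym (Dq w z j))
      ... | no i≢q = trans (Dr _ z i i≢p i≢q j) (sym (Dr w z i i≢p i≢q j))
    a+b : Fin n → Carrier
    a+b j = 1# * a j + 1# * b j
    D-alt : ∀ x → det n (D x x) ≈ 0#
    D-alt x = alt (D x x) (λ j → trans (Dp x x j) (sym (Dq x x j)))
    is : ∀ x y (L : Mat n) → (∀ j → L p j ≈ x j) → (∀ j → L q j ≈ y j) →
      (∀ i → i ≢ p → i ≢ q → ∀ j → L i j ≈ M i j) → det n L ≈ det n (D x y)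
    is x y L Lp Lq Lr = det-cong n L (D x y) entry
      where
      entry : ∀ i j → L i j ≈ D x y i j
      entry i j with i ≟ p
      ... | yes ≡.refl = trans (Lp j) (sym (Dp x y j))
      ... | no i≢p with i ≟ q
      ...   | yes ≡.refl = trans (Lq j) (sym (Dq x y j))
      ...   | no i≢q = trans (Lr i i≢p i≢q j) (sym (Dr x y i i≢p i≢q j))
    N+M≈0 : det n N + det n M ≈ 0#
    N+M≈0 = begin
        det n N + det n M
      ≈⟨ +-cong (is b a N Np Nq Nr) (is a b M (λ _ → refl) (λ _ → refl) (λ _ _ _ _ → refl)) ⟩
        det n (D b a) + det n (D a b)
      ≈⟨ +-cong (+-identityʳ _) (+-identityˡ _) ⟨
        (det n (D b a) + 0#) + (0# + det n (D a b))
      ≈⟨ +-cong (+-congˡ (D-alt b)) (+-congʳ (D-alt a)) ⟨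
        (det n (D b a) + det n (D b b)) + (det n (D a a) + det n (D a b))
      ≈⟨ +-comm _ _ ⟩
        (det n (D a a) + det n (D a b)) + (det n (D b a) + det n (D b b))
      ≈⟨ +-cong (lin₂ a a b) (lin₂ b a b) ⟨
        det n (D a a+b) + det n (D b a+b)
      ≈⟨ lin₁ a b a+b ⟨
        det n (D a+b a+b)
      ≈⟨ D-alt a+b ⟩
        0# ∎

  -- Expanding along the first column, the terms of rows 0 and 1 cancel and the other minors
  -- still have their rows 0 and 1 equal.
  alternates-01 : ∀ n → Alternates {suc (suc n)} zero (suc zero)
  alternates-01 n M M₀≈M₁ = begin
      det (suc (suc n)) M
    ≈⟨ det-ᵀ (suc (suc n)) M ⟨
      1# * (M zero zero * d₀) + (- 1# * (M (suc zero) zero * d₁) + sum rest)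
    ≈⟨ +-congˡ (+-cong (*-congˡ (*-cong (sym (M₀≈M₁ zero)) (sym d₀≈d₁))) (sum-zero rest (rest≈0 n M M₀≈M₁))) ⟩
      1# * x + (- 1# * x + 0#)
    ≈⟨ +-congˡ (+-identityʳ _) ⟩
      1# * x + - 1# * x
    ≈⟨ +-congˡ (-‿distribˡ-* 1# x) ⟨
      1# * x + - (1# * x)
    ≈⟨ -‿inverseʳ _ ⟩
      0# ∎
    where
    d₀ = det (suc n) (minor (λ i j → M j i) zero)
    d₁ = det (suc n) (minor (λ i j → M j i) (suc zero))
    x = M zero zero * d₀
    rest : Fin n → Carrier
    rest i = - - sg (toℕ i) * (M (suc (suc i)) zero * det (suc n) (minor (λ i j → M j i) (suc (suc i))))
    d₀≈d₁ : d₀ ≈ d₁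
    d₀≈d₁ = det-cong (suc n) (minor (λ i j → M j i) zero) (minor (λ i j → M j i) (suc zero)) λ where
      r zero    → sym (M₀≈M₁ (suc r))
      r (suc c) → refl
    rest≈0 : ∀ n (M : Mat (suc (suc n))) → (∀ j → M zero j ≈ M (suc zero) j) → ∀ i →
      - - sg (toℕ i) * (M (suc (suc i)) zero * det (suc n) (minor (λ i j → M j i) (suc (suc i)))) ≈ 0#
    rest≈0 (suc n) M M₀≈M₁ i = trans (*-congˡ (trans (*-congˡ (trans
        (sym (det-ᵀ (suc (suc n)) (minor (λ i j → M j i) (suc (suc i)))))
        (alternates-01 n (λ r c → minor (λ i j → M j i) (suc (suc i)) c r) (λ j → M₀≈M₁ (suc j)))))
      (zeroʳ _))) (zeroʳ _)

  -- Equal rows below row 0 stay equal in every minor of the expansion. If row 0 equals a row of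
  -- index at least 2, swapping rows 0 and 1 moves the equality below row 0 at the cost of a sign.
  alternates-< : ∀ {n} (p q : Fin n) → p Fin.< q → Alternates p q
  alternates-< {suc (suc n)} zero (suc zero) p<q M eq = alternates-01 n M eq
  alternates-< {suc n} (suc p) (suc q) p<q M eq = sum-zero (laplace M) λ j →
    trans (*-congˡ (trans (*-congˡ (alternates-< p q (ℕ.s≤s⁻¹ p<q) (minor M j) (λ k → eq (punchIn j k))))
      (zeroʳ _))) (zeroʳ _)
  alternates-< {suc (suc (suc n))} zero (suc (suc q)) p<q M eq = begin
      det _ M      ≈⟨ -‿involutive _ ⟨
      - - det _ M  ≈⟨ -‿cong (swap-rows (λ ()) (alternates-01 (suc n)) M N (λ _ → refl) (λ _ → refl) Nr) ⟨
      - det _ N    ≈⟨ -‿cong (sum-zero (laplace N) λ j → trans (*-congˡ (trans (*-congˡ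
                        (alternates-< zero (suc q) (ℕ.s≤s ℕ.z≤n) (minor N j) (λ k → eq (punchIn j k))))
                        (zeroʳ _))) (zeroʳ _)) ⟩
      - 0#         ≈⟨ -0#≈0# ⟩
      0#           ∎
    where
    N : Mat (suc (suc (suc n)))
    N zero          = M (suc zero)
    N (suc zero)    = M zero
    N (suc (suc i)) = M (suc (suc i))
    Nr : ∀ i → i ≢ zero → i ≢ suc zero → ∀ j → N i j ≈ M i j
    Nr zero i≢0 i≢1 j = contradiction ≡.refl i≢0
    Nr (suc zero) i≢0 i≢1 j = contradiction ≡.refl i≢1
    Nr (suc (suc i)) i≢0 i≢1 j = refl
  alternates : ∀ {n} (p q : Fin n) → p ≢ q → Alternates p q
  alternates p q p≢q M eq with Fin.<-cmp p q
  ... | tri< p<q _ _ = alternates-< p q p<q M eq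
  ... | tri≈ _ p≡q _ = contradiction p≡q p≢q
  ... | tri> _ _ q<p = alternates-< q p q<p M (λ j → sym (eq j))

  transpose-i : ∀ {n} (i j : Fin n) → transpose i j i ≡ j
  transpose-i i j with i ≟ i
  ... | yes _   = ≡.refl
  ... | no i≢i = contradiction ≡.refl i≢i

  transpose-j : ∀ {n} (i j : Fin n) → transpose i j j ≡ i
  transpose-j i j with j ≟ i
  ... | yes j≡i = j≡i
  ... | no _ with j ≟ j
  ...   | yes _   = ≡.refl
  ...   | no j≢j = contradiction ≡.refl j≢j

  transpose-≢ : ∀ {n} (i j : Fin n) {k} → k ≢ i → k ≢ j → transpose i j k ≡ k
  transpose-≢ i j {k} k≢i k≢j with k ≟ i
  ... | yes k≡i = contradiction k≡i k≢i
  ... | no _ with k ≟ j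
  ...   | yes k≡j = contradiction k≡j k≢j
  ...   | no _    = ≡.refl

  det-transpose-rows : ∀ {n} {p q : Fin n} → p ≢ q → (M : Mat n) → det n (λ i → M (transpose p q i)) ≈ - det n M
  det-transpose-rows {p = p} {q} p≢q M = swap-rows p≢q (alternates p q p≢q) M _
    (λ j → reflexive (≡.cong (λ i → M i j) (transpose-i p q)))
    (λ j → reflexive (≡.cong (λ i → M i j) (transpose-j p q)))
    (λ i i≢p i≢q j → reflexive (≡.cong (λ i → M i j) (transpose-≢ p q i≢p i≢q)))

  -- The row swap and the column swap each change the sign, and the two signs cancel.
  det-transpose-conj : ∀ {n} (p q : Fin n) (M : Mat n) →
    det n (λ i j → M (transpose p q i) (transpose p q j)) ≈ det n M
  det-transpose-conj {n} p q M with p ≟ q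
  ... | yes ≡.refl = det-cong n _ _ (λ i j → reflexive (≡.cong₂ M (fixed i) (fixed j)))
    where
    fixed : ∀ i → transpose p p i ≡ i
    fixed i with i ≟ p
    ... | yes ≡.refl = ≡.refl
    ... | no i≢p with i ≟ p
    ...   | yes i≡p = contradiction i≡p i≢p
    ...   | no _ = ≡.refl
  ... | no p≢q = begin
      det n (λ i j → M (τ i) (τ j))    ≈⟨ det-transpose-rows p≢q (λ i j → M i (τ j)) ⟩
      - det n (λ i j → M i (τ j))      ≈⟨ -‿cong (det-ᵀ n (λ i j → M i (τ j))) ⟨
      - det n (λ j i → M i (τ j))      ≈⟨ -‿cong (det-transpose-rows p≢q (λ j i → M i j)) ⟩
      - - det n (λ j i → M i j)        ≈⟨ -‿involutive _ ⟩
      det n (λ j i → M i j)            ≈⟨ det-ᵀ n M ⟩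
      det n M                          ∎
    where τ = transpose p q

  det-conj : ∀ {n} (π : Permutation′ n) (M : Mat n) → det n (λ i j → M (π ⟨$⟩ʳ i) (π ⟨$⟩ʳ j)) ≈ det n M
  det-conj {n} π M = trans
    (det-cong n _ _ (λ i j → reflexive (≡.cong₂ M (≡.sym (eval-decompose π i)) (≡.sym (eval-decompose π j)))))
    (conj-eval (decompose π))
    where
    conj-eval : ∀ ts → det n (λ i j → M (eval ts ⟨$⟩ʳ i) (eval ts ⟨$⟩ʳ j)) ≈ det n M
    conj-eval []             = refl
    conj-eval ((p , q) ∷ ts) = trans
      (det-transpose-conj p q (λ i j → M (eval ts ⟨$⟩ʳ i) (eval ts ⟨$⟩ʳ j))) (conj-eval ts)

  ∏ : ∀ {n} → (Fin n → Carrier) → Carrier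
  ∏ {zero}  f = 1#
  ∏ {suc n} f = f zero * ∏ (λ i → f (suc i))

  det-scale : ∀ n (x : Fin n → Carrier) (M : Mat n) → det n (λ i j → x i * M i j) ≈ ∏ x * det n M
  det-scale zero    x M = sym (*-identityˡ 1#)
  det-scale (suc n) x M = trans
    (sum-cong _ (λ j → ∏ x * laplace M j) λ j → trans
      (*-congˡ (*-congˡ (det-scale n (λ i → x (suc i)) (minor M j))))
      (solve 5 (λ s a m p d → (s :* ((a :* m) :* (p :* d)) := (a :* p) :* (s :* (m :* d)))) refl
        (sg (toℕ j)) (x zero) (M zero j) (∏ (λ i → x (suc i))) (det n (minor M j))))
    (sym (sum-* (∏ x) (laplace M)))

  det-block : ∀ {n} (M : Mat (suc n)) → (∀ i → M (suc i) zero ≈ 0#) →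
    det (suc n) M ≈ M zero zero * det n (minor M zero)
  det-block {n} M M₀≈0 = begin
      det (suc n) M
    ≈⟨ det-ᵀ (suc n) M ⟨
      1# * (M zero zero * det n (λ i j → minor M zero j i)) + sum (λ i → laplace (λ i j → M j i) (suc i))
    ≈⟨ +-cong (trans (*-identityˡ _) (*-congˡ (det-ᵀ n (minor M zero))))
         (sum-zero _ λ i → trans (*-congˡ (trans (*-congʳ (M₀≈0 i)) (zeroˡ _))) (zeroʳ _)) ⟩
      M zero zero * det n (minor M zero) + 0#
    ≈⟨ +-identityʳ _ ⟩
      M zero zero * det n (minor M zero) ∎

  private
    -- Row operations are performed on the rows of index below a threshold t, one more at each step.
    below : ∀ {a} {A : Set a} {n} → ℕ → Fin n → A → A → A
    below t i x y = if toℕ i ℕ.<ᵇ t then x else y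

    below-n : ∀ {a} {A : Set a} {n} (i : Fin n) (x y : A) → below n i x y ≡ x
    below-n {n = n} i x y with toℕ i ℕ.<ᵇ n | ℕ.<⇒<ᵇ (Fin.toℕ<n i)
    ... | true | _ = ≡.refl

    below-≡ : ∀ {a} {A : Set a} {n} (p : Fin n) (x y : A) → below (toℕ p) p x y ≡ y
    below-≡ p x y with toℕ p ℕ.<ᵇ toℕ p in eq
    ... | false = ≡.refl
    ... | true  = contradiction (ℕ.<ᵇ⇒< (toℕ p) (toℕ p) (≡.subst T (≡.sym eq) _)) (ℕ.<-irrefl ≡.refl)

    below-suc-≡ : ∀ {a} {A : Set a} {n} (p : Fin n) (x y : A) → below (suc (toℕ p)) p x y ≡ x
    below-suc-≡ p x y with toℕ p ℕ.<ᵇ suc (toℕ p) | ℕ.<⇒<ᵇ (ℕ.n<1+n (toℕ p))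
    ... | true | _ = ≡.refl

    below-suc-≢ : ∀ {a} {A : Set a} {n} t (i : Fin n) → toℕ i ≢ t → (x y : A) → below (suc t) i x y ≡ below t i x y
    below-suc-≢ t i i≢t x y with toℕ i ℕ.<ᵇ suc t in e | toℕ i ℕ.<ᵇ t in e'
    ... | true  | true  = ≡.refl
    ... | false | false = ≡.refl
    ... | true  | false = contradiction
      (ℕ.<⇒<ᵇ (ℕ.≤∧≢⇒< (ℕ.≤-pred (ℕ.<ᵇ⇒< (toℕ i) (suc t) (≡.subst T (≡.sym e) _))) i≢t)) (≡.subst T e')
    ... | false | true  = contradiction
      (ℕ.<⇒<ᵇ (ℕ.m<n⇒m<1+n (ℕ.<ᵇ⇒< (toℕ i) t (≡.subst T (≡.sym e') _)))) (≡.subst T e)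

    row-at? : ∀ n t → (∃ λ (p : Fin n) → toℕ p ≡ t) ⊎ (∀ (i : Fin n) → toℕ i ≢ t)
    row-at? n t with t ℕ.<? n
    ... | yes t<n = inj₁ (Fin.fromℕ< t<n , Fin.toℕ-fromℕ< t<n)
    ... | no t≮n  = inj₂ λ i i≡t → t≮n (≡.subst (ℕ._< n) i≡t (Fin.toℕ<n i))

  -- `A t` has the operation carried out in the rows before `t`. One more row changes the
  -- determinant by a multiple of one with two equal rows. Since `x q` vanishes, row `q` remains
  -- that of `M` throughout.
  det-addRows : ∀ {n} q (x : Fin n → Carrier) (M : Mat n) → x q ≈ 0# →
    det n (λ i j → M i j + x i * M q j) ≈ det n M
  det-addRows {n} q x M xq≈0 = trans
    (det-cong n _ (A n) (λ i j → +-congˡ (*-congʳ (reflexive (≡.sym (below-n i (x i) 0#))))))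
    (trans (steps n) (det-cong n (A 0) M (λ i j → trans (+-congˡ (zeroˡ _)) (+-identityʳ _))))
    where
    A : ℕ → Mat n
    A t i j = M i j + below t i (x i) 0# * M q j
    A-≢ : ∀ t i → toℕ i ≢ t → ∀ j → A (suc t) i j ≈ A t i j
    A-≢ t i i≢t j = +-congˡ (*-congʳ (reflexive (below-suc-≢ t i i≢t (x i) 0#)))
    below-q : ∀ t → below t q (x q) 0# ≈ 0#
    below-q t with toℕ q ℕ.<ᵇ t
    ... | true  = xq≈0
    ... | false = refl
    step : ∀ t → det n (A (suc t)) ≈ det n (A t)
    step t with row-at? n t
    ... | inj₂ none = det-cong n _ (A t) (λ i j → A-≢ t i (none i) j)
    ... | inj₁ (p , ≡.refl) with p ≟ q
    ...   | yes ≡.refl = det-cong n _ (A t) λ i j → +-congˡ (*-congʳ (entry i))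
      where
      entry : ∀ i → below (suc t) i (x i) 0# ≈ below t i (x i) 0#
      entry i with i ≟ p
      ... | yes ≡.refl = trans (below-q (suc t)) (sym (below-q t))
      ... | no i≢p     = reflexive (below-suc-≢ t i (i≢p ∘ Fin.toℕ-injective) (x i) 0#)
    ...   | no p≢q = begin
        det n (A (suc t))
      ≈⟨ det-linear p (A (suc t)) (A t) (set (A t) p (A t q)) 1# (x p) row
           (λ i i≢p → A-≢ t i (i≢p ∘ Fin.toℕ-injective))
           (λ i i≢p j → trans (A-≢ t i (i≢p ∘ Fin.toℕ-injective) j) (sym (set-≢ (A t) p (A t q) i i≢p j))) ⟩
        1# * det n (A t) + x p * det n (set (A t) p (A t q))
      ≈⟨ +-cong (*-identityˡ _) (*-congˡ (alternates p q p≢q _ (λ j →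
           trans (set-p (A t) p (A t q) j) (sym (set-≢ (A t) p (A t q) q (p≢q ∘ ≡.sym) j))))) ⟩
        det n (A t) + x p * 0#
      ≈⟨ trans (+-congˡ (zeroʳ _)) (+-identityʳ _) ⟩
        det n (A t) ∎
      where
      row : ∀ j → A (suc t) p j ≈ 1# * A t p j + x p * set (A t) p (A t q) p j
      row j = begin
          M p j + below (suc t) p (x p) 0# * M q j
        ≡⟨ ≡.cong (λ z → M p j + z * M q j) (below-suc-≡ p (x p) 0#) ⟩
          M p j + x p * M q j
        ≈⟨ solve 3 (λ m y k → (m :+ y :* k := con (ℤ.+ 1) :* (m :+ con (ℤ.+ 0) :* k) :+ y :* (k :+ con (ℤ.+ 0) :* k)))
             refl (M p j) (x p) (M q j) ⟩
          1# * (M p j + 0# * M q j) + x p * (M q j + 0# * M q j)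
        ≈⟨ +-cong (*-congˡ (+-congˡ (*-congʳ (reflexive (≡.sym (below-≡ p (x p) 0#))))))
             (*-congˡ (trans (+-congˡ (*-congʳ (sym (below-q t)))) (sym (set-p (A t) p (A t q) j)))) ⟩
          1# * A t p j + x p * set (A t) p (A t q) p j ∎
    steps : ∀ t → det n (A t) ≈ det n (A 0)
    steps zero    = refl
    steps (suc t) = trans (step t) (steps t)

  det-sum-row : ∀ {n} r (p : Fin n) (M : Mat n) (x : Fin r → Carrier) (Y : Fin r → Fin n → Carrier) →
    (∀ j → M p j ≈ sum (λ k → x k * Y k j)) → det n M ≈ sum (λ k → x k * det n (set M p (Y k)))
  det-sum-row zero p M x Y row = trans
    (det-linear p M M M 0# 0# (λ j → trans (row j) (sym (trans (+-cong (zeroˡ _) (zeroˡ _)) (+-identityˡ 0#))))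
      (λ _ _ _ → refl) (λ _ _ _ → refl))
    (trans (+-cong (zeroˡ _) (zeroˡ _)) (+-identityˡ 0#))
  det-sum-row {n} (suc r) p M x Y row = begin
      det n M
    ≈⟨ det-linear p M (set M p (Y zero)) (set M p rest) (x zero) 1#
         (λ j → trans (row j) (+-cong (*-congˡ (sym (set-p M p (Y zero) j)))
           (trans (sym (*-identityˡ _)) (*-congˡ (sym (set-p M p rest j))))))
         (λ i i≢p j → sym (set-≢ M p (Y zero) i i≢p j))
         (λ i i≢p j → sym (set-≢ M p rest i i≢p j)) ⟩
      x zero * det n (set M p (Y zero)) + 1# * det n (set M p rest)
    ≈⟨ +-congˡ (trans (*-identityˡ _) (det-sum-row r p (set M p rest) (λ k → x (suc k)) (λ k → Y (suc k))
         (λ j → set-p M p rest j))) ⟩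
      x zero * det n (set M p (Y zero)) + sum (λ k → x (suc k) * det n (set (set M p rest) p (Y (suc k))))
    ≈⟨ +-congˡ (sum-cong _ (λ k → x (suc k) * det n (set M p (Y (suc k)))) (λ k → *-congˡ
         (det-cong n _ (set M p (Y (suc k))) (overwrite (Y (suc k)))))) ⟩
      sum (λ k → x k * det n (set M p (Y k))) ∎
    where
    rest : Fin n → Carrier
    rest j = sum (λ k → x (suc k) * Y (suc k) j)
    overwrite : ∀ y i j → set (set M p rest) p y i j ≈ set M p y i j
    overwrite y i j with i ≟ p
    ... | yes ≡.refl = trans (set-p (set M p rest) p y j) (sym (set-p M p y j))
    ... | no i≢p     = trans (set-≢ (set M p rest) p y i i≢p j)
                         (trans (set-≢ M p rest i i≢p j) (sym (set-≢ M p y i i≢p j)))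

  -- Every row is a combination of the `r` rows of `Y`. Expanding the rows one at a time by
  -- multilinearity leaves determinants whose rows are all rows of `Y`, and by the pigeonhole
  -- principle two of them coincide. In `G t g` the rows from `t` on are already replaced, with `g`
  -- recording the choice.
  det-low-rank : ∀ {n r} → r ℕ.< n → (X : Fin n → Fin r → Carrier) (Y : Fin r → Fin n → Carrier) →
    det n (λ i j → sum (λ k → X i k * Y k j)) ≈ 0#
  det-low-rank {zero} ()
  det-low-rank {suc n} {zero}  r<n X Y = sum-zero (laplace {n} (λ i j → 0#)) (λ j → trans (*-congˡ (zeroˡ _)) (zeroʳ _))
  det-low-rank {suc n} {suc r} r<n X Y = trans
    (det-cong (suc n) _ (G (suc n) (λ _ → zero)) (λ i j → reflexive (≡.cong-app (≡.sym (below-n i _ (Y zero))) j)))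
    (G≈0 (suc n) (λ _ → zero))
    where
    XY : Fin (suc n) → Fin (suc n) → Carrier
    XY i j = sum (λ k → X i k * Y k j)
    G : ℕ → (Fin (suc n) → Fin (suc r)) → Mat (suc n)
    G t g i = below t i (XY i) (Y (g i))
    G≈0 : ∀ t g → det (suc n) (G t g) ≈ 0#
    G≈0 zero    g with Fin.pigeonhole r<n g
    ... | i , j , i<j , gi≡gj = alternates-< i j i<j (G 0 g) (λ k → reflexive (≡.cong (λ l → Y l k) gi≡gj))
    G≈0 (suc t) g with row-at? (suc n) t
    ... | inj₂ none = trans (det-cong (suc n) _ (G t g)
            (λ i j → reflexive (≡.cong-app (below-suc-≢ t i (none i) (XY i) (Y (g i))) j))) (G≈0 t g)
    ... | inj₁ (p , ≡.refl) = trans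
            (det-sum-row (suc r) p (G (suc t) g) (X p) Y (λ j → reflexive (≡.cong-app (below-suc-≡ p (XY p) (Y (g p))) j)))
            (sum-zero (λ k → X p k * det (suc n) (set (G (suc t) g) p (Y k))) λ k → trans (*-congˡ (trans (det-cong (suc n) _ (G t (g' k)) (entry k)) (G≈0 t (g' k)))) (zeroʳ _))
      where
      g' : Fin (suc r) → Fin (suc n) → Fin (suc r)
      g' k = updateAt g p (const k)
      entry : ∀ k i j → set (G (suc t) g) p (Y k) i j ≈ G t (g' k) i j
      entry k i j with i ≟ p
      ... | yes ≡.refl = trans (set-p (G (suc t) g) p (Y k) j) (reflexive (≡.cong-app (≡.sym
              (≡.trans (below-≡ p (XY p) (Y (g' k p))) (≡.cong Y (updateAt-updates p g)))) j))
      ... | no i≢p     = trans (set-≢ (G (suc t) g) p (Y k) i i≢p j) (reflexive (≡.cong-app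
              (≡.trans (below-suc-≢ t i (i≢p ∘ Fin.toℕ-injective) (XY i) (Y (g i)))
                (≡.cong (λ l → below t i (XY i) (Y l)) (≡.sym (updateAt-minimal i p g i≢p)))) j))

-- Symmetric pencils: order of vanishing of the determinant against rank

module Ranks where

  open import Data.Integer as ℤ using (ℤ; +_; 0ℤ; 1ℤ)
  open import Relation.Binary.PropositionalEquality as ≡ using (_≡_; _≢_)
  open import Data.Product using (∃; _×_; _,_; proj₁; proj₂)
  open import Level using (_⊔_)
  open import Data.Nat as ℕ using (ℕ; zero; suc)
  import Data.Nat.Properties as ℕ
  import Data.Integer.Properties as ℤ
  open import Data.Integer.Solver using (module +-*-Solver)
  open import Data.Fin using (Fin; zero; suc; toℕ; punchIn)
  import Data.Fin.Properties as Fin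
  open import Data.Sum using (inj₁; inj₂)
  open import Relation.Nullary using (yes; no; contradiction; ¬?)
  open import Relation.Nullary.Decidable using (decidable-stable)

  -- `ev` is the value at y = 0: a homomorphism to ℤ whose kernel is generated by the cancellable
  -- element `y`. This is all that the pivoting argument knows about polynomials.
  record Evaluation {o ℓ} (R : CommutativeRing o ℓ) : Set (o ⊔ ℓ) where
    open CommutativeRing R using (Carrier; _≈_; _+_; _*_; -_; 0#; 1#)
    field
      y        : Carrier
      ev       : Carrier → ℤ
      ev-cong  : ∀ {a b} → a ≈ b → ev a ≡ ev b
      ev-+     : ∀ a b → ev (a + b) ≡ ev a ℤ.+ ev b
      ev-*     : ∀ a b → ev (a * b) ≡ ev a ℤ.* ev b
      ev-neg   : ∀ a → ev (- a) ≡ ℤ.- ev a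
      ev-0     : ev 0# ≡ 0ℤ
      ev-1     : ev 1# ≡ 1ℤ
      ev-y     : ev y ≡ 0ℤ
      quotient : ∀ a → ev a ≡ 0ℤ → ∃ λ q → a ≈ y * q
      cancel   : ∀ a b → y * a ≈ y * b → a ≈ b

  module Z = Determinants ℤ.+-*-commutativeRing
  module ZS = +-*-Solver

  Matℤ : ℕ → Set
  Matℤ n = Fin n → Fin n → ℤ

  -- Rank at most `r` over ℚ, with the denominators of the factorisation collected in `c`.
  record Factor (r : ℕ) {n : ℕ} (A : Matℤ n) : Set where
    field
      c   : ℤ
      c≢0 : c ≢ 0ℤ
      X   : Fin n → Fin r → ℤ
      Y   : Fin r → Fin n → ℤ
      eq  : ∀ i j → c ℤ.* A i j ≡ Z.sum (λ k → X i k ℤ.* Y k j)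

  *≢0 : ∀ {a b} → a ≢ 0ℤ → b ≢ 0ℤ → a ℤ.* b ≢ 0ℤ
  *≢0 {a} a≢0 b≢0 ab≡0 with ℤ.i*j≡0⇒i≡0∨j≡0 a ab≡0
  ... | inj₁ a≡0 = a≢0 a≡0
  ... | inj₂ b≡0 = b≢0 b≡0

  -- Scaling its rows by `c` multiplies an m × m minor by a nonzero power of `c`, and the scaled
  -- minor factors through dimension r < m.
  minors-vanish : ∀ {r n m} {A : Matℤ n} → Factor r A → r ℕ.< m → (s t : Fin m → Fin n) →
    Z.det m (λ i j → A (s i) (t j)) ≡ 0ℤ
  minors-vanish {m = m} {A} F r<m s t with ℤ.i*j≡0⇒i≡0∨j≡0 (Z.∏ {m} (λ _ → c)) scaled≡0
    where
    open Factor F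
    scaled≡0 : Z.∏ {m} (λ _ → c) ℤ.* Z.det m (λ i j → A (s i) (t j)) ≡ 0ℤ
    scaled≡0 = ≡.trans (≡.sym (Z.det-scale m (λ _ → c) (λ i j → A (s i) (t j))))
      (≡.trans (Z.det-cong m _ _ (λ i j → eq (s i) (t j)))
        (Z.det-low-rank r<m (λ i → X (s i)) (λ k j → Y k (t j))))
  ... | inj₂ d≡0 = d≡0
  ... | inj₁ ∏≡0 = contradiction ∏≡0 (∏≢0 m)
    where
    ∏≢0 : ∀ m → Z.∏ {m} (λ _ → Factor.c F) ≢ 0ℤ
    ∏≢0 zero    ()
    ∏≢0 (suc m) = *≢0 (Factor.c≢0 F) (∏≢0 m)

  factor-neg : ∀ {r n} {A A' : Matℤ n} → (∀ i j → A i j ≡ ℤ.- A' i j) → Factor r A → Factor r A'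
  factor-neg {A' = A'} A≡ F = record
    { c = ℤ.- c ; c≢0 = λ -c≡0 → c≢0 (≡.trans (≡.sym (ℤ.neg-involutive c)) (≡.cong ℤ.-_ -c≡0)) ; X = X ; Y = Y
    ; eq = λ i j → ≡.trans (≡.trans (≡.sym (ℤ.neg-distribˡ-* c (A' i j))) (ℤ.neg-distribʳ-* c (A' i j)))
        (≡.trans (≡.cong (c ℤ.*_) (≡.sym (A≡ i j))) (eq i j)) }
    where open Factor F

  module Corank {o ℓ} (R : CommutativeRing o ℓ) (V : Evaluation R) where

    open CommutativeRing R hiding (zero)
    open Evaluation V
    open import Algebra.Properties.Semiring.Exp semiring using (_^_)
    open import Algebra.Properties.Semiring.Sum semiring using (sum; ∑-comm)
    open import Relation.Binary.Reasoning.Setoid setoid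
    open Determinants R using (Mat; minor; det; det-cong; det-ᵀ; det-scale; det-addRows; det-block; ∏; sum-cong; sum-*; sum-+; sum-zero; sg; laplace)
    open IntegerSolver R using (solve; _:=_; _:+_; _:*_; :-_; con)

    mv : ∀ {m n} → (Fin m → Fin n → Carrier) → (Fin n → Carrier) → Fin m → Carrier
    mv S v i = sum (λ j → S i j * v j)

    quad : ∀ {n} → Mat n → (Fin n → Carrier) → Carrier
    quad S v = sum (λ i → v i * mv S v i)

    Symmetric : ∀ {n} → Mat n → Set _
    Symmetric S = ∀ i j → S i j ≈ S j i

    -- Writing S = S₀ + y S₁ + O(y²), this says that the form S₁ is anisotropic on the kernel of S₀.
    Nondegenerate : ∀ {n} → Mat n → Set _
    Nondegenerate {n} S = ∀ (v : Fin n → Carrier) → (∀ i → ev (mv S v i) ≡ 0ℤ) →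
      (∃ λ q → quad S v ≈ y * (y * q)) → ∀ i → ev (v i) ≡ 0ℤ

    y^_∣_ : ℕ → Carrier → Set _
    y^ k ∣ a = ∃ λ q → a ≈ y ^ k * q

    ev-y* : ∀ a → ev (y * a) ≡ 0ℤ
    ev-y* a = ≡.trans (ev-* y a) (≡.trans (≡.cong (ℤ._* ev a) ev-y) (ℤ.*-zeroˡ (ev a)))

    -- `y` is prime, since its quotient ℤ is a domain: each factor `y` of a product with `a` must
    -- come from `d`, and can be cancelled.
    y^∣-coprime : ∀ k {a d} → ev a ≢ 0ℤ → y^ k ∣ (a * d) → y^ k ∣ d
    y^∣-coprime zero    {a} {d} a≢0 _ = d , sym (*-identityˡ d)
    y^∣-coprime (suc k) {a} {d} a≢0 (q , eq) with quotient d d≡0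
      where
      ad≡0 : ev a ℤ.* ev d ≡ 0ℤ
      ad≡0 = ≡.trans (≡.sym (ev-* a d)) (≡.trans (ev-cong (trans eq (*-assoc _ _ _))) (ev-y* (y ^ k * q)))
      d≡0 : ev d ≡ 0ℤ
      d≡0 with ℤ.i*j≡0⇒i≡0∨j≡0 (ev a) ad≡0
      ... | inj₁ a≡0 = contradiction a≡0 a≢0
      ... | inj₂ d≡0 = d≡0
    ... | d' , d≈yd' with y^∣-coprime k {a} {d'} a≢0 (q , cancel (a * d') (y ^ k * q) (begin
        y * (a * d')       ≈⟨ solve 3 (λ y a d → (y :* (a :* d) := a :* (y :* d))) refl y a d' ⟩
        a * (y * d')       ≈⟨ *-congˡ d≈yd' ⟨
        a * d              ≈⟨ eq ⟩
        y ^ suc k * q      ≈⟨ *-assoc _ _ _ ⟩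
        y * (y ^ k * q)    ∎))
    ... | q' , eq' = q' , trans d≈yd' (trans (*-congˡ eq') (sym (*-assoc _ _ _)))

    Conclusion : ℕ → ∀ {n} → Mat n → Set
    Conclusion k {n} S = ∃ λ r → (r ℕ.+ k ℕ.≤ n) × Factor r (λ i j → ev (S i j))

    -- `α` is 1 for a corner that is nonzero at y = 0, and `y` for a first row that vanishes there;
    -- (a, b) is the first row with `α` divided out. `S'` is `a` times the Schur complement D - α b
    -- bᵀ / a, which avoids division by `a`.
    module Schur {m} (S : Mat (suc m)) (S-sym : Symmetric S) (S-nd : Nondegenerate S)
      (α a : Carrier) (b : Fin m → Carrier)
      (S₀₀ : S zero zero ≈ α * a) (S₀ : ∀ j → S zero (suc j) ≈ α * b j) (a≢0 : ev a ≢ 0ℤ) where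

      D : Mat m
      D i j = S (suc i) (suc j)

      S' : Mat m
      S' i j = a * D i j + (α * - b i) * b j

      S'-sym : Symmetric S'
      S'-sym i j = +-cong (*-congˡ (S-sym (suc i) (suc j)))
        (solve 3 (λ α x z → ((α :* :- x) :* z := (α :* :- z) :* x)) refl α (b i) (b j))

      -- The vector w = (-b·v, a v) satisfies S w = (0, S' v) and therefore wᵀ S w = a vᵀ S' v. The
      -- hypotheses on `v` thus pass to `w`, and a factor `a` with nonzero value can be removed from
      -- the conclusion.
      S'-nd : Nondegenerate S'
      S'-nd v S'v≡0 (q , vS'v≈) i = unscale (S-nd w Sw≡0 (a * q , wSw≈) (suc i))
        where
        β : Carrier
        β = sum (λ j → b j * v j)
        w : Fin (suc m) → Carrier
        w zero    = - β
        w (suc j) = a * v j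
        Sw₀ : mv S w zero ≈ 0#
        Sw₀ = begin
            S zero zero * - β + sum (λ j → S zero (suc j) * (a * v j))
          ≈⟨ +-cong (*-congʳ S₀₀) (sum-cong _ (λ j → (α * a) * (b j * v j)) λ j → trans (*-congʳ (S₀ j))
               (solve 4 (λ α b a v → ((α :* b) :* (a :* v) := (α :* a) :* (b :* v))) refl α (b j) a (v j))) ⟩
            (α * a) * - β + sum (λ j → (α * a) * (b j * v j))
          ≈⟨ +-congˡ (sum-* (α * a) (λ j → b j * v j)) ⟨
            (α * a) * - β + (α * a) * β
          ≈⟨ solve 2 (λ x β → (x :* :- β :+ x :* β := con (+ 0))) refl (α * a) β ⟩
            0# ∎
        Sw-suc : ∀ i → mv S w (suc i) ≈ mv S' v i
        Sw-suc i = begin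
            S (suc i) zero * - β + sum (λ j → D i j * (a * v j))
          ≈⟨ +-cong (*-congʳ (trans (S-sym (suc i) zero) (S₀ i))) (sum-cong _ (λ j → a * (D i j * v j)) λ j →
               solve 3 (λ d a v → (d :* (a :* v) := a :* (d :* v))) refl (D i j) a (v j)) ⟩
            (α * b i) * - β + sum (λ j → a * (D i j * v j))
          ≈⟨ trans (+-cong (solve 3 (λ α b β → ((α :* b) :* :- β := (α :* :- b) :* β)) refl α (b i) β) refl) (+-comm _ _) ⟩
            sum (λ j → a * (D i j * v j)) + (α * - b i) * β
          ≈⟨ +-congˡ (sum-* (α * - b i) (λ j → b j * v j)) ⟩
            sum (λ j → a * (D i j * v j)) + sum (λ j → (α * - b i) * (b j * v j))
          ≈⟨ sum-+ (λ j → a * (D i j * v j)) (λ j → (α * - b i) * (b j * v j)) ⟨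
            sum (λ j → a * (D i j * v j) + (α * - b i) * (b j * v j))
          ≈⟨ sum-cong _ (λ j → S' i j * v j) (λ j →
               solve 5 (λ a d v x b → (a :* (d :* v) :+ x :* (b :* v) := (a :* d :+ x :* b) :* v)) refl
                 a (D i j) (v j) (α * - b i) (b j)) ⟩
            mv S' v i ∎
        Sw≡0 : ∀ i → ev (mv S w i) ≡ 0ℤ
        Sw≡0 zero    = ≡.trans (ev-cong Sw₀) ev-0
        Sw≡0 (suc i) = ≡.trans (ev-cong (Sw-suc i)) (S'v≡0 i)
        wSw≈ : quad S w ≈ y * (y * (a * q))
        wSw≈ = begin
            - β * mv S w zero + sum (λ i → (a * v i) * mv S w (suc i))
          ≈⟨ +-cong (trans (*-congˡ Sw₀) (zeroʳ _)) (sum-cong _ (λ i → a * (v i * mv S' v i)) λ i →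
               trans (*-congˡ (Sw-suc i)) (*-assoc _ _ _)) ⟩
            0# + sum (λ i → a * (v i * mv S' v i))
          ≈⟨ trans (+-identityˡ _) (sym (sum-* a (λ i → v i * mv S' v i))) ⟩
            a * quad S' v
          ≈⟨ *-congˡ vS'v≈ ⟩
            a * (y * (y * q))
          ≈⟨ solve 3 (λ a y q → (a :* (y :* (y :* q)) := y :* (y :* (a :* q)))) refl a y q ⟩
            y * (y * (a * q)) ∎
        unscale : ∀ {x} → ev (a * x) ≡ 0ℤ → ev x ≡ 0ℤ
        unscale {x} ax≡0 with ℤ.i*j≡0⇒i≡0∨j≡0 (ev a) (≡.trans (≡.sym (ev-* a x)) ax≡0)
        ... | inj₁ a≡0 = contradiction a≡0 a≢0
        ... | inj₂ x≡0 = x≡0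

      P : Carrier
      P = ∏ {m} (λ _ → a)

      -- Take `α` out of row 0, multiply the other rows by `a`, which accounts for P = a^m, and
      -- subtract α b i times row 0 from row i. Column 0 is then zero below the corner `a`.
      det-schur : P * det (suc m) S ≈ α * (a * det m S')
      det-schur = begin
          P * det (suc m) S
        ≈⟨ *-congˡ (det-cong (suc m) S (λ i j → x i * M i j) S≈xM) ⟩
          P * det (suc m) (λ i j → x i * M i j)
        ≈⟨ *-congˡ (det-scale (suc m) x M) ⟩
          P * ((α * ∏ {m} (λ _ → 1#)) * det (suc m) M)
        ≈⟨ *-congˡ (*-congʳ (trans (*-congˡ (∏1 m)) (*-identityʳ α))) ⟩
          P * (α * det (suc m) M)
        ≈⟨ solve 3 (λ p α d → (p :* (α :* d) := α :* ((con (+ 1) :* p) :* d))) refl P α (det (suc m) M) ⟩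
          α * ((1# * P) * det (suc m) M)
        ≈⟨ *-congˡ (det-scale (suc m) z M) ⟨
          α * det (suc m) M₂
        ≈⟨ *-congˡ (det-addRows zero u M₂ refl) ⟨
          α * det (suc m) M₃
        ≈⟨ *-congˡ (det-block M₃ (λ i → solve 3 (λ a α b → (a :* (α :* b) :+ (α :* :- b) :* (con (+ 1) :* a) := con (+ 0))) refl
             a α (b i))) ⟩
          α * (M₃ zero zero * det m (minor M₃ zero))
        ≈⟨ *-congˡ (*-cong (solve 1 (λ a → (con (+ 1) :* a :+ con (+ 0) :* (con (+ 1) :* a) := a)) refl a)
             (det-cong m (minor M₃ zero) S' λ i j → +-congˡ (*-congˡ (*-identityˡ _)))) ⟩
          α * (a * det m S') ∎
        where
        M : Mat (suc m)
        M zero    zero    = a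
        M zero    (suc j) = b j
        M (suc i) zero    = α * b i
        M (suc i) (suc j) = D i j
        x : Fin (suc m) → Carrier
        x zero    = α
        x (suc i) = 1#
        S≈xM : ∀ i j → S i j ≈ x i * M i j
        S≈xM zero    zero    = S₀₀
        S≈xM zero    (suc j) = S₀ j
        S≈xM (suc i) zero    = trans (trans (S-sym (suc i) zero) (S₀ i)) (sym (*-identityˡ _))
        S≈xM (suc i) (suc j) = sym (*-identityˡ _)
        ∏1 : ∀ m → ∏ {m} (λ _ → 1#) ≈ 1#
        ∏1 zero    = refl
        ∏1 (suc m) = trans (*-identityˡ _) (∏1 m)
        z : Fin (suc m) → Carrier
        z zero    = 1#
        z (suc i) = a
        M₂ : Mat (suc m)
        M₂ i j = z i * M i j
        u : Fin (suc m) → Carrier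
        u zero    = 0#
        u (suc i) = α * - b i
        M₃ : Mat (suc m)
        M₃ i j = M₂ i j + u i * M₂ zero j

      ev-S' : ∀ i j → ev (S' i j) ≡ ev a ℤ.* ev (D i j) ℤ.+ (ev α ℤ.* (ℤ.- ev (b i))) ℤ.* ev (b j)
      ev-S' i j = ≡.trans (ev-+ _ _) (≡.cong₂ ℤ._+_ (ev-* _ _)
        (≡.trans (ev-* _ _) (≡.cong (ℤ._* ev (b j)) (≡.trans (ev-* _ _) (≡.cong (ev α ℤ.*_) (ev-neg _))))))

      -- The first row and column of S vanish at y = 0.
      factor-ramified : ev α ≡ 0ℤ → ∀ {r} → Factor r (λ i j → ev (S' i j)) → Factor r (λ i j → ev (S i j))
      factor-ramified α≡0 {r} F = record
        { c = c ℤ.* ev a ; c≢0 = *≢0 c≢0 a≢0 ; X = X' ; Y = Y' ; eq = eq' }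
        where
        open Factor F
        X' : Fin (suc m) → Fin r → ℤ
        X' zero    k = 0ℤ
        X' (suc i) k = X i k
        Y' : Fin r → Fin (suc m) → ℤ
        Y' k zero    = 0ℤ
        Y' k (suc j) = Y k j
        ev-α* : ∀ {s x} → s ≈ α * x → c ℤ.* ev a ℤ.* ev s ≡ 0ℤ
        ev-α* {s} {x} s≈αx = ≡.trans (≡.cong (c ℤ.* ev a ℤ.*_) (≡.trans (ev-cong s≈αx) (≡.trans (ev-* α x)
          (≡.trans (≡.cong (ℤ._* ev x) α≡0) (ℤ.*-zeroˡ (ev x)))))) (ℤ.*-zeroʳ (c ℤ.* ev a))
        eq' : ∀ i j → c ℤ.* ev a ℤ.* ev (S i j) ≡ Z.sum (λ k → X' i k ℤ.* Y' k j)
        eq' zero    zero    = ≡.trans (ev-α* S₀₀) (≡.sym (Z.sum-zero {r} (λ k → 0ℤ ℤ.* 0ℤ) (λ k → ≡.refl)))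
        eq' zero    (suc j) = ≡.trans (ev-α* (S₀ j)) (≡.sym (Z.sum-zero (λ k → 0ℤ ℤ.* Y k j) (λ k → ℤ.*-zeroˡ (Y k j))))
        eq' (suc i) zero    = ≡.trans (ev-α* (trans (S-sym (suc i) zero) (S₀ i)))
                                (≡.sym (Z.sum-zero (λ k → X i k ℤ.* 0ℤ) (λ k → ℤ.*-zeroʳ (X i k))))
        eq' (suc i) (suc j) = ≡.trans (≡.trans
          (ZS.solve 5 (λ c a d b b' → (c ZS.:* a ZS.:* d ZS.:= c ZS.:* (a ZS.:* d ZS.:+ (ZS.con (+ 0) ZS.:* (ZS.:- b)) ZS.:* b')))
            ≡.refl c (ev a) (ev (D i j)) (ev (b i)) (ev (b j)))
          (≡.cong (c ℤ.*_) (≡.trans (≡.cong (λ α → ev a ℤ.* ev (D i j) ℤ.+ (α ℤ.* (ℤ.- ev (b i))) ℤ.* ev (b j)) (≡.sym α≡0))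
            (≡.sym (ev-S' i j))))) (eq i j)

      -- At y = 0 with α = 1, the matrix c a S is the sum of c (a, b)ᵀ (a, b) and of c S' bordered
      -- by zeros: one rank-one term more than for `S'`.
      factor-unit : ev α ≡ 1ℤ → ∀ {r} → Factor r (λ i j → ev (S' i j)) → Factor (suc r) (λ i j → ev (S i j))
      factor-unit α≡1 {r} F = record
        { c = c ℤ.* ev a ; c≢0 = *≢0 c≢0 a≢0 ; X = X' ; Y = Y' ; eq = eq' }
        where
        open Factor F
        X' : Fin (suc m) → Fin (suc r) → ℤ
        X' zero    zero    = c ℤ.* ev a
        X' zero    (suc k) = 0ℤ
        X' (suc i) zero    = c ℤ.* ev (b i)
        X' (suc i) (suc k) = X i k
        Y' : Fin (suc r) → Fin (suc m) → ℤ
        Y' zero    zero    = ev a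
        Y' zero    (suc j) = ev (b j)
        Y' (suc k) zero    = 0ℤ
        Y' (suc k) (suc j) = Y k j
        ev-α* : ∀ {s x} → s ≈ α * x → ev s ≡ ev x
        ev-α* {s} {x} s≈αx = ≡.trans (ev-cong s≈αx) (≡.trans (ev-* α x)
          (≡.trans (≡.cong (ℤ._* ev x) α≡1) (ℤ.*-identityˡ (ev x))))
        plus-0 : ∀ {x z s} → x ≡ z → s ≡ 0ℤ → x ≡ z ℤ.+ s
        plus-0 {z = z} ≡.refl ≡.refl = ≡.sym (ℤ.+-identityʳ z)
        eq' : ∀ i j → c ℤ.* ev a ℤ.* ev (S i j) ≡ Z.sum (λ k → X' i k ℤ.* Y' k j)
        eq' zero    zero    = plus-0 (≡.cong (c ℤ.* ev a ℤ.*_) (ev-α* S₀₀)) (Z.sum-zero {r} (λ k → 0ℤ ℤ.* 0ℤ) (λ k → ≡.refl))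
        eq' zero    (suc j) = plus-0 (≡.cong (c ℤ.* ev a ℤ.*_) (ev-α* (S₀ j)))
                                (Z.sum-zero (λ k → 0ℤ ℤ.* Y k j) (λ k → ℤ.*-zeroˡ (Y k j)))
        eq' (suc i) zero    = plus-0
          (≡.trans (≡.cong (c ℤ.* ev a ℤ.*_) (ev-α* (trans (S-sym (suc i) zero) (S₀ i))))
            (ZS.solve 3 (λ c a b → (c ZS.:* a ZS.:* b ZS.:= c ZS.:* b ZS.:* a)) ≡.refl c (ev a) (ev (b i))))
          (Z.sum-zero (λ k → X i k ℤ.* 0ℤ) (λ k → ℤ.*-zeroʳ (X i k)))
        eq' (suc i) (suc j) = ≡.trans
          (ZS.solve 5 (λ c a d b b' → (c ZS.:* a ZS.:* d ZS.:= c ZS.:* b ZS.:* b' ZS.:+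
              c ZS.:* (a ZS.:* d ZS.:+ (ZS.con (+ 1) ZS.:* (ZS.:- b)) ZS.:* b')))
            ≡.refl c (ev a) (ev (D i j)) (ev (b i)) (ev (b j)))
          (≡.cong (λ s → c ℤ.* ev (b i) ℤ.* ev (b j) ℤ.+ s) (≡.trans
            (≡.cong (c ℤ.*_) (≡.trans (≡.cong (λ α → ev a ℤ.* ev (D i j) ℤ.+ (α ℤ.* (ℤ.- ev (b i))) ℤ.* ev (b j)) (≡.sym α≡1))
              (≡.sym (ev-S' i j)))) (eq i j)))

    δ : ∀ {n} → Fin n → Fin n → Carrier
    δ zero    zero    = 1#
    δ zero    (suc j) = 0#
    δ (suc i) zero    = 0#
    δ (suc i) (suc j) = δ i j

    sum-δ : ∀ {n} (f : Fin n → Carrier) j → sum (λ i → f i * δ i j) ≈ f j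
    sum-δ {suc n} f zero    = trans (+-cong (*-identityʳ _) (sum-zero (λ i → f (suc i) * 0#) (λ i → zeroʳ _))) (+-identityʳ _)
    sum-δ {suc n} f (suc j) = trans (+-cong (zeroʳ _) (sum-δ (λ i → f (suc i)) j)) (+-identityˡ _)

    -- Passes from S to T S Tᵀ, where T adds `ε` times row `suc j` to row 0. This makes the corner
    -- nonzero at y = 0 when it vanishes there but its row does not. `τ` is T acting on vectors,
    -- `τ*` its transpose, and `τ⁻` its inverse at y = 0.
    module Congruence {m} (S : Mat (suc m)) (S-sym : Symmetric S) (S-nd : Nondegenerate S) (j : Fin m) (ε : Carrier) where

      τ : (Fin (suc m) → Carrier) → Fin (suc m) → Carrier
      τ f zero    = f zero + ε * f (suc j)
      τ f (suc i) = f (suc i)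

      rowOp : Mat (suc m) → Mat (suc m)
      rowOp M i k = τ (λ l → M l k) i

      det-rowOp : ∀ M → det (suc m) (rowOp M) ≈ det (suc m) M
      det-rowOp M = trans (det-cong (suc m) (rowOp M) (λ i k → M i k + x i * M (suc j) k) entry) (det-addRows (suc j) x M refl)
        where
        x : Fin (suc m) → Carrier
        x zero    = ε
        x (suc i) = 0#
        entry : ∀ i k → rowOp M i k ≈ M i k + x i * M (suc j) k
        entry zero    k = refl
        entry (suc i) k = sym (trans (+-congˡ (zeroˡ _)) (+-identityʳ _))

      S'' : Mat (suc m)
      S'' i k = τ (rowOp S i) k

      det-S'' : det (suc m) S'' ≈ det (suc m) S
      det-S'' = begin
        det (suc m) S''                          ≈⟨ det-ᵀ (suc m) S'' ⟨
        det (suc m) (rowOp (λ k i → rowOp S i k)) ≈⟨ det-rowOp (λ k i → rowOp S i k) ⟩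
        det (suc m) (λ k i → rowOp S i k)        ≈⟨ det-ᵀ (suc m) (rowOp S) ⟩
        det (suc m) (rowOp S)                    ≈⟨ det-rowOp S ⟩
        det (suc m) S                            ∎

      S''-sym : Symmetric S''
      S''-sym zero    zero    = refl
      S''-sym zero    (suc k) = +-cong (S-sym zero (suc k)) (*-congˡ (S-sym (suc j) (suc k)))
      S''-sym (suc i) zero    = +-cong (S-sym (suc i) zero) (*-congˡ (S-sym (suc i) (suc j)))
      S''-sym (suc i) (suc k) = S-sym (suc i) (suc k)

      τ* : (Fin (suc m) → Carrier) → Fin (suc m) → Carrier
      τ* v zero    = v zero
      τ* v (suc k) = v (suc k) + δ k j * (ε * v zero)

      τ-adjoint : ∀ f v → sum (λ k → τ f k * v k) ≈ sum (λ k → f k * τ* v k)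
      τ-adjoint f v = begin
          (f zero + ε * f (suc j)) * v zero + s
        ≈⟨ solve 5 (λ f e g v s → ((f :+ e :* g) :* v :+ s := f :* v :+ (s :+ (e :* v) :* g))) refl
             (f zero) ε (f (suc j)) (v zero) s ⟩
          f zero * v zero + (s + (ε * v zero) * f (suc j))
        ≈⟨ +-congˡ (+-congˡ (trans (*-congˡ (sym (sum-δ (λ k → f (suc k)) j))) (sum-* (ε * v zero) (λ k → f (suc k) * δ k j)))) ⟩
          f zero * v zero + (s + sum (λ k → (ε * v zero) * (f (suc k) * δ k j)))
        ≈⟨ +-congˡ (sum-+ (λ k → f (suc k) * v (suc k)) (λ k → (ε * v zero) * (f (suc k) * δ k j))) ⟨
          f zero * v zero + sum (λ k → f (suc k) * v (suc k) + (ε * v zero) * (f (suc k) * δ k j))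
        ≈⟨ +-congˡ (sum-cong _ (λ k → f (suc k) * τ* v (suc k)) (λ k →
             solve 4 (λ f v e d → (f :* v :+ e :* (f :* d) := f :* (v :+ d :* e))) refl (f (suc k)) (v (suc k)) (ε * v zero) (δ k j))) ⟩
          sum (λ k → f k * τ* v k) ∎
        where s = sum (λ k → f (suc k) * v (suc k))

      -- With w = Tᵀ v one has S'' v = T (S w) and vᵀ S'' v = wᵀ S w. Both T and Tᵀ are unipotent,
      -- so vanishing at y = 0 can be carried back through them.
      S''-nd : Nondegenerate S''
      S''-nd v S''v≡0 (q , vS''v≈) = v≡0
        where
        w : Fin (suc m) → Carrier
        w = τ* v
        mv-τ : ∀ i → mv S'' v i ≈ τ (mv S w) i
        mv-τ zero    = begin
            mv S'' v zero
          ≈⟨ τ-adjoint (rowOp S zero) v ⟩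
            sum (λ k → (S zero k + ε * S (suc j) k) * w k)
          ≈⟨ sum-cong _ (λ k → S zero k * w k + ε * (S (suc j) k * w k)) (λ k → trans (distribʳ _ _ _) (+-congˡ (*-assoc _ _ _))) ⟩
            sum (λ k → S zero k * w k + ε * (S (suc j) k * w k))
          ≈⟨ trans (sum-+ (λ k → S zero k * w k) (λ k → ε * (S (suc j) k * w k)))
               (+-congˡ (sym (sum-* ε (λ k → S (suc j) k * w k)))) ⟩
            mv S w zero + ε * mv S w (suc j) ∎
        mv-τ (suc i) = τ-adjoint (S (suc i)) v
        Sw-suc≡0 : ∀ i → ev (mv S w (suc i)) ≡ 0ℤ
        Sw-suc≡0 i = ≡.trans (ev-cong (sym (mv-τ (suc i)))) (S''v≡0 (suc i))
        Sw≡0 : ∀ i → ev (mv S w i) ≡ 0ℤ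
        Sw≡0 (suc i) = Sw-suc≡0 i
        Sw≡0 zero    = ≡.trans (≡.sym (ℤ.+-identityʳ _)) (≡.trans
          (≡.cong (λ z → ev (mv S w zero) ℤ.+ z) (≡.sym
            (≡.trans (ev-* ε _) (≡.trans (≡.cong (ev ε ℤ.*_) (Sw-suc≡0 j)) (ℤ.*-zeroʳ (ev ε))))))
          (≡.trans (≡.sym (ev-+ _ _)) (≡.trans (ev-cong (sym (mv-τ zero))) (S''v≡0 zero))))
        wSw≈ : quad S w ≈ y * (y * q)
        wSw≈ = begin
            sum (λ i → w i * mv S w i)       ≈⟨ sum-cong _ (λ i → mv S w i * w i) (λ i → *-comm _ _) ⟩
            sum (λ i → mv S w i * τ* v i)    ≈⟨ τ-adjoint (mv S w) v ⟨
            sum (λ i → τ (mv S w) i * v i)   ≈⟨ sum-cong _ (λ i → v i * mv S'' v i) (λ i → trans (*-congʳ (sym (mv-τ i))) (*-comm _ _)) ⟩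
            quad S'' v                       ≈⟨ vS''v≈ ⟩
            y * (y * q)                      ∎
        w≡0 : ∀ i → ev (w i) ≡ 0ℤ
        w≡0 = S-nd w Sw≡0 (q , wSw≈)
        v≡0 : ∀ i → ev (v i) ≡ 0ℤ
        v≡0 zero    = w≡0 zero
        v≡0 (suc k) = ≡.trans (≡.sym (≡.trans (ev-+ (v (suc k)) (δ k j * (ε * v zero)))
          (≡.trans (≡.cong (λ z → ev (v (suc k)) ℤ.+ z) tail≡0) (ℤ.+-identityʳ _)))) (w≡0 (suc k))
          where
          tail≡0 : ev (δ k j * (ε * v zero)) ≡ 0ℤ
          tail≡0 = ≡.trans (ev-* _ _) (≡.trans (≡.cong (ev (δ k j) ℤ.*_) (≡.trans (ev-* _ _)
            (≡.trans (≡.cong (ev ε ℤ.*_) (w≡0 zero)) (ℤ.*-zeroʳ (ev ε))))) (ℤ.*-zeroʳ (ev (δ k j))))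

      private
        e = ev ε

        τ⁻ : (Fin (suc m) → ℤ) → Fin (suc m) → ℤ
        τ⁻ f zero    = f zero ℤ.+ ℤ.- e ℤ.* f (suc j)
        τ⁻ f (suc i) = f (suc i)

        τ⁻-sum : ∀ {r} (c : ℤ) (f : Fin (suc m) → ℤ) (g : Fin (suc m) → Fin r → ℤ) →
          (∀ i → c ℤ.* f i ≡ Z.sum (g i)) → ∀ i → c ℤ.* τ⁻ f i ≡ Z.sum (λ k → τ⁻ (λ l → g l k) i)
        τ⁻-sum c f g eq (suc i) = eq (suc i)
        τ⁻-sum c f g eq zero    = ≡.trans
          (ZS.solve 4 (λ c x e z → (c ZS.:* (x ZS.:+ (ZS.:- e) ZS.:* z) ZS.:= c ZS.:* x ZS.:+ (ZS.:- e) ZS.:* (c ZS.:* z)))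
            ≡.refl c (f zero) e (f (suc j)))
          (≡.trans (≡.cong₂ (λ x z → x ℤ.+ ℤ.- e ℤ.* z) (eq zero) (eq (suc j)))
            (≡.trans (≡.cong (λ z → Z.sum (g zero) ℤ.+ z) (Z.sum-* (ℤ.- e) (g (suc j))))
              (≡.sym (Z.sum-+ (g zero) (λ k → ℤ.- e ℤ.* g (suc j) k)))))

        τ⁻-*ˡ : ∀ (f : Fin (suc m) → ℤ) z i → τ⁻ (λ l → f l ℤ.* z) i ≡ τ⁻ f i ℤ.* z
        τ⁻-*ˡ f z zero    = ZS.solve 4 (λ x e w z → (x ZS.:* z ZS.:+ (ZS.:- e) ZS.:* (w ZS.:* z) ZS.:= (x ZS.:+ (ZS.:- e) ZS.:* w) ZS.:* z))
          ≡.refl (f zero) e (f (suc j)) z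
        τ⁻-*ˡ f z (suc i) = ≡.refl

        τ⁻-*ʳ : ∀ (f : Fin (suc m) → ℤ) z i → τ⁻ (λ l → z ℤ.* f l) i ≡ z ℤ.* τ⁻ f i
        τ⁻-*ʳ f z zero    = ZS.solve 4 (λ x e w z → (z ZS.:* x ZS.:+ (ZS.:- e) ZS.:* (z ZS.:* w) ZS.:= z ZS.:* (x ZS.:+ (ZS.:- e) ZS.:* w)))
          ≡.refl (f zero) e (f (suc j)) z
        τ⁻-*ʳ f z (suc i) = ≡.refl

        ev-τ : ∀ (f : Fin (suc m) → Carrier) → ev (f zero + ε * f (suc j)) ≡ ev (f zero) ℤ.+ e ℤ.* ev (f (suc j))
        ev-τ f = ≡.trans (ev-+ (f zero) (ε * f (suc j))) (≡.cong (λ z → ev (f zero) ℤ.+ z) (ev-* ε (f (suc j))))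

      ev-S''₀₀ : ev (S'' zero zero) ≡ (ev (S zero zero) ℤ.+ e ℤ.* ev (S (suc j) zero))
        ℤ.+ e ℤ.* (ev (S zero (suc j)) ℤ.+ e ℤ.* ev (S (suc j) (suc j)))
      ev-S''₀₀ = ≡.trans (ev-τ (rowOp S zero)) (≡.cong₂ (λ x z → x ℤ.+ e ℤ.* z)
        (ev-τ (λ l → S l zero)) (ev-τ (λ l → S l (suc j))))

      -- Undoing the congruence acts on the left factor by rows and on the right factor by columns,
      -- so the number of terms is unchanged.
      factor-congruence : ∀ {r} → Factor r (λ i k → ev (S'' i k)) → Factor r (λ i k → ev (S i k))
      factor-congruence {r} F = record
        { c = c ; c≢0 = c≢0 ; X = λ i k → τ⁻ (λ l → X l k) i ; Y = λ k i → τ⁻ (Y k) i ; eq = eq' }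
        where
        open Factor F
        A'' : Matℤ (suc m)
        A'' i k = ev (S'' i k)
        cancel-+ : ∀ x z → x ≡ (x ℤ.+ e ℤ.* z) ℤ.+ ℤ.- e ℤ.* z
        cancel-+ x z = ZS.solve 3 (λ x e z → (x ZS.:= (x ZS.:+ e ZS.:* z) ZS.:+ (ZS.:- e) ZS.:* z)) ≡.refl x e z
        undo-col : ∀ i k → ev (rowOp S i k) ≡ τ⁻ (A'' i) k
        undo-col i (suc k) = ≡.refl
        undo-col i zero    = ≡.trans (cancel-+ (ev (rowOp S i zero)) (ev (rowOp S i (suc j)))) (≡.cong (ℤ._+ ℤ.- e ℤ.* ev (rowOp S i (suc j))) (≡.sym (ev-τ (rowOp S i))))
        undo-row : ∀ i k → ev (S i k) ≡ τ⁻ (λ l → ev (rowOp S l k)) i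
        undo-row (suc i) k = ≡.refl
        undo-row zero    k = ≡.trans (cancel-+ (ev (S zero k)) (ev (S (suc j) k))) (≡.cong (ℤ._+ ℤ.- e ℤ.* ev (S (suc j) k)) (≡.sym (ev-τ (λ l → S l k))))
        eq' : ∀ i k → c ℤ.* ev (S i k) ≡ Z.sum (λ l → τ⁻ (λ i → X i l) i ℤ.* τ⁻ (Y l) k)
        eq' i k = ≡.trans (≡.cong (c ℤ.*_) (undo-row i k)) (≡.trans
          (τ⁻-sum c (λ i → ev (rowOp S i k)) (λ i l → X i l ℤ.* τ⁻ (Y l) k) (λ i →
            ≡.trans (≡.cong (c ℤ.*_) (undo-col i k)) (≡.trans
              (τ⁻-sum c (A'' i) (λ k l → X i l ℤ.* Y l k) (eq i) k)
              (Z.sum-cong _ _ (λ l → τ⁻-*ʳ (Y l) (X i l) k)))) i)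
          (Z.sum-cong _ _ (λ l → τ⁻-*ˡ (λ i → X i l) (τ⁻ (Y l) k) i)))

    -- Induction on the size of the matrix

    Bound : ℕ → Set _
    Bound m = ∀ (S : Mat m) → Symmetric S → Nondegenerate S → ∀ k → y^ k ∣ det m S → Conclusion k S

    unit-pivot : ∀ {m} → Bound m → ∀ (S : Mat (suc m)) → Symmetric S → Nondegenerate S → ev (S zero zero) ≢ 0ℤ →
      ∀ k → y^ k ∣ det (suc m) S → Conclusion k S
    unit-pivot {m} bound S S-sym S-nd S₀₀≢0 k (q , det≈) = conclude (bound S' S'-sym S'-nd k y^k∣det-S')
      where
      open Schur S S-sym S-nd 1# (S zero zero) (λ j → S zero (suc j)) (sym (*-identityˡ _)) (λ j → sym (*-identityˡ _)) S₀₀≢0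
      y^k∣det-S' : y^ k ∣ det m S'
      y^k∣det-S' = y^∣-coprime k S₀₀≢0 (P * q , (begin
        S zero zero * det m S'          ≈⟨ *-identityˡ _ ⟨
        1# * (S zero zero * det m S')   ≈⟨ det-schur ⟨
        P * det (suc m) S               ≈⟨ *-congˡ det≈ ⟩
        P * (y ^ k * q)                 ≈⟨ solve 3 (λ p y q → (p :* (y :* q) := y :* (p :* q))) refl P (y ^ k) q ⟩
        y ^ k * (P * q)                 ∎))
      conclude : Conclusion k S' → Conclusion k S
      conclude (r , r+k≤m , F) = suc r , ℕ.s≤s r+k≤m , factor-unit ev-1 F

    -- Such a pivot consumes exactly one factor `y` of the determinant and leaves the rank at y = 0
    -- alone. The count is exact because nondegeneracy forbids the corner to vanish to second order.
    ramified-pivot : ∀ {m} → Bound m → ∀ (S : Mat (suc m)) → Symmetric S → Nondegenerate S → (∀ j → ev (S zero j) ≡ 0ℤ) →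
      ∀ k → y^ k ∣ det (suc m) S → Conclusion k S
    ramified-pivot {m} bound S S-sym S-nd S₀≡0 k y^k∣ = conclude k y^k∣
      where
      quot : ∀ j → ∃ λ q → S zero j ≈ y * q
      quot j = quotient (S zero j) (S₀≡0 j)
      a : Carrier
      a = proj₁ (quot zero)
      e₀ : Fin (suc m) → Carrier
      e₀ zero    = 1#
      e₀ (suc i) = 0#
      mv-e₀ : ∀ i → mv S e₀ i ≈ S zero i
      mv-e₀ i = trans (+-cong (*-identityʳ _) (sum-zero (λ j → S i (suc j) * 0#) (λ j → zeroʳ _)))
        (trans (+-identityʳ _) (S-sym i zero))
      -- For the first unit vector, S e₀ is the first row, which vanishes at y = 0, and e₀ᵀ S e₀ is
      -- the corner y a. If `a` vanished at y = 0 as well, nondegeneracy would yield 1 = 0.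
      a≢0 : ev a ≢ 0ℤ
      a≢0 a≡0 = 1≢0 (≡.trans (≡.sym ev-1) (S-nd e₀ (λ i → ≡.trans (ev-cong (mv-e₀ i)) (S₀≡0 i)) (proj₁ (quotient a a≡0) , (begin
          1# * mv S e₀ zero + sum (λ i → 0# * mv S e₀ (suc i))
        ≈⟨ trans (+-cong (*-identityˡ _) (sum-zero (λ i → 0# * mv S e₀ (suc i)) (λ i → zeroˡ _))) (+-identityʳ _) ⟩
          mv S e₀ zero   ≈⟨ mv-e₀ zero ⟩
          S zero zero    ≈⟨ proj₂ (quot zero) ⟩
          y * a          ≈⟨ *-congˡ (proj₂ (quotient a a≡0)) ⟩
          y * (y * proj₁ (quotient a a≡0)) ∎)) zero))
        where
        1≢0 : 1ℤ ≢ 0ℤ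
        1≢0 ()
      open Schur S S-sym S-nd y a (λ j → proj₁ (quot (suc j))) (proj₂ (quot zero)) (λ j → proj₂ (quot (suc j))) a≢0
      conclude₀ : Conclusion 0 S' → Conclusion 0 S
      conclude₀ (r , r+0≤m , F) = r , ℕ.m≤n⇒m≤1+n r+0≤m , factor-ramified ev-y F
      conclude₁ : ∀ k → Conclusion k S' → Conclusion (suc k) S
      conclude₁ k (r , r+k≤m , F) = r , ≡.subst (ℕ._≤ suc m) (≡.sym (ℕ.+-suc r k)) (ℕ.s≤s r+k≤m) , factor-ramified ev-y F
      conclude : ∀ k → y^ k ∣ det (suc m) S → Conclusion k S
      conclude zero    _          = conclude₀ (bound S' S'-sym S'-nd 0 (det m S' , sym (*-identityˡ _)))
      conclude (suc k) (q , det≈) = conclude₁ k (bound S' S'-sym S'-nd k (y^∣-coprime k a≢0 (P * q , cancel _ _ (begin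
        y * (a * det m S')        ≈⟨ det-schur ⟨
        P * det (suc m) S         ≈⟨ *-congˡ det≈ ⟩
        P * ((y * y ^ k) * q)     ≈⟨ solve 4 (λ p y z q → (p :* ((y :* z) :* q) := y :* (z :* (p :* q)))) refl P y (y ^ k) q ⟩
        y * (y ^ k * (P * q))     ∎))))

    corank-bound : ∀ m → Bound m
    corank-bound zero S S-sym S-nd zero y^k∣ =
      0 , ℕ.z≤n , record { c = 1ℤ ; c≢0 = λ () ; X = λ () ; Y = λ () ; eq = λ () }
    corank-bound zero S S-sym S-nd (suc k) (q , 1≈)
      with ≡.trans (≡.sym ev-1) (≡.trans (ev-cong (trans 1≈ (*-assoc _ _ _))) (ev-y* (y ^ k * q)))
    ... | ()
    corank-bound (suc m) S S-sym S-nd k y^k∣ with ev (S zero zero) ℤ.≟ 0ℤ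
    ... | no S₀₀≢0 = unit-pivot (corank-bound m) S S-sym S-nd S₀₀≢0 k y^k∣
    ... | yes S₀₀≡0 with Fin.any? (λ j → ¬? (ev (S zero (suc j)) ℤ.≟ 0ℤ))
    ...   | no none = ramified-pivot (corank-bound m) S S-sym S-nd S₀≡0 k y^k∣
      where
      S₀≡0 : ∀ j → ev (S zero j) ≡ 0ℤ
      S₀≡0 zero    = S₀₀≡0
      S₀≡0 (suc j) = decidable-stable (ev (S zero (suc j)) ℤ.≟ 0ℤ) λ ≢0 → none (j , ≢0)
    -- Writing b and d for the values of the entries (0, j+1) and (j+1, j+1), the new corner is 2b +
    -- d for ε = 1 and -2b + d for ε = -1. Their difference 4b is nonzero, so one of the two choices
    -- provides a unit pivot.
    ...   | yes (j , S₀ⱼ≢0) = try (ev (Congruence.S'' S S-sym S-nd j 1# zero zero) ℤ.≟ 0ℤ)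
      where
      via : ∀ ε → ev (Congruence.S'' S S-sym S-nd j ε zero zero) ≢ 0ℤ → Conclusion k S
      via ε ≢0 = back (unit-pivot (corank-bound m) S'' S''-sym S''-nd ≢0 k (proj₁ y^k∣ , trans det-S'' (proj₂ y^k∣)))
        where
        open Congruence S S-sym S-nd j ε
        back : Conclusion k S'' → Conclusion k S
        back (r , r+k≤ , F) = r , r+k≤ , factor-congruence F
      b = ev (S zero (suc j))
      d = ev (S (suc j) (suc j))
      pivot : ∀ ε → ev (Congruence.S'' S S-sym S-nd j ε zero zero) ≡ ev ε ℤ.* b ℤ.+ ev ε ℤ.* (b ℤ.+ ev ε ℤ.* d)
      pivot ε = ≡.trans (Congruence.ev-S''₀₀ S S-sym S-nd j ε) (≡.cong (ℤ._+ ev ε ℤ.* (b ℤ.+ ev ε ℤ.* d))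
        (≡.trans (≡.cong₂ (λ x z → x ℤ.+ ev ε ℤ.* z) S₀₀≡0 (ev-cong (S-sym (suc j) zero))) (ℤ.+-identityˡ (ev ε ℤ.* b))))
      try : _ → Conclusion k S
      try (no ≢0)  = via 1# ≢0
      try (yes ≡0) = via (- 1#) λ ≡0' → S₀ⱼ≢0 (zero-of-4 (≡.trans
          (ZS.solve 2 (λ b d → (ZS.con (+ 4) ZS.:* b ZS.:=
              (ZS.con 1ℤ ZS.:* b ZS.:+ ZS.con 1ℤ ZS.:* (b ZS.:+ ZS.con 1ℤ ZS.:* d)) ZS.:+
              ZS.:- (ZS.con ℤ.-1ℤ ZS.:* b ZS.:+ ZS.con ℤ.-1ℤ ZS.:* (b ZS.:+ ZS.con ℤ.-1ℤ ZS.:* d)))) ≡.refl b d)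
          (≡.cong₂ (λ x z → x ℤ.+ ℤ.- z)
            (≡.trans (≡.cong (λ e → e ℤ.* b ℤ.+ e ℤ.* (b ℤ.+ e ℤ.* d)) (≡.sym ev-1)) (≡.trans (≡.sym (pivot 1#)) ≡0))
            (≡.trans (≡.cong (λ e → e ℤ.* b ℤ.+ e ℤ.* (b ℤ.+ e ℤ.* d)) (≡.sym (≡.trans (ev-neg 1#) (≡.cong ℤ.-_ ev-1))))
              (≡.trans (≡.sym (pivot (- 1#))) ≡0')))))
        where
        zero-of-4 : ∀ {b} → + 4 ℤ.* b ≡ 0ℤ → b ≡ 0ℤ
        zero-of-4 {b} eq with ℤ.i*j≡0⇒i≡0∨j≡0 (+ 4) eq
        ... | inj₂ b≡0 = b≡0

    -- Divisibility of a determinant by powers of y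

    y^∣-+ : ∀ k {a b} → y^ k ∣ a → y^ k ∣ b → y^ k ∣ (a + b)
    y^∣-+ k (p , a≈) (q , b≈) = p + q , trans (+-cong a≈ b≈) (sym (distribˡ _ _ _))

    y^∣-sum : ∀ k {n} (f : Fin n → Carrier) → (∀ i → y^ k ∣ f i) → y^ k ∣ sum f
    y^∣-sum k {zero}  f k∣f = 0# , sym (zeroʳ _)
    y^∣-sum k {suc n} f k∣f = y^∣-+ k (k∣f zero) (y^∣-sum k (λ i → f (suc i)) (λ i → k∣f (suc i)))

    y^∣det : ∀ n r (M : Mat n) → (∀ i → r ℕ.≤ toℕ i → ∀ j → ev (M i j) ≡ 0ℤ) → y^ (n ℕ.∸ r) ∣ det n M
    y^∣det zero    zero    M M≡0 = 1# , sym (*-identityˡ 1#)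
    y^∣det zero    (suc r) M M≡0 = 1# , sym (*-identityˡ 1#)
    y^∣det (suc n) zero    M M≡0 = y^∣-sum (suc n) (laplace M) λ j → term j (quotient (M zero j) (M≡0 zero ℕ.z≤n j))
        (y^∣det n zero (minor M j) (λ i _ k → M≡0 (suc i) ℕ.z≤n (punchIn j k)))
      where
      term : ∀ j → (∃ λ q → M zero j ≈ y * q) → y^ n ∣ det n (minor M j) → y^ (suc n) ∣ laplace M j
      term j (q , M₀ⱼ≈) (p , d≈) = sg (toℕ j) * (q * p) , trans (*-congˡ (*-cong M₀ⱼ≈ d≈))
        (solve 5 (λ s y q z p → (s :* ((y :* q) :* (z :* p)) := (y :* z) :* (s :* (q :* p)))) refl (sg (toℕ j)) y q (y ^ n) p)
    y^∣det (suc n) (suc r) M M≡0 = y^∣-sum (n ℕ.∸ r) (laplace M) λ j → term j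
        (y^∣det n r (minor M j) (λ i r≤i k → M≡0 (suc i) (ℕ.s≤s r≤i) (punchIn j k)))
      where
      term : ∀ j → y^ (n ℕ.∸ r) ∣ det n (minor M j) → y^ (n ℕ.∸ r) ∣ laplace M j
      term j (p , d≈) = sg (toℕ j) * (M zero j * p) , trans (*-congˡ (*-congˡ d≈))
        (solve 4 (λ s m z p → (s :* (m :* (z :* p)) := z :* (s :* (m :* p)))) refl (sg (toℕ j)) (M zero j) (y ^ (n ℕ.∸ r)) p)

    -- Subtracting row `p` from the rows of index at least `r` keeps the determinant and makes those
    -- rows vanish at y = 0, each of them giving one factor `y`. Row `p` lies before `r` and
    -- survives.
    y^∣det-equal-rows : ∀ n r p (M : Mat n) → toℕ p ℕ.< r →
      (∀ i → r ℕ.≤ toℕ i → ∀ j → ev (M i j) ≡ ev (M p j)) → y^ (n ℕ.∸ r) ∣ det n M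
    y^∣det-equal-rows n r p M p<r eq = proj₁ below , trans (sym (det-addRows p x M x-p)) (proj₂ below)
      where
      x : Fin n → Carrier
      x i with r ℕ.≤? toℕ i
      ... | yes _ = - 1#
      ... | no _  = 0#
      x-p : x p ≈ 0#
      x-p with r ℕ.≤? toℕ p
      ... | yes r≤p = contradiction p<r (ℕ.≤⇒≯ r≤p)
      ... | no _    = refl
      x-below : ∀ i → r ℕ.≤ toℕ i → x i ≈ - 1#
      x-below i r≤i with r ℕ.≤? toℕ i
      ... | yes _  = refl
      ... | no r≰i = contradiction r≤i r≰i
      below : y^ (n ℕ.∸ r) ∣ det n (λ i j → M i j + x i * M p j)
      below = y^∣det n r _ λ i r≤i j → ≡.trans
        (ev-cong (+-congˡ (trans (*-congʳ (x-below i r≤i)) (solve 1 (λ m → (:- con (+ 1) :* m := :- m)) refl (M p j)))))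
        (≡.trans (ev-+ _ _) (≡.trans (≡.cong₂ ℤ._+_ (eq i r≤i j) (ev-neg (M p j))) (ℤ.+-inverseʳ (ev (M p j)))))

    private
      square : ∀ i → ∃ λ m → (i ℤ.* i ≡ + m) × (m ≡ 0 → i ≡ 0ℤ)
      square i = ℤ.∣ i ∣ ℕ.* ℤ.∣ i ∣ , ≡.trans (nonneg i) (≡.sym (ℤ.pos-* ℤ.∣ i ∣ ℤ.∣ i ∣)) ,
        λ m≡0 → ℤ.∣i∣≡0⇒i≡0 (m*m≡0 ℤ.∣ i ∣ m≡0)
        where
        m*m≡0 : ∀ m → m ℕ.* m ≡ 0 → m ≡ 0
        m*m≡0 zero eq = ≡.refl
        nonneg : ∀ i → i ℤ.* i ≡ + ℤ.∣ i ∣ ℤ.* + ℤ.∣ i ∣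
        nonneg (+ n)      = ≡.refl
        nonneg (ℤ.-[1+ n ]) = ≡.refl

      -- Exhibiting the sum as a natural number lets its vanishing force every term to vanish.
      sum-squares : ∀ {n} (f : Fin n → ℤ) → ∃ λ m → (Z.sum (λ i → f i ℤ.* f i) ≡ + m) × (m ≡ 0 → ∀ i → f i ≡ 0ℤ)
      sum-squares {zero}  f = 0 , ≡.refl , λ _ ()
      sum-squares {suc n} f with square (f zero) | sum-squares (λ i → f (suc i))
      ... | a , a≡ , a0 | b , b≡ , b0 = a ℕ.+ b , ≡.cong₂ ℤ._+_ a≡ b≡ , λ where
        ab≡0 zero    → a0 (ℕ.m+n≡0⇒m≡0 a ab≡0)
        ab≡0 (suc i) → b0 (ℕ.m+n≡0⇒n≡0 a ab≡0) i

    sum-squares≡0 : ∀ {n} (f : Fin n → ℤ) → Z.sum (λ i → f i ℤ.* f i) ≡ 0ℤ → ∀ i → f i ≡ 0ℤ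
    sum-squares≡0 f Σ≡0 with sum-squares f
    ... | m , Σ≡m , zeros = zeros (ℤ.+-injective (≡.trans (≡.sym Σ≡m) Σ≡0))

    ev-sum : ∀ {n} (f : Fin n → Carrier) → ev (sum f) ≡ Z.sum (λ i → ev (f i))
    ev-sum {zero}  f = ev-0
    ev-sum {suc n} f = ≡.trans (ev-+ (f zero) (sum (λ i → f (suc i)))) (≡.cong (λ z → ev (f zero) ℤ.+ z) (ev-sum (λ i → f (suc i))))

    δ-sym : ∀ {n} (i j : Fin n) → δ i j ≈ δ j i
    δ-sym zero    zero    = refl
    δ-sym zero    (suc j) = refl
    δ-sym (suc i) zero    = refl
    δ-sym (suc i) (suc j) = δ-sym i j

    -- The pencil y I - B of a symmetric integer matrix B

    module Pencil (const : ℤ → Carrier)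
      (const-+ : ∀ a b → const (a ℤ.+ b) ≈ const a + const b)
      (const-* : ∀ a b → const (a ℤ.* b) ≈ const a * const b)
      (const-0 : const 0ℤ ≈ 0#)
      (ev-const : ∀ a → ev (const a) ≡ a) where

      const-sum : ∀ {n} (f : Fin n → ℤ) → const (Z.sum f) ≈ sum (λ i → const (f i))
      const-sum {zero}  f = const-0
      const-sum {suc n} f = trans (const-+ (f zero) (Z.sum (λ i → f (suc i)))) (+-congˡ (const-sum (λ i → f (suc i))))

      module _ {n} (B : Matℤ n) (B-sym : ∀ i j → B i j ≡ B j i) (S : Mat n)
        (S≈ : ∀ i j → S i j ≈ y * δ i j + - const (B i j)) where

        pencil-sym : Symmetric S
        pencil-sym i j = trans (S≈ i j) (trans
          (+-cong (*-congˡ (δ-sym i j)) (-‿cong (reflexive (≡.cong const (B-sym i j))))) (sym (S≈ j i)))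

        ev-pencil : ∀ i j → ev (S i j) ≡ ℤ.- B i j
        ev-pencil i j = ≡.trans (ev-cong (S≈ i j)) (≡.trans (ev-+ _ _) (≡.trans
          (≡.cong₂ ℤ._+_ (ev-y* (δ i j)) (≡.trans (ev-neg _) (≡.cong ℤ.-_ (ev-const (B i j))))) (ℤ.+-identityˡ _)))

        -- Write v = v₀ + y v₁ with v₀ the value at y = 0. The first hypothesis says B v₀ = 0 over
        -- ℤ, so B v = y B v₁, and by symmetry vᵀ B v = y² v₁ᵀ B v₁. Hence y vᵀ v = vᵀ S v + vᵀ B v
        -- is divisible by y². Cancelling one `y` shows that vᵀ v vanishes at y = 0, where its value
        -- is the sum of squares of the entries of v₀.
        pencil-nd : Nondegenerate S
        pencil-nd v Sv≡0 (q , vSv≈) = sum-squares≡0 v₀ Σv₀²≡0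
          where
          v₀ : Fin n → ℤ
          v₀ i = ev (v i)
          split : ∀ i → ∃ λ u → v i + - const (v₀ i) ≈ y * u
          split i = quotient _ (≡.trans (ev-+ _ _) (≡.trans
            (≡.cong (λ z → v₀ i ℤ.+ z) (≡.trans (ev-neg _) (≡.cong ℤ.-_ (ev-const (v₀ i))))) (ℤ.+-inverseʳ (v₀ i))))
          v₁ : Fin n → Carrier
          v₁ i = proj₁ (split i)
          v≈ : ∀ i → v i ≈ const (v₀ i) + y * v₁ i
          v≈ i = trans (solve 2 (λ v c → (v := c :+ (v :+ :- c))) refl (v i) (const (v₀ i))) (+-congˡ (proj₂ (split i)))
          b : Fin n → Fin n → Carrier
          b i j = const (B i j)
          β : Fin n → Carrier
          β i = mv b v i
          γ : Fin n → Carrier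
          γ i = mv b v₁ i
          Sv≈ : ∀ i → mv S v i ≈ y * v i + - β i
          Sv≈ i = begin
              mv S v i
            ≈⟨ sum-cong _ (λ j → y * (v j * δ j i) + - 1# * (b i j * v j)) (λ j → trans (*-congʳ (trans (S≈ i j) (+-congʳ (*-congˡ (δ-sym i j)))))
                 (solve 4 (λ y d b v → ((y :* d :+ :- b) :* v := y :* (v :* d) :+ :- con (+ 1) :* (b :* v))) refl y (δ j i) (b i j) (v j))) ⟩
              sum (λ j → y * (v j * δ j i) + - 1# * (b i j * v j))
            ≈⟨ sum-+ (λ j → y * (v j * δ j i)) (λ j → - 1# * (b i j * v j)) ⟩
              sum (λ j → y * (v j * δ j i)) + sum (λ j → - 1# * (b i j * v j))
            ≈⟨ +-cong (sum-* y (λ j → v j * δ j i)) (sum-* (- 1#) (λ j → b i j * v j)) ⟨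
              y * sum (λ j → v j * δ j i) + - 1# * β i
            ≈⟨ +-cong (*-congˡ (sum-δ v i)) (solve 1 (λ β → (:- con (+ 1) :* β := :- β)) refl (β i)) ⟩
              y * v i + - β i ∎
          ev-β : ∀ i → ev (β i) ≡ 0ℤ
          ev-β i = ≡.trans (ev-cong (trans (solve 2 (λ β x → (β := x :+ :- (x :+ :- β))) refl (β i) (y * v i))
              (+-congˡ (-‿cong (sym (Sv≈ i))))))
            (≡.trans (ev-+ _ _) (≡.cong₂ ℤ._+_ (ev-y* (v i)) (≡.trans (ev-neg _) (≡.cong ℤ.-_ (Sv≡0 i)))))
          Bv₀≡0 : ∀ i → Z.sum (λ j → B i j ℤ.* v₀ j) ≡ 0ℤ
          Bv₀≡0 i = ≡.trans (≡.sym (≡.trans (ev-sum (λ j → b i j * v j))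
            (Z.sum-cong _ _ λ j → ≡.trans (ev-* _ _) (≡.cong (ℤ._* v₀ j) (ev-const (B i j)))))) (ev-β i)
          bv₀≈0 : ∀ i → sum (λ j → b i j * const (v₀ j)) ≈ 0#
          bv₀≈0 i = trans (sum-cong _ _ (λ j → sym (const-* (B i j) (v₀ j))))
            (trans (sym (const-sum (λ j → B i j ℤ.* v₀ j))) (trans (reflexive (≡.cong const (Bv₀≡0 i))) const-0))
          β≈ : ∀ i → β i ≈ y * γ i
          β≈ i = begin
              β i
            ≈⟨ sum-cong _ (λ j → b i j * const (v₀ j) + y * (b i j * v₁ j)) (λ j → trans (*-congˡ (v≈ j))
                 (solve 4 (λ b c y u → (b :* (c :+ y :* u) := b :* c :+ y :* (b :* u))) refl (b i j) (const (v₀ j)) y (v₁ j))) ⟩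
              sum (λ j → b i j * const (v₀ j) + y * (b i j * v₁ j))
            ≈⟨ trans (sum-+ (λ j → b i j * const (v₀ j)) (λ j → y * (b i j * v₁ j)))
                 (+-cong (bv₀≈0 i) (sym (sum-* y (λ j → b i j * v₁ j)))) ⟩
              0# + y * γ i
            ≈⟨ +-identityˡ _ ⟩
              y * γ i ∎
          κ : Carrier
          κ = sum (λ j → v₁ j * γ j)
          vβ≈ : sum (λ i → v i * β i) ≈ y * (y * κ)
          vβ≈ = begin
              sum (λ i → v i * β i)
            ≈⟨ sum-cong _ (λ i → y * sum (λ j → v i * (b i j * v₁ j))) (λ i → trans (*-congˡ (β≈ i))
                 (trans (solve 3 (λ v y g → (v :* (y :* g) := y :* (v :* g))) refl (v i) y (γ i)) (*-congˡ (sum-* (v i) (λ j → b i j * v₁ j))))) ⟩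
              sum (λ i → y * sum (λ j → v i * (b i j * v₁ j)))
            ≈⟨ sum-* y (λ i → sum (λ j → v i * (b i j * v₁ j))) ⟨
              y * sum (λ i → sum (λ j → v i * (b i j * v₁ j)))
            ≈⟨ *-congˡ (∑-comm (λ i j → v i * (b i j * v₁ j))) ⟩
              y * sum (λ j → sum (λ i → v i * (b i j * v₁ j)))
            ≈⟨ *-congˡ (sum-cong _ (λ j → v₁ j * β j) (λ j → trans
                 (sum-cong _ (λ i → v₁ j * (b j i * v i)) (λ i → trans
                   (solve 3 (λ v b u → (v :* (b :* u) := u :* (b :* v))) refl (v i) (b i j) (v₁ j))
                   (*-congˡ (*-congʳ (reflexive (≡.cong const (B-sym i j)))))))
                 (sym (sum-* (v₁ j) (λ i → b j i * v i))))) ⟩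
              y * sum (λ j → v₁ j * β j)
            ≈⟨ *-congˡ (sum-cong _ (λ j → y * (v₁ j * γ j)) (λ j → trans (*-congˡ (β≈ j))
                 (solve 3 (λ v y g → (v :* (y :* g) := y :* (v :* g))) refl (v₁ j) y (γ j)))) ⟩
              y * sum (λ j → y * (v₁ j * γ j))
            ≈⟨ *-congˡ (sum-* y (λ j → v₁ j * γ j)) ⟨
              y * (y * κ) ∎
          vSv : quad S v ≈ y * sum (λ i → v i * v i) + - sum (λ i → v i * β i)
          vSv = begin
              quad S v
            ≈⟨ sum-cong _ (λ i → y * (v i * v i) + - 1# * (v i * β i)) (λ i → trans (*-congˡ (Sv≈ i))
                 (solve 3 (λ v y β → (v :* (y :* v :+ :- β) := y :* (v :* v) :+ :- con (+ 1) :* (v :* β))) refl (v i) y (β i))) ⟩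
              sum (λ i → y * (v i * v i) + - 1# * (v i * β i))
            ≈⟨ sum-+ (λ i → y * (v i * v i)) (λ i → - 1# * (v i * β i)) ⟩
              sum (λ i → y * (v i * v i)) + sum (λ i → - 1# * (v i * β i))
            ≈⟨ +-cong (sum-* y (λ i → v i * v i)) (sum-* (- 1#) (λ i → v i * β i)) ⟨
              y * sum (λ i → v i * v i) + - 1# * sum (λ i → v i * β i)
            ≈⟨ +-congˡ (solve 1 (λ s → (:- con (+ 1) :* s := :- s)) refl _) ⟩
              y * sum (λ i → v i * v i) + - sum (λ i → v i * β i) ∎
          Σv²≈ : sum (λ i → v i * v i) ≈ y * (q + κ)
          Σv²≈ = cancel _ _ (begin
              y * sum (λ i → v i * v i)
            ≈⟨ solve 2 (λ a b → (a := (a :+ :- b) :+ b)) refl (y * sum (λ i → v i * v i)) (sum (λ i → v i * β i)) ⟩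
              (y * sum (λ i → v i * v i) + - sum (λ i → v i * β i)) + sum (λ i → v i * β i)
            ≈⟨ +-cong (trans (sym vSv) vSv≈) vβ≈ ⟩
              y * (y * q) + y * (y * κ)
            ≈⟨ solve 3 (λ y q k → (y :* (y :* q) :+ y :* (y :* k) := y :* (y :* (q :+ k)))) refl y q κ ⟩
              y * (y * (q + κ)) ∎)
          Σv₀²≡0 : Z.sum (λ i → v₀ i ℤ.* v₀ i) ≡ 0ℤ
          Σv₀²≡0 = ≡.trans (≡.sym (≡.trans (ev-sum (λ i → v i * v i)) (Z.sum-cong _ _ (λ i → ev-* (v i) (v i)))))
            (≡.trans (ev-cong Σv²≈) (ev-y* (q + κ)))

    -- Makes a multiplicity an upper bound: when the cofactor is nonzero at the root, no higher
    -- power can divide.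
    y^∣-excess : ∀ k j q → y^ (k ℕ.+ suc j) ∣ (y ^ k * q) → ev q ≡ 0ℤ
    y^∣-excess zero    j q (p , eq) = ≡.trans (ev-cong (trans (sym (*-identityˡ q)) (trans eq (*-assoc _ _ _)))) (ev-y* (y ^ j * p))
    y^∣-excess (suc k) j q (p , eq) = y^∣-excess k j q (p , cancel _ _ (trans (sym (*-assoc _ _ _)) (trans eq (*-assoc _ _ _))))

    y^∣-root : ∀ k {a} q → a ≈ y ^ k * q → ev q ≡ 0ℤ → y^ (suc k) ∣ a
    y^∣-root k {a} q a≈ q≡0 = proj₁ (quotient q q≡0) , (begin
      a                                      ≈⟨ a≈ ⟩
      y ^ k * q                              ≈⟨ *-congˡ (proj₂ (quotient q q≡0)) ⟩
      y ^ k * (y * proj₁ (quotient q q≡0))   ≈⟨ solve 3 (λ z y q → (z :* (y :* q) := (y :* z) :* q)) refl (y ^ k) y (proj₁ (quotient q q≡0)) ⟩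
      (y * y ^ k) * proj₁ (quotient q q≡0)   ∎)

-- The ring ℤ[x] and characteristic polynomials

module Polynomials where

  open import Defs hiding (sym; det)
  import Defs
  open import Data.Nat as ℕ using (ℕ; zero; suc)
  import Data.Nat.Properties as ℕ
  open import Data.Integer as ℤ using (ℤ; +_; 0ℤ; 1ℤ; -1ℤ)
  import Data.Integer.Properties as ℤ
  open import Data.Integer.Solver using (module +-*-Solver)
  open import Data.Fin as Fin using (Fin; zero; suc; toℕ; punchIn)
  import Data.Fin.Properties as Fin
  open import Data.Bool using (true; false; if_then_else_)
  open import Data.List using ([]; _∷_)
  open import Data.Product using (∃; _×_; _,_)
  open import Relation.Nullary using (contradiction)
  open import Relation.Binary using (tri<; tri≈; tri>; IsEquivalence)
  open import Relation.Binary.PropositionalEquality as ≡ using (_≡_; refl; sym; trans; cong; cong₂)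
  open import Level using (0ℓ)
  open import Algebra.Properties.AbelianGroup ℤ.+-0-abelianGroup using (∙-cancelʳ)
  open Ranks using (Evaluation; module Corank; module Z)
  open +-*-Solver using (solve; _:=_; _:+_; _:*_; con)

  coeff-+ : ∀ p q i → coeff (p +P q) i ≡ coeff p i ℤ.+ coeff q i
  coeff-+ []      q       i       = sym (ℤ.+-identityˡ _)
  coeff-+ (a ∷ p) []      i       = sym (ℤ.+-identityʳ _)
  coeff-+ (a ∷ p) (b ∷ q) zero    = refl
  coeff-+ (a ∷ p) (b ∷ q) (suc i) = coeff-+ p q i

  coeff-scale : ∀ c p i → coeff (scaleP c p) i ≡ c ℤ.* coeff p i
  coeff-scale c []      i       = sym (ℤ.*-zeroʳ c)
  coeff-scale c (a ∷ p) zero    = refl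
  coeff-scale c (a ∷ p) (suc i) = coeff-scale c p i

  coeff-*-zero : ∀ a p q → coeff ((a ∷ p) *P q) 0 ≡ a ℤ.* coeff q 0
  coeff-*-zero a p q = trans (coeff-+ (scaleP a q) (0ℤ ∷ (p *P q)) 0) (trans (ℤ.+-identityʳ _) (coeff-scale a q 0))

  coeff-*-suc : ∀ a p q i → coeff ((a ∷ p) *P q) (suc i) ≡ a ℤ.* coeff q (suc i) ℤ.+ coeff (p *P q) i
  coeff-*-suc a p q i = trans (coeff-+ (scaleP a q) (0ℤ ∷ (p *P q)) (suc i)) (cong (ℤ._+ coeff (p *P q) i) (coeff-scale a q (suc i)))

  *P-[] : ∀ p → (p *P []) ≈P []
  *P-[] []      i       = refl
  *P-[] (a ∷ p) zero    = refl
  *P-[] (a ∷ p) (suc i) = *P-[] p i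

  -- `_*P_` recurses on its left factor. This lemma and the next provide the matching recursion on
  -- the right factor, from which commutativity follows.
  coeff-*-∷-zero : ∀ p b q → coeff (p *P (b ∷ q)) 0 ≡ b ℤ.* coeff p 0
  coeff-*-∷-zero []      b q = sym (ℤ.*-zeroʳ b)
  coeff-*-∷-zero (a ∷ p) b q = trans (coeff-*-zero a p (b ∷ q)) (ℤ.*-comm a b)

  coeff-*-∷-suc : ∀ p b q i → coeff (p *P (b ∷ q)) (suc i) ≡ b ℤ.* coeff p (suc i) ℤ.+ coeff (p *P q) i
  coeff-*-∷-suc []      b q i = sym (trans (ℤ.+-identityʳ _) (ℤ.*-zeroʳ b))
  coeff-*-∷-suc (a ∷ p) b q zero = trans (coeff-*-suc a p (b ∷ q) 0) (trans
    (cong (λ z → a ℤ.* coeff q 0 ℤ.+ z) (coeff-*-∷-zero p b q))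
    (trans (ℤ.+-comm (a ℤ.* coeff q 0) _) (cong (λ z → b ℤ.* coeff p 0 ℤ.+ z) (sym (coeff-*-zero a p q)))))
  coeff-*-∷-suc (a ∷ p) b q (suc i) = trans (coeff-*-suc a p (b ∷ q) (suc i)) (trans
    (cong (λ z → a ℤ.* coeff q (suc i) ℤ.+ z) (coeff-*-∷-suc p b q i))
    (trans (solve 3 (λ x y z → (x :+ (y :+ z) := y :+ (x :+ z))) refl (a ℤ.* coeff q (suc i)) (b ℤ.* coeff p (suc i)) (coeff (p *P q) i))
      (cong (λ z → b ℤ.* coeff p (suc i) ℤ.+ z) (sym (coeff-*-suc a p q i)))))

  *P-comm : ∀ p q → (p *P q) ≈P (q *P p)
  *P-comm []      q i       = sym (*P-[] q i)
  *P-comm (a ∷ p) q zero    = trans (coeff-*-zero a p q) (sym (coeff-*-∷-zero q a p))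
  *P-comm (a ∷ p) q (suc i) = trans (coeff-*-suc a p q i) (trans
    (cong (λ z → a ℤ.* coeff q (suc i) ℤ.+ z) (*P-comm p q i)) (sym (coeff-*-∷-suc q a p i)))

  *P-congˡ : ∀ p q r → q ≈P r → (p *P q) ≈P (p *P r)
  *P-congˡ []      q r q≈r i       = refl
  *P-congˡ (a ∷ p) q r q≈r zero    = trans (coeff-*-zero a p q) (trans (cong (a ℤ.*_) (q≈r 0)) (sym (coeff-*-zero a p r)))
  *P-congˡ (a ∷ p) q r q≈r (suc i) = trans (coeff-*-suc a p q i) (trans
    (cong₂ (λ x z → a ℤ.* x ℤ.+ z) (q≈r (suc i)) (*P-congˡ p q r q≈r i)) (sym (coeff-*-suc a p r i)))

  *P-cong : ∀ p q r s → p ≈P q → r ≈P s → (p *P r) ≈P (q *P s)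
  *P-cong p q r s p≈q r≈s i = trans (*P-congˡ p r s r≈s i) (trans (*P-comm p s i)
    (trans (*P-congˡ s p q p≈q i) (*P-comm s q i)))

  *P-distribˡ : ∀ p q r → (p *P (q +P r)) ≈P ((p *P q) +P (p *P r))
  *P-distribˡ []      q r i       = refl
  *P-distribˡ (a ∷ p) q r zero    = trans (coeff-*-zero a p (q +P r)) (trans (cong (a ℤ.*_) (coeff-+ q r 0))
    (trans (ℤ.*-distribˡ-+ a (coeff q 0) (coeff r 0)) (sym (trans (coeff-+ ((a ∷ p) *P q) ((a ∷ p) *P r) 0)
      (cong₂ ℤ._+_ (coeff-*-zero a p q) (coeff-*-zero a p r))))))
  *P-distribˡ (a ∷ p) q r (suc i) = trans (coeff-*-suc a p (q +P r) i) (trans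
    (cong₂ (λ x z → a ℤ.* x ℤ.+ z) (coeff-+ q r (suc i)) (trans (*P-distribˡ p q r i) (coeff-+ (p *P q) (p *P r) i)))
    (trans (solve 5 (λ a x y z w → (a :* (x :+ y) :+ (z :+ w) := (a :* x :+ z) :+ (a :* y :+ w))) refl
        a (coeff q (suc i)) (coeff r (suc i)) (coeff (p *P q) i) (coeff (p *P r) i))
      (sym (trans (coeff-+ ((a ∷ p) *P q) ((a ∷ p) *P r) (suc i))
        (cong₂ ℤ._+_ (coeff-*-suc a p q i) (coeff-*-suc a p r i))))))

  +P-cong : ∀ p q r s → p ≈P q → r ≈P s → (p +P r) ≈P (q +P s)
  +P-cong p q r s p≈q r≈s i = trans (coeff-+ p r i) (trans (cong₂ ℤ._+_ (p≈q i) (r≈s i)) (sym (coeff-+ q s i)))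

  *P-distribʳ : ∀ p q r → ((q +P r) *P p) ≈P ((q *P p) +P (r *P p))
  *P-distribʳ p q r i = trans (*P-comm (q +P r) p i) (trans (*P-distribˡ p q r i)
    (+P-cong (p *P q) (q *P p) (p *P r) (r *P p) (*P-comm p q) (*P-comm p r) i))

  scale-* : ∀ c p q → (scaleP c p *P q) ≈P scaleP c (p *P q)
  scale-* c []      q i       = refl
  scale-* c (a ∷ p) q zero    = trans (coeff-*-zero (c ℤ.* a) (scaleP c p) q) (trans (ℤ.*-assoc c a _)
    (sym (trans (coeff-scale c ((a ∷ p) *P q) 0) (cong (c ℤ.*_) (coeff-*-zero a p q)))))
  scale-* c (a ∷ p) q (suc i) = trans (coeff-*-suc (c ℤ.* a) (scaleP c p) q i) (trans
    (cong (λ z → c ℤ.* a ℤ.* coeff q (suc i) ℤ.+ z) (trans (scale-* c p q i) (coeff-scale c (p *P q) i)))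
    (trans (solve 4 (λ c a x z → (c :* a :* x :+ c :* z := c :* (a :* x :+ z))) refl c a (coeff q (suc i)) (coeff (p *P q) i))
      (sym (trans (coeff-scale c ((a ∷ p) *P q) (suc i)) (cong (c ℤ.*_) (coeff-*-suc a p q i))))))

  shift-* : ∀ p q → ((0ℤ ∷ p) *P q) ≈P (0ℤ ∷ (p *P q))
  shift-* p q zero    = trans (coeff-*-zero 0ℤ p q) (ℤ.*-zeroˡ (coeff q 0))
  shift-* p q (suc i) = trans (coeff-*-suc 0ℤ p q i) (trans
    (cong (ℤ._+ coeff (p *P q) i) (ℤ.*-zeroˡ (coeff q (suc i)))) (ℤ.+-identityˡ _))

  *P-assoc : ∀ p q r → ((p *P q) *P r) ≈P (p *P (q *P r))
  *P-assoc []      q r i = refl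
  *P-assoc (a ∷ p) q r i = trans (*P-distribʳ r (scaleP a q) (0ℤ ∷ (p *P q)) i)
    (+P-cong (scaleP a q *P r) (scaleP a (q *P r)) ((0ℤ ∷ (p *P q)) *P r) (0ℤ ∷ (p *P (q *P r))) (scale-* a q r) shifted i)
    where
    shifted : ((0ℤ ∷ (p *P q)) *P r) ≈P (0ℤ ∷ (p *P (q *P r)))
    shifted zero    = shift-* (p *P q) r zero
    shifted (suc i) = trans (shift-* (p *P q) r (suc i)) (*P-assoc p q r i)

  *P-identityˡ : ∀ p → (constP 1ℤ *P p) ≈P p
  *P-identityˡ p zero    = trans (coeff-*-zero 1ℤ [] p) (ℤ.*-identityˡ _)
  *P-identityˡ p (suc i) = trans (coeff-*-suc 1ℤ [] p i) (trans (ℤ.+-identityʳ _) (ℤ.*-identityˡ _))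

  negP : Poly → Poly
  negP = scaleP -1ℤ

  negP-inverseʳ : ∀ p → (p +P negP p) ≈P []
  negP-inverseʳ p i = trans (coeff-+ p (negP p) i) (trans (cong (λ z → coeff p i ℤ.+ z) (coeff-scale -1ℤ p i))
    (solve 1 (λ x → (x :+ con -1ℤ :* x := con 0ℤ)) refl (coeff p i)))

  ≈P-isEquivalence : IsEquivalence _≈P_
  ≈P-isEquivalence = record
    { refl = λ i → refl ; sym = λ p≈q i → sym (p≈q i) ; trans = λ p≈q q≈r i → trans (p≈q i) (q≈r i) }

  ≈P-sym : ∀ p q → p ≈P q → q ≈P p
  ≈P-sym p q p≈q i = sym (p≈q i)

  ≈P-trans : ∀ p q r → p ≈P q → q ≈P r → p ≈P r
  ≈P-trans p q r p≈q q≈r i = trans (p≈q i) (q≈r i)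

  +P-comm : ∀ p q → (p +P q) ≈P (q +P p)
  +P-comm p q i = trans (coeff-+ p q i) (trans (ℤ.+-comm (coeff p i) _) (sym (coeff-+ q p i)))

  polyRing : CommutativeRing 0ℓ 0ℓ
  polyRing = record
    { Carrier = Poly ; _≈_ = _≈P_ ; _+_ = _+P_ ; _*_ = _*P_ ; -_ = negP ; 0# = [] ; 1# = constP 1ℤ
    ; isCommutativeRing = record
      { isRing = record
        { +-isAbelianGroup = record
          { isGroup = record
            { isMonoid = record
              { isSemigroup = record
                { isMagma = record
                  { isEquivalence = ≈P-isEquivalence
                  ; ∙-cong = λ {p} {q} {r} {s} → +P-cong p q r s }
                ; assoc = λ p q r i → trans (coeff-+ (p +P q) r i) (trans (cong (ℤ._+ coeff r i) (coeff-+ p q i))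
                    (trans (ℤ.+-assoc (coeff p i) (coeff q i) (coeff r i)) (sym (trans (coeff-+ p (q +P r) i)
                      (cong (λ z → coeff p i ℤ.+ z) (coeff-+ q r i)))))) }
              ; identity = (λ p i → refl) , (λ p i → trans (coeff-+ p [] i) (ℤ.+-identityʳ _)) }
            ; inverse = (λ p i → trans (+P-comm (negP p) p i) (negP-inverseʳ p i)) , negP-inverseʳ
            ; ⁻¹-cong = λ {p} {q} p≈q i → trans (coeff-scale -1ℤ p i) (trans (cong (-1ℤ ℤ.*_) (p≈q i)) (sym (coeff-scale -1ℤ q i))) }
          ; comm = +P-comm }
        ; *-cong = λ {p} {q} {r} {s} → *P-cong p q r s
        ; *-assoc = *P-assoc
        ; *-identity = *P-identityˡ , λ p i → trans (*P-comm p (constP 1ℤ) i) (*P-identityˡ p i)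
        ; distrib = *P-distribˡ , *P-distribʳ }
      ; *-comm = *P-comm } }

  evalP-+ : ∀ p q x → evalP (p +P q) x ≡ evalP p x ℤ.+ evalP q x
  evalP-+ []      q       x = sym (ℤ.+-identityˡ _)
  evalP-+ (a ∷ p) []      x = sym (ℤ.+-identityʳ _)
  evalP-+ (a ∷ p) (b ∷ q) x = trans (cong (λ z → a ℤ.+ b ℤ.+ x ℤ.* z) (evalP-+ p q x))
    (solve 5 (λ a b x p q → (a :+ b :+ x :* (p :+ q) := (a :+ x :* p) :+ (b :+ x :* q))) refl a b x (evalP p x) (evalP q x))

  evalP-scale : ∀ c p x → evalP (scaleP c p) x ≡ c ℤ.* evalP p x
  evalP-scale c []      x = sym (ℤ.*-zeroʳ c)
  evalP-scale c (a ∷ p) x = trans (cong (λ z → c ℤ.* a ℤ.+ x ℤ.* z) (evalP-scale c p x))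
    (solve 4 (λ c a x p → (c :* a :+ x :* (c :* p) := c :* (a :+ x :* p))) refl c a x (evalP p x))

  evalP-* : ∀ p q x → evalP (p *P q) x ≡ evalP p x ℤ.* evalP q x
  evalP-* []      q x = sym (ℤ.*-zeroˡ (evalP q x))
  evalP-* (a ∷ p) q x = trans (evalP-+ (scaleP a q) (0ℤ ∷ (p *P q)) x) (trans
    (cong₂ (λ u z → u ℤ.+ (0ℤ ℤ.+ x ℤ.* z)) (evalP-scale a q x) (evalP-* p q x))
    (solve 4 (λ a q x p → (a :* q :+ (con 0ℤ :+ x :* (p :* q)) := (a :+ x :* p) :* q)) refl a (evalP q x) x (evalP p x)))

  evalP-cong : ∀ p q x → p ≈P q → evalP p x ≡ evalP q x
  evalP-cong []      []      x p≈q = refl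
  evalP-cong []      (b ∷ q) x p≈q = trans (sym (trans (ℤ.+-identityˡ _) (ℤ.*-zeroʳ x)))
    (cong₂ (λ a z → a ℤ.+ x ℤ.* z) (p≈q 0) (evalP-cong [] q x (λ i → p≈q (suc i))))
  evalP-cong (a ∷ p) []      x p≈q = trans
    (cong₂ (λ a z → a ℤ.+ x ℤ.* z) (p≈q 0) (evalP-cong p [] x (λ i → p≈q (suc i))))
    (trans (ℤ.+-identityˡ _) (ℤ.*-zeroʳ x))
  evalP-cong (a ∷ p) (b ∷ q) x p≈q =
    cong₂ (λ a z → a ℤ.+ x ℤ.* z) (p≈q 0) (evalP-cong p q x (λ i → p≈q (suc i)))

  -- The factor x - (-1) in the shape that `RootMult` gives it for the root -1.
  yP : Poly
  yP = XP +P constP (ℤ.- -1ℤ)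

  ev : Poly → ℤ
  ev p = evalP p -1ℤ

  coeff-y*-zero : ∀ q → coeff (yP *P q) 0 ≡ coeff q 0
  coeff-y*-zero q = trans (coeff-*-zero 1ℤ (constP 1ℤ) q) (ℤ.*-identityˡ _)

  coeff-y*-suc : ∀ q i → coeff (yP *P q) (suc i) ≡ coeff q (suc i) ℤ.+ coeff q i
  coeff-y*-suc q i = trans (coeff-*-suc 1ℤ (constP 1ℤ) q i) (cong₂ ℤ._+_ (ℤ.*-identityˡ (coeff q (suc i))) (*P-identityˡ q i))

  -- Synthetic division by x + 1. The remainder is the value at -1; for a ∷ p the new lowest
  -- coefficient of the quotient is the remainder of `p`.
  divide-y : ∀ p → ∃ λ q → (coeff p 0 ≡ coeff q 0 ℤ.+ ev p) × (∀ i → coeff p (suc i) ≡ coeff q (suc i) ℤ.+ coeff q i)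
  divide-y [] = [] , refl , λ i → refl
  divide-y (a ∷ p) with divide-y p
  ... | q , p₀ , p₊ = (ev p ∷ q) ,
    solve 2 (λ a c → (a := c :+ (a :+ con -1ℤ :* c))) refl a (ev p) , λ where
      zero    → p₀
      (suc i) → p₊ i

  quotient-y : ∀ p → ev p ≡ 0ℤ → ∃ λ q → p ≈P (yP *P q)
  quotient-y p p≡0 with divide-y p
  ... | q , p₀ , p₊ = q , λ where
    zero    → trans p₀ (trans (cong (λ z → coeff q 0 ℤ.+ z) p≡0) (trans (ℤ.+-identityʳ _) (sym (coeff-y*-zero q))))
    (suc i) → trans (p₊ i) (sym (coeff-y*-suc q i))

  -- The constant coefficient of x + 1 is 1, so a product with it determines the other factor from
  -- the lowest coefficient upwards.
  cancel-y : ∀ p q → (yP *P p) ≈P (yP *P q) → p ≈P q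
  cancel-y p q yp≈yq zero    = trans (sym (coeff-y*-zero p)) (trans (yp≈yq 0) (coeff-y*-zero q))
  cancel-y p q yp≈yq (suc i) = ∙-cancelʳ (coeff q i) (coeff p (suc i)) (coeff q (suc i)) (trans
    (cong (λ z → coeff p (suc i) ℤ.+ z) (sym (cancel-y p q yp≈yq i)))
    (trans (sym (coeff-y*-suc p i)) (trans (yp≈yq (suc i)) (coeff-y*-suc q i))))

  evaluation : Evaluation polyRing
  evaluation = record
    { y = yP ; ev = ev
    ; ev-cong = λ {p} {q} → evalP-cong p q -1ℤ
    ; ev-+ = λ p q → evalP-+ p q -1ℤ
    ; ev-* = λ p q → evalP-* p q -1ℤ
    ; ev-neg = λ p → trans (evalP-scale -1ℤ p -1ℤ) (ℤ.-1*i≡-i (ev p))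
    ; ev-0 = refl ; ev-1 = refl ; ev-y = refl
    ; quotient = quotient-y ; cancel = cancel-y }

  module PR = Corank polyRing evaluation
  module PD = Determinants polyRing

  constP-* : ∀ a b → constP (a ℤ.* b) ≈P (constP a *P constP b)
  constP-* a b zero    = sym (ℤ.+-identityʳ _)
  constP-* a b (suc i) = refl

  constP-0 : constP 0ℤ ≈P []
  constP-0 zero    = refl
  constP-0 (suc i) = refl

  constP-+ : ∀ a b → constP (a ℤ.+ b) ≈P (constP a +P constP b)
  constP-+ a b i = refl

  ev-constP : ∀ a → ev (constP a) ≡ a
  ev-constP a = trans (cong (λ z → a ℤ.+ z) (ℤ.*-zeroʳ -1ℤ)) (ℤ.+-identityʳ a)

  module PP = PR.Pencil constP constP-+ constP-* constP-0 ev-constP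

  -- Reconciles two forms of the sign: `signP` has period two, whereas `PD.sg` negates at every
  -- step.
  sg-signP : ∀ k p → scaleP (signP k) p ≈P (PD.sg k *P p)
  sg-signP zero p i = trans (coeff-scale 1ℤ p i) (trans (ℤ.*-identityˡ _) (sym (*P-identityˡ p i)))
  sg-signP (suc zero) p i = sym (trans (scale-* -1ℤ (constP 1ℤ) p i) (trans
    (coeff-scale -1ℤ (constP 1ℤ *P p) i) (trans (cong (-1ℤ ℤ.*_) (*P-identityˡ p i)) (sym (coeff-scale -1ℤ p i)))))
  sg-signP (suc (suc k)) p i = trans (sg-signP k p i) (*P-cong (PD.sg k) (negP (negP (PD.sg k))) p p
    (λ i → sym (trans (coeff-scale -1ℤ (negP (PD.sg k)) i) (trans (cong (-1ℤ ℤ.*_) (coeff-scale -1ℤ (PD.sg k) i))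
      (solve 1 (λ x → (con -1ℤ :* (con -1ℤ :* x) := x)) refl (coeff (PD.sg k) i))))) (λ i → refl) i)

  sumFinP-cong : ∀ {n} (f g : Fin n → Poly) → (∀ i → f i ≈P g i) → sumFinP f ≈P PD.sum g
  sumFinP-cong {zero}  f g f≈g = λ i → refl
  sumFinP-cong {suc n} f g f≈g = +P-cong (f zero) (g zero) (sumFinP (λ i → f (suc i))) (PD.sum (λ i → g (suc i)))
    (f≈g zero) (sumFinP-cong (λ i → f (suc i)) (λ i → g (suc i)) (λ i → f≈g (suc i)))

  det≈ : ∀ n (M : Fin n → Fin n → Poly) → Defs.det n M ≈P PD.det n M
  det≈ zero    M = λ i → refl
  det≈ (suc n) M = sumFinP-cong (λ j → scaleP (signP (toℕ j)) (M zero j *P Defs.det n (PD.minor M j))) (PD.laplace M) λ j i → trans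
    (sg-signP (toℕ j) (M zero j *P Defs.det n (PD.minor M j)) i)
    (*P-congˡ (PD.sg (toℕ j)) (M zero j *P Defs.det n (PD.minor M j)) (M zero j *P PD.det n (PD.minor M j))
      (*P-congˡ (M zero j) (Defs.det n (PD.minor M j)) (PD.det n (PD.minor M j)) (det≈ n (PD.minor M j))) i)

  -- Degree and leading coefficient of characteristic polynomials

  charMatrix : ∀ {n} → (Fin n → Fin n → ℤ) → Fin n → Fin n → Poly
  charMatrix A i j = if i ==F j then XP +P constP (ℤ.- A i j) else constP (ℤ.- A i j)

  coeff-sumFinP : ∀ {n} (f : Fin n → Poly) i → coeff (sumFinP f) i ≡ Z.sum (λ j → coeff (f j) i)
  coeff-sumFinP {zero}  f i = refl
  coeff-sumFinP {suc n} f i = trans (coeff-+ (f zero) (sumFinP (λ j → f (suc j))) i)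
    (cong (λ z → coeff (f zero) i ℤ.+ z) (coeff-sumFinP (λ j → f (suc j)) i))

  Linear : Poly → Set
  Linear p = ∀ i → coeff p (suc (suc i)) ≡ 0ℤ

  coeff-linear-* : ∀ p q → Linear p → ∀ i →
    coeff (p *P q) (suc i) ≡ coeff p 0 ℤ.* coeff q (suc i) ℤ.+ coeff p 1 ℤ.* coeff q i
  coeff-linear-* p q lin i = trans (*P-cong p (coeff p 0 ∷ coeff p 1 ∷ []) q q
      (λ { zero → refl ; (suc zero) → refl ; (suc (suc i)) → lin i }) (λ i → refl) (suc i))
    (trans (coeff-*-suc (coeff p 0) (constP (coeff p 1)) q i) (cong (λ z → coeff p 0 ℤ.* coeff q (suc i) ℤ.+ z) (constant i)))
    where
    constant : ∀ i → coeff (constP (coeff p 1) *P q) i ≡ coeff p 1 ℤ.* coeff q i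
    constant zero    = coeff-*-zero (coeff p 1) [] q
    constant (suc i) = trans (coeff-*-suc (coeff p 1) [] q i) (ℤ.+-identityʳ _)

  signP≡sg : ∀ k → signP k ≡ Z.sg k
  signP≡sg zero          = refl
  signP≡sg (suc zero)    = refl
  signP≡sg (suc (suc k)) = trans (signP≡sg k) (sym (ℤ.neg-involutive (Z.sg k)))

  det-degree : ∀ n (M : Fin n → Fin n → Poly) → (∀ i j → Linear (M i j)) → ∀ i → n ℕ.< i → coeff (Defs.det n M) i ≡ 0ℤ
  det-degree zero    M lin (suc i) _   = refl
  det-degree (suc n) M lin (suc i) n<i = trans (coeff-sumFinP (λ j → scaleP (signP (toℕ j)) (M zero j *P d j)) (suc i)) (Z.sum-zero _ λ j → trans
    (coeff-scale (signP (toℕ j)) (M zero j *P d j) (suc i)) (trans (cong (signP (toℕ j) ℤ.*_) (trans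
      (coeff-linear-* (M zero j) (d j) (lin zero j) i) (trans (cong₂ ℤ._+_
        (trans (cong (coeff (M zero j) 0 ℤ.*_) (d≡0 j (suc i) (ℕ.<-trans (ℕ.s<s⁻¹ n<i) (ℕ.n<1+n i)))) (ℤ.*-zeroʳ (coeff (M zero j) 0)))
        (trans (cong (coeff (M zero j) 1 ℤ.*_) (d≡0 j i (ℕ.s<s⁻¹ n<i))) (ℤ.*-zeroʳ (coeff (M zero j) 1))))
        refl))) (ℤ.*-zeroʳ (signP (toℕ j)))))
    where
    d : ∀ j → Poly
    d j = Defs.det n (PD.minor M j)
    d≡0 : ∀ j i → n ℕ.< i → coeff (d j) i ≡ 0ℤ
    d≡0 j = det-degree n (PD.minor M j) (λ r c → lin (suc r) (punchIn j c))

  det-leading : ∀ n (M : Fin n → Fin n → Poly) → (∀ i j → Linear (M i j)) →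
    coeff (Defs.det n M) n ≡ Z.det n (λ i j → coeff (M i j) 1)
  det-leading zero    M lin = refl
  det-leading (suc n) M lin = trans (coeff-sumFinP (λ j → scaleP (signP (toℕ j)) (M zero j *P d j)) (suc n)) (Z.sum-cong _ (Z.laplace (λ i j → coeff (M i j) 1)) λ j → trans
    (coeff-scale (signP (toℕ j)) (M zero j *P d j) (suc n)) (cong₂ ℤ._*_ (signP≡sg (toℕ j)) (trans
      (coeff-linear-* (M zero j) (d j) (lin zero j) n) (trans (cong₂ ℤ._+_
        (trans (cong (coeff (M zero j) 0 ℤ.*_) (det-degree n (PD.minor M j) (λ r c → lin (suc r) (punchIn j c)) (suc n) (ℕ.n<1+n n)))
          (ℤ.*-zeroʳ (coeff (M zero j) 0)))
        (cong (coeff (M zero j) 1 ℤ.*_) (det-leading n (PD.minor M j) (λ r c → lin (suc r) (punchIn j c)))))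
        (ℤ.+-identityˡ _)))))
    where
    d : ∀ j → Poly
    d j = Defs.det n (PD.minor M j)

  charMatrix-linear : ∀ {n} (A : Fin n → Fin n → ℤ) i j → Linear (charMatrix A i j)
  charMatrix-linear A i j k with i ==F j
  ... | true  = refl
  ... | false = refl

  det-identity : ∀ n → Z.det n (λ i j → if i ==F j then 1ℤ else 0ℤ) ≡ 1ℤ
  det-identity zero    = refl
  det-identity (suc n) = trans (Z.det-block {n} (λ i j → if i ==F j then 1ℤ else 0ℤ) (λ i → refl))
    (trans (ℤ.*-identityˡ _) (det-identity n))

  charPoly-monic : ∀ n (A : Fin n → Fin n → ℤ) → coeff (charPoly n A) n ≡ 1ℤ
  charPoly-monic n A = trans (det-leading n (charMatrix A) (charMatrix-linear A))
    (trans (Z.det-cong n _ (λ i j → if i ==F j then 1ℤ else 0ℤ) entry) (det-identity n))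
    where
    entry : ∀ i j → coeff (charMatrix A i j) 1 ≡ (if i ==F j then 1ℤ else 0ℤ)
    entry i j with i ==F j
    ... | true  = refl
    ... | false = refl

  -- A monic polynomial of degree n determines n. In this way a cospectral graph of arbitrary order
  -- is shown to have the right number of vertices.
  charPoly-order : ∀ {n k} (A : Fin n → Fin n → ℤ) (B : Fin k → Fin k → ℤ) → charPoly n A ≈P charPoly k B → n ≡ k
  charPoly-order {n} {k} A B A≈B with ℕ.<-cmp n k
  ... | tri≈ _ n≡k _ = n≡k
  ... | tri< n<k _ _ = contradiction (trans (sym (det-degree n (charMatrix A) (charMatrix-linear A) k n<k)) (trans (A≈B k) (charPoly-monic k B))) λ ()
  ... | tri> _ _ k<n = contradiction (trans (sym (det-degree k (charMatrix B) (charMatrix-linear B) n k<n)) (trans (sym (A≈B n)) (charPoly-monic n A))) λ ()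

-- Distances in graphs

module Distances where

  open import Defs
  open import Data.Nat as ℕ using (ℕ; zero; suc; _≤_; _<_; z≤n; s≤s)
  import Data.Nat.Properties as ℕ
  open import Data.Integer as ℤ using (+_)
  open import Data.Fin as Fin using (Fin; zero; suc; toℕ)
  import Data.Fin.Properties as Fin
  open import Data.Bool using (Bool; true; false; _∨_; _∧_)
  open import Data.Bool.Properties using (∨-zeroʳ; ¬-not; ⇔→≡)
  open import Data.Product using (∃; _×_; _,_; proj₁; proj₂)
  open import Data.Sum using (_⊎_; inj₁; inj₂)
  open import Function using (_∘_)
  open import Function.Bundles using (Inverse; mk⇔)
  open import Relation.Nullary using (yes; no; contradiction)
  open import Relation.Binary.PropositionalEquality as ≡ using (_≡_; _≢_; refl; trans; cong; cong₂; subst; subst₂)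

  ∨-true : ∀ a {b} → a ∨ b ≡ true → a ≡ true ⊎ b ≡ true
  ∨-true true  _ = inj₁ refl
  ∨-true false p = inj₂ p

  ∧-true : ∀ a {b} → a ∧ b ≡ true → a ≡ true × b ≡ true
  ∧-true true p = refl , p

  anyFin-intro : ∀ {n} (f : Fin n → Bool) i → f i ≡ true → anyFin f ≡ true
  anyFin-intro f zero    fi rewrite fi = refl
  anyFin-intro f (suc i) fi = trans (cong (f zero ∨_) (anyFin-intro (f ∘ suc) i fi)) (∨-zeroʳ (f zero))

  anyFin-elim : ∀ {n} (f : Fin n → Bool) → anyFin f ≡ true → ∃ λ i → f i ≡ true
  anyFin-elim {suc n} f p with ∨-true (f zero) p
  ... | inj₁ f0 = zero , f0
  ... | inj₂ q with anyFin-elim (f ∘ suc) q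
  ...   | i , fi = suc i , fi

  ==F⇒≡ : ∀ {n} {i j : Fin n} → (i ==F j) ≡ true → i ≡ j
  ==F⇒≡ {i = i} {j} p with i Fin.≟ j
  ... | yes i≡j = i≡j

  ≢⇒==F : ∀ {n} {i j : Fin n} → i ≢ j → (i ==F j) ≡ false
  ≢⇒==F {i = i} {j} i≢j with i Fin.≟ j
  ... | yes i≡j = contradiction i≡j i≢j
  ... | no _    = refl

  maxFin-≥ : ∀ {n} (f : Fin n → ℕ) i → f i ≤ maxFin f
  maxFin-≥ f zero    = ℕ.m≤m⊔n (f zero) _
  maxFin-≥ f (suc i) = ℕ.≤-trans (maxFin-≥ (f ∘ suc) i) (ℕ.m≤n⊔m (f zero) _)

  maxFin-lub : ∀ {n} (f : Fin n → ℕ) {b} → (∀ i → f i ≤ b) → maxFin f ≤ b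
  maxFin-lub {zero}  f f≤b = z≤n
  maxFin-lub {suc n} f f≤b = ℕ.⊔-lub (f≤b zero) (maxFin-lub (f ∘ suc) (f≤b ∘ suc))

  maxFin-attained : ∀ {n} (f : Fin (suc n) → ℕ) → ∃ λ i → f i ≡ maxFin f
  maxFin-attained {zero}  f = zero , ≡.sym (ℕ.⊔-identityʳ (f zero))
  maxFin-attained {suc n} f with ℕ.⊔-sel (f zero) (maxFin (f ∘ suc)) | maxFin-attained (f ∘ suc)
  ... | inj₁ eq | _      = zero , ≡.sym eq
  ... | inj₂ eq | i , fi = suc i , trans fi (≡.sym eq)

  Reach : ∀ {n} → Graph n → ℕ → Fin n → Fin n → Set
  Reach G k u v = reach G k u v ≡ true

  module _ {n} (G : Graph n) where

    reach-refl : ∀ k u → Reach G k u u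
    reach-refl zero    u = ==F-refl u
    reach-refl (suc k) u rewrite reach-refl k u = refl

    reach-suc : ∀ k {u v} → Reach G k u v → Reach G (suc k) u v
    reach-suc k p rewrite p = refl

    reach-step : ∀ k {u w v} → Reach G k u w → adj G w v ≡ true → Reach G (suc k) u v
    reach-step k {u} {w} {v} p q = trans (cong (reach G k u v ∨_) (anyFin-intro _ w (cong₂ _∧_ p q))) (∨-zeroʳ (reach G k u v))

    reach-last : ∀ k {u v} → Reach G (suc k) u v → Reach G k u v ⊎ (∃ λ w → Reach G k u w × adj G w v ≡ true)
    reach-last k {u} {v} p with ∨-true (reach G k u v) p
    ... | inj₁ q = inj₁ q
    ... | inj₂ q with anyFin-elim (λ w → reach G k u w ∧ adj G w v) q
    ...   | w , r = inj₂ (w , ∧-true (reach G k u w) r)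

    reach-mono : ∀ {k l u v} → k ≤ l → Reach G k u v → Reach G l u v
    reach-mono {k} {l} {u} {v} k≤l p = subst (λ l → Reach G l u v) (ℕ.m∸n+n≡m k≤l) (go (l ℕ.∸ k))
      where
      go : ∀ d → Reach G (d ℕ.+ k) u v
      go zero    = p
      go (suc d) = reach-suc (d ℕ.+ k) (go d)

    reach-trans : ∀ k l {u v w} → Reach G k u v → Reach G l v w → Reach G (l ℕ.+ k) u w
    reach-trans k zero    {u} p q = subst (Reach G k u) (==F⇒≡ q) p
    reach-trans k (suc l) p q with reach-last l q
    ... | inj₁ r           = reach-suc (l ℕ.+ k) (reach-trans k l p r)
    ... | inj₂ (x , r , e) = reach-step (l ℕ.+ k) (reach-trans k l p r) e

    reach-edge : ∀ {u v} → adj G u v ≡ true → Reach G 1 u v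
    reach-edge {u} e = reach-step 0 {u} {u} (==F-refl u) e

    reach-sym : ∀ k {u v} → Reach G k u v → Reach G k v u
    reach-sym zero    {u} {v} p rewrite ==F⇒≡ {i = u} {v} p = ==F-refl v
    reach-sym (suc k) {u} {v} p with reach-last k p
    ... | inj₁ q           = reach-suc k (reach-sym k q)
    ... | inj₂ (w , q , e) = subst (λ m → Reach G m v u) (ℕ.+-comm k 1)
            (reach-trans 1 k (reach-edge (trans (Defs.Graph.sym G v w) e)) (reach-sym k q))

    -- A specification of distance without fuel. The search `dist` has fuel n and is shown to meet
    -- it once distances are known to be smaller than n.
    IsDist : Fin n → Fin n → ℕ → Set
    IsDist u v d = Reach G d u v × (∀ k → Reach G k u v → d ≤ k)

    least : ∀ k {u v} → Reach G k u v → ∃ (IsDist u v)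
    least zero    p = 0 , p , λ _ _ → z≤n
    least (suc k) {u} {v} p with reach G k u v in eq
    ... | true  = least k eq
    ... | false = suc k , subst (λ b → b ∨ anyFin (λ w → reach G k u w ∧ adj G w v) ≡ true) (≡.sym eq) p , minimal
      where
      minimal : ∀ l → Reach G l u v → suc k ≤ l
      minimal l q with suc k ℕ.≤? l
      ... | yes k<l = k<l
      ... | no k≮l with trans (≡.sym eq) (reach-mono (ℕ.≤-pred (ℕ.≰⇒> k≮l)) q)
      ...   | ()

    isDist-unique : ∀ {u v d e} → IsDist u v d → IsDist u v e → d ≡ e
    isDist-unique (p , p≤) (q , q≤) = ℕ.≤-antisym (p≤ _ q) (q≤ _ p)

    isDist-predecessor : ∀ {u v d} → IsDist u v (suc d) → ∃ λ w → IsDist u w d × adj G w v ≡ true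
    isDist-predecessor {u} {v} {d} (p , p≤) with reach-last d p
    ... | inj₁ q = contradiction (p≤ d q) ℕ.1+n≰n
    ... | inj₂ (w , q , e) = w , (q , λ k r → ℕ.≤-pred (p≤ (suc k) (reach-step k r e))) , e

    geodesic : ∀ {u v} d → IsDist u v d → ∀ k → k ≤ d → ∃ λ w → IsDist u w k
    geodesic {v = v} d p k k≤d with k ℕ.≟ d
    ... | yes refl = v , p
    geodesic zero p zero k≤d | no k≢d = contradiction refl k≢d
    geodesic (suc d) p k k≤d | no k≢d with isDist-predecessor p
    ... | w , q , _ = geodesic d q k (ℕ.≤-pred (ℕ.≤∧≢⇒< k≤d k≢d))

    -- Vertices at distances 0, ..., d from `u` exist along a geodesic. If d ≥ n, two of these d + 1
    -- vertices coincide, and one vertex would have two distances.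
    isDist-bounded : ∀ {u v d} → IsDist u v d → d < n
    isDist-bounded {u} {v} {d} p with d ℕ.<? n
    ... | yes d<n = d<n
    ... | no d≮n with Fin.pigeonhole (s≤s (ℕ.≮⇒≥ d≮n)) (λ i → proj₁ (point i))
      where
      point : ∀ (i : Fin (suc d)) → ∃ λ w → IsDist u w (toℕ i)
      point i = geodesic d p (toℕ i) (Fin.toℕ≤pred[n] i)
    ...   | i , j , i<j , eq = contradiction
              (isDist-unique (proj₂ (geodesic d p (toℕ i) (Fin.toℕ≤pred[n] i)))
                (subst (λ w → IsDist u w (toℕ j)) (≡.sym eq) (proj₂ (geodesic d p (toℕ j) (Fin.toℕ≤pred[n] j)))))
              (ℕ.<⇒≢ i<j)

    -- The invariant k ≤ d < k + f says that the search has not passed d and has fuel to reach it,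
    -- so the default value returned without fuel never occurs.
    findDist-correct : ∀ {u v d} → IsDist u v d → ∀ f k → k ≤ d → d < k ℕ.+ f → findDist G u v f k ≡ d
    findDist-correct p zero k k≤d d<k = contradiction (subst (_ <_) (ℕ.+-identityʳ k) d<k) (ℕ.≤⇒≯ k≤d)
    findDist-correct {u} {v} {d} (p , p≤) (suc f) k k≤d d<k with reach G k u v in eq
    ... | true  = ℕ.≤-antisym k≤d (p≤ k eq)
    ... | false = findDist-correct (p , p≤) f (suc k) (ℕ.≤∧≢⇒< k≤d k≢d) (subst (d <_) (ℕ.+-suc k f) d<k)
      where
      k≢d : k ≢ d
      k≢d refl with trans (≡.sym eq) p
      ... | ()

    dist-unique : ∀ {u v d} → IsDist u v d → dist G u v ≡ d
    dist-unique p = findDist-correct p n 0 z≤n (isDist-bounded p)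

  module Distance {n} (G : Graph n) (conn : Connected G) where

    d : Fin n → Fin n → ℕ
    d = dist G

    isDist : ∀ u v → IsDist G u v (d u v)
    isDist u v with least G (proj₁ (conn u v)) (proj₂ (conn u v))
    ... | k , p = subst (IsDist G u v) (≡.sym (dist-unique G p)) p

    d-≤ : ∀ {u v} k → Reach G k u v → d u v ≤ k
    d-≤ {u} {v} k p = proj₂ (isDist u v) k p

    d-reach : ∀ u v → Reach G (d u v) u v
    d-reach u v = proj₁ (isDist u v)

    d-refl : ∀ u → d u u ≡ 0
    d-refl u = ℕ.n≤0⇒n≡0 (d-≤ 0 (reach-refl G 0 u))

    d≡0⇒≡ : ∀ {u v} → d u v ≡ 0 → u ≡ v
    d≡0⇒≡ {u} {v} eq = ==F⇒≡ (subst (λ k → Reach G k u v) eq (d-reach u v))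

    d-sym : ∀ u v → d u v ≡ d v u
    d-sym u v = ℕ.≤-antisym (d-≤ _ (reach-sym G (d v u) {v} {u} (d-reach v u))) (d-≤ _ (reach-sym G (d u v) {u} {v} (d-reach u v)))

    d-triangle : ∀ u v w → d u w ≤ d u v ℕ.+ d v w
    d-triangle u v w = subst (d u w ≤_) (ℕ.+-comm (d v w) (d u v)) (d-≤ _ (reach-trans G (d u v) (d v w) (d-reach u v) (d-reach v w)))

    d-pos : ∀ {u v} → u ≢ v → 1 ≤ d u v
    d-pos u≢v = ℕ.n≢0⇒n>0 (u≢v ∘ d≡0⇒≡)

    d-edge : ∀ {u v} → adj G u v ≡ true → d u v ≡ 1
    d-edge {u} {v} e = ℕ.≤-antisym (d-≤ 1 (reach-edge G e)) (d-pos u≢v)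
      where
      u≢v : u ≢ v
      u≢v refl with trans (≡.sym e) (irrefl G u)
      ... | ()

    predecessor : ∀ {u v k} → d u v ≡ suc k → ∃ λ w → d u w ≡ k × adj G w v ≡ true
    predecessor {u} {v} eq with isDist-predecessor G (subst (IsDist G u v) eq (isDist u v))
    ... | w , p , e = w , dist-unique G p , e

    d≡1⇒edge : ∀ {u v} → d u v ≡ 1 → adj G u v ≡ true
    d≡1⇒edge {u} {v} eq with predecessor eq
    ... | w , d≡0 , e = subst (λ w → adj G w v ≡ true) (≡.sym (d≡0⇒≡ d≡0)) e

    d≢1⇒non-edge : ∀ {u v} → d u v ≢ 1 → adj G u v ≡ false
    d≢1⇒non-edge d≢1 = ¬-not (d≢1 ∘ d-edge)

    ε : Fin n → ℕ
    ε = ecc G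

    d≤ε : ∀ u v → d u v ≤ ε u
    d≤ε u v = maxFin-≥ (d u) v

    d≤ε′ : ∀ u v → d u v ≤ ε v
    d≤ε′ u v = subst (_≤ ε v) (d-sym v u) (d≤ε v u)

  reach-map : ∀ {n} (G H : Graph n) (f : Fin n → Fin n) → (∀ i j → adj H (f i) (f j) ≡ adj G i j) →
    ∀ k {u v} → Reach G k u v → Reach H k (f u) (f v)
  reach-map G H f f-adj zero    {u} {v} p rewrite ==F⇒≡ {i = u} {v} p = ==F-refl (f v)
  reach-map G H f f-adj (suc k) {u} {v} p with reach-last G k p
  ... | inj₁ q           = reach-suc H k (reach-map G H f f-adj k q)
  ... | inj₂ (w , q , e) = reach-step H k {f u} {f w} {f v} (reach-map G H f f-adj k q) (trans (f-adj w v) e)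

  module Isomorphism {n} (G H : Graph n) (iso : Iso G H) where
    f g : Fin n → Fin n
    f = Inverse.to (proj₁ iso)
    g = Inverse.from (proj₁ iso)
    fg : ∀ i → f (g i) ≡ i
    fg = Inverse.strictlyInverseˡ (proj₁ iso)
    gf : ∀ i → g (f i) ≡ i
    gf = Inverse.strictlyInverseʳ (proj₁ iso)

    g-adj : ∀ i j → adj G (g i) (g j) ≡ adj H i j
    g-adj i j = trans (≡.sym (proj₂ iso (g i) (g j))) (cong₂ (adj H) (fg i) (fg j))

    reach-≡ : ∀ k u v → reach H k (f u) (f v) ≡ reach G k u v
    reach-≡ k u v = ⇔→≡ {reach H k (f u) (f v)} {reach G k u v} {true} (mk⇔
      (λ p → subst₂ (Reach G k) (gf u) (gf v) (reach-map H G g g-adj k {f u} {f v} p))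
      (reach-map G H f (proj₂ iso) k {u} {v}))

    dist-≡ : ∀ u v → dist H (f u) (f v) ≡ dist G u v
    dist-≡ u v = go n 0
      where
      go : ∀ m k → findDist H (f u) (f v) m k ≡ findDist G u v m k
      go zero    k = refl
      go (suc m) k rewrite reach-≡ k u v with reach G k u v
      ... | true  = refl
      ... | false = go m (suc k)

    ecc-≡ : ∀ u → ecc H (f u) ≡ ecc G u
    ecc-≡ u = ℕ.≤-antisym
      (maxFin-lub (dist H (f u)) λ v → subst (_≤ ecc G u) (trans (≡.sym (dist-≡ u (g v))) (cong (dist H (f u)) (fg v)))
        (maxFin-≥ (dist G u) (g v)))
      (maxFin-lub (dist G u) λ v → subst (_≤ ecc H (f u)) (dist-≡ u v) (maxFin-≥ (dist H (f u)) (f v)))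

    eccMatrix-≡ : ∀ u v → eccMatrix H (f u) (f v) ≡ eccMatrix G u v
    eccMatrix-≡ u v rewrite dist-≡ u v | ecc-≡ u | ecc-≡ v = refl

-- Eccentricity matrices

module Spectra where

  open import Defs hiding (sym; det)
  import Defs
  open Polynomials
  open Distances
  open import Data.Nat as ℕ using (ℕ; zero; suc; _≤_; _<_; _⊓_)
  import Data.Nat.Properties as ℕ
  open import Data.Integer as ℤ using (ℤ; +_; 0ℤ; 1ℤ)
  import Data.Integer.Properties as ℤ
  open import Data.Fin as Fin using (Fin; zero; suc; toℕ)
  import Data.Fin.Properties as Fin
  open import Data.Bool using (true; false; if_then_else_)
  open import Data.List using ([])
  open import Data.Product using (∃; _×_; _,_; proj₁; proj₂)
  open import Relation.Nullary using (Dec; yes; no; ¬_; does)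
  open import Relation.Nullary.Decidable using (dec-true; dec-false)
  open import Relation.Binary.PropositionalEquality as ≡ using (_≡_; _≢_; refl; sym; trans; cong; cong₂; subst)
  open PR using (y^_∣_)
  open Ranks using (module Z; Factor; minors-vanish; factor-neg)
  open import Algebra.Properties.Semiring.Exp (CommutativeRing.semiring polyRing) using (_^_)

  -- I + 𝒜(G), using that the diagonal of 𝒜(G) is zero.
  B : ∀ {n} → Graph n → Fin n → Fin n → ℤ
  B G i j = if i ==F j then 1ℤ else eccMatrix G i j

  B-diag : ∀ {n} (G : Graph n) i → B G i i ≡ 1ℤ
  B-diag G i rewrite ==F-refl i = refl

  powP≡ : ∀ k → powP yP k ≡ yP ^ k
  powP≡ zero    = refl
  powP≡ (suc k) = cong (yP *P_) (powP≡ k)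

  δ≡ : ∀ {n} (i j : Fin n) → PR.δ i j ≡ (if i ==F j then constP 1ℤ else [])
  δ≡ zero    zero    = refl
  δ≡ zero    (suc j) = refl
  δ≡ (suc i) zero    = refl
  δ≡ (suc i) (suc j) = δ≡ i j

  eccMatrix-diag : ∀ {n} (G : Graph n) → Connected G → ∀ i → eccMatrix G i i ≡ 0ℤ
  eccMatrix-diag G conn i rewrite Distance.d-refl G conn i with does (0 ℕ.≟ (ecc G i ⊓ ecc G i))
  ... | true  = refl
  ... | false = refl

  module _ {n} (G : Graph n) (conn : Connected G) where
    open Distance G conn

    B-sym : ∀ i j → B G i j ≡ B G j i
    B-sym i j rewrite ==F-sym i j | d-sym i j | ℕ.⊓-comm (ecc G i) (ecc G j) = refl

    -- x I - 𝒜 = (x + 1) I - (I + 𝒜), compared coefficient by coefficient. The zero diagonal of 𝒜 is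
    -- used where `B` puts 1.
    charMatrix-pencil : ∀ i j → charMatrix (eccMatrix G) i j ≈P ((yP *P PR.δ i j) +P negP (constP (B G i j)))
    charMatrix-pencil i j rewrite δ≡ i j with i Fin.≟ j
    ... | yes refl rewrite eccMatrix-diag G conn i = λ where
      zero                → refl
      (suc zero)          → refl
      (suc (suc zero))    → refl
      (suc (suc (suc k))) → refl
    ... | no _ = λ where
      zero                → sym (trans (ℤ.+-identityˡ _) (ℤ.-1*i≡-i (eccMatrix G i j)))
      (suc zero)          → refl
      (suc (suc k))       → refl

    S : PD.Mat n
    S = charMatrix (eccMatrix G)

    ev-S : ∀ i j → ev (S i j) ≡ ℤ.- B G i j
    ev-S = PP.ev-pencil (B G) B-sym S charMatrix-pencil

    low-rank : ∀ k → y^ k ∣ eccCharPoly G → ∃ λ r → (r ℕ.+ k ≤ n) × Factor r (B G)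
    low-rank k (q , p≈) = proj₁ bound , proj₁ (proj₂ bound) , factor-neg ev-S (proj₂ (proj₂ bound))
      where
      bound : PR.Conclusion k S
      bound = PR.corank-bound n S (PP.pencil-sym (B G) B-sym S charMatrix-pencil)
        (PP.pencil-nd (B G) B-sym S charMatrix-pencil) k (q , λ i → trans (sym (det≈ n S i)) (p≈ i))

    y^∣eccCharPoly : ∀ r p → toℕ p < r → (∀ i → r ≤ toℕ i → ∀ j → B G i j ≡ B G p j) → y^ (n ℕ.∸ r) ∣ eccCharPoly G
    y^∣eccCharPoly r p p<r eq = proj₁ divides , λ i → trans (det≈ n S i) (proj₂ divides i)
      where
      divides : y^ (n ℕ.∸ r) ∣ PD.det n S
      divides = PR.y^∣det-equal-rows n r p S p<r
        (λ i r≤i j → trans (ev-S i j) (trans (cong ℤ.-_ (eq i r≤i j)) (sym (ev-S p j))))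

    rootMult⇒∣ : ∀ {k} → EccMultMinusOne G k → ∃ λ q → (eccCharPoly G ≈P ((yP ^ k) *P q)) × ev q ≢ 0ℤ
    rootMult⇒∣ {k} (q , p≈ , q≢0) = q , subst (λ z → eccCharPoly G ≈P (z *P q)) (powP≡ k) p≈ , q≢0

    ∣⇒rootMult : ∀ {k} q → eccCharPoly G ≈P ((yP ^ k) *P q) → ev q ≢ 0ℤ → EccMultMinusOne G k
    ∣⇒rootMult {k} q p≈ q≢0 = q , subst (λ z → eccCharPoly G ≈P (z *P q)) (sym (powP≡ k)) p≈ , q≢0

    -- If the cofactor vanished at -1, the power k + 1 would divide, and the corank bound would
    -- produce the excluded factorisation.
    exact-mult : ∀ k → y^ k ∣ eccCharPoly G → ¬ (∃ λ r → (r ℕ.+ suc k ≤ n) × Factor r (B G)) → EccMultMinusOne G k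
    exact-mult k (q , p≈) no-factor = ∣⇒rootMult {k} q p≈ λ q≡0 →
      no-factor (low-rank (suc k) (PR.y^∣-root k {eccCharPoly G} q p≈ q≡0))

    B-entry-≡ : ∀ {u v} → u ≢ v → d u v ≡ ε u ⊓ ε v → B G u v ≡ + d u v
    B-entry-≡ {u} {v} u≢v eq rewrite ≢⇒==F u≢v =
      cong (if_then + d u v else 0ℤ) (dec-true (d u v ℕ.≟ (ε u ⊓ ε v)) eq)

    B-entry-≢ : ∀ {u v} → u ≢ v → d u v ≢ ε u ⊓ ε v → B G u v ≡ 0ℤ
    B-entry-≢ {u} {v} u≢v ≢min rewrite ≢⇒==F u≢v =
      cong (if_then + d u v else 0ℤ) (dec-false (d u v ℕ.≟ (ε u ⊓ ε v)) ≢min)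

    -- The alternative between 0 and the minimum is kept as a Boolean, so that finite checks can
    -- range over all patterns of entries.
    B-entry : ∀ {u v} → u ≢ v → ∃ λ b → B G u v ≡ (if b then + (ε u ⊓ ε v) else 0ℤ)
    B-entry {u} {v} u≢v with d u v ℕ.≟ (ε u ⊓ ε v)
    ... | yes eq = true , trans (B-entry-≡ u≢v eq) (cong +_ eq)
    ... | no ≢min = false , B-entry-≢ u≢v ≢min

    B-entry-< : ∀ {u v} → u ≢ v → d u v < ε u → d u v < ε v → B G u v ≡ 0ℤ
    B-entry-< u≢v <u <v = B-entry-≢ u≢v λ eq → ℕ.<⇒≢ (ℕ.⊓-glb <u <v) eq

    B-universal-row : ∀ {w z} → ε w ≡ 1 → B G w z ≡ 1ℤ
    B-universal-row {w} {z} εw = by-cases (w Fin.≟ z)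
      where
      d≡1 : w ≢ z → d w z ≡ 1
      d≡1 w≢z = ℕ.≤-antisym (subst (d w z ≤_) εw (d≤ε w z)) (d-pos w≢z)
      min≡1 : w ≢ z → ε w ⊓ ε z ≡ 1
      min≡1 w≢z = trans (cong (_⊓ ε z) εw) (ℕ.m≤n⇒m⊓n≡m (subst (_≤ ε z) (d≡1 w≢z) (d≤ε′ w z)))
      by-cases : Dec (w ≡ z) → B G w z ≡ 1ℤ
      by-cases (yes refl) = B-diag G w
      by-cases (no w≢z)   = trans (B-entry-≡ w≢z (trans (d≡1 w≢z) (sym (min≡1 w≢z)))) (cong +_ (d≡1 w≢z))

  vanishing-minors : ∀ {r n m} (A : Fin n → Fin n → ℤ) → Factor r A → r < m → (s t : Fin m → Fin n) →
    Z.det m (λ i j → A (s i) (t j)) ≡ 0ℤ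
  vanishing-minors A = minors-vanish {A = A}

  rootMult-cong : ∀ {m n} (G : Graph m) (H : Graph n) {k} → eccCharPoly G ≈P eccCharPoly H → EccMultMinusOne H k → EccMultMinusOne G k
  rootMult-cong G H G≈H (q , p≈ , q≢0) = q , (λ i → trans (G≈H i) (p≈ i)) , q≢0

  -- An isomorphism permutes the rows and the columns of the characteristic matrix simultaneously.
  iso⇒charPoly : ∀ {n} (G H : Graph n) → Iso G H → eccCharPoly G ≈P eccCharPoly H
  iso⇒charPoly {n} G H iso i = trans (det≈ n (charMatrix (eccMatrix G)) i) (trans
    (PD.det-cong n (charMatrix (eccMatrix G)) (λ u v → charMatrix (eccMatrix H) (f u) (f v)) (λ u v k → cong (λ p → coeff p k) (conj u v)) i)
    (trans (PD.det-conj (proj₁ iso) (charMatrix (eccMatrix H)) i) (sym (det≈ n (charMatrix (eccMatrix H)) i))))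
    where
    open Isomorphism G H iso
    same : ∀ u v → (f u ==F f v) ≡ (u ==F v)
    same u v with u Fin.≟ v
    ... | yes refl = ==F-refl (f u)
    ... | no u≢v   = ≢⇒==F (λ fu≡fv → u≢v (trans (sym (gf u)) (trans (cong g fu≡fv) (gf v))))
    conj : ∀ u v → charMatrix (eccMatrix G) u v ≡ charMatrix (eccMatrix H) (f u) (f v)
    conj u v = cong₂ (λ b a → if b then XP +P constP (ℤ.- a) else constP (ℤ.- a)) (sym (same u v)) (sym (eccMatrix-≡ u v))

  -- What the classification uses of distances, eccentricities and I + 𝒜(G); behind a record these
  -- functions do not unfold.
  record Eccentricities {n} (G : Graph n) : Set where
    field
      d           : Fin n → Fin n → ℕ
      d-refl      : ∀ u → d u u ≡ 0
      d-sym       : ∀ u v → d u v ≡ d v u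
      d-triangle  : ∀ u v w → d u w ≤ d u v ℕ.+ d v w
      d-pos       : ∀ {u v} → u ≢ v → 1 ≤ d u v
      d-edge      : ∀ {u v} → adj G u v ≡ true → d u v ≡ 1
      d≡1⇒edge    : ∀ {u v} → d u v ≡ 1 → adj G u v ≡ true
      d≢1⇒non-edge : ∀ {u v} → d u v ≢ 1 → adj G u v ≡ false
      predecessor : ∀ {u v k} → d u v ≡ suc k → ∃ λ w → d u w ≡ k × adj G w v ≡ true
      ε           : Fin n → ℕ
      d≤ε         : ∀ u v → d u v ≤ ε u
      b           : Fin n → Fin n → ℤ
      b≡B         : ∀ u v → b u v ≡ B G u v
      b-diag      : ∀ u → b u u ≡ 1ℤ
      b-sym       : ∀ u v → b u v ≡ b v u
      entry       : ∀ {u v} → u ≢ v → ∃ λ c → b u v ≡ (if c then + (ε u ⊓ ε v) else 0ℤ)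
      entry-≡     : ∀ {u v} → u ≢ v → d u v ≡ ε u ⊓ ε v → b u v ≡ + d u v
      entry-<     : ∀ {u v} → u ≢ v → d u v < ε u → d u v < ε v → b u v ≡ 0ℤ
      universal-row : ∀ {w z} → ε w ≡ 1 → b w z ≡ 1ℤ

  eccentricities : ∀ {n} (G : Graph n) → Connected G → Eccentricities G
  eccentricities G conn = record
    { Distance G conn
    ; b = B G ; b≡B = λ u v → refl ; b-diag = B-diag G ; b-sym = B-sym G conn
    ; entry = B-entry G conn ; entry-≡ = B-entry-≡ G conn ; entry-< = B-entry-< G conn ; universal-row = B-universal-row G conn }

-- Determinants of 4 × 4 matrices

module Minors where

  open import Defs hiding (sym; det)
  open Ranks using (module Z)
  open import Data.Nat as ℕ using (ℕ; zero; suc)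
  open import Data.Integer as ℤ using (ℤ; +_; 0ℤ; 1ℤ)
  import Data.Integer.Properties as ℤ
  open import Data.Integer.Solver using (module +-*-Solver)
  open import Data.Fin as Fin using (Fin; zero; suc; toℕ; punchIn)
  open import Data.Bool using (Bool; true; false; if_then_else_)
  open import Data.Product using (_×_; _,_)
  open import Data.Sum using (inj₁; inj₂)
  open import Relation.Nullary using (Dec; ¬_; contradiction; ¬?; _×-dec_)
  open import Relation.Nullary.Decidable using (toWitness; map′)
  open import Relation.Binary.PropositionalEquality as ≡ using (_≡_; _≢_; refl; sym; trans; cong)
  open +-*-Solver using (solve; _:=_; _:+_; _:*_; _:-_; :-_; con; Polynomial)

  vec4 : ∀ {a} {A : Set a} → A → A → A → A → Fin 4 → A
  vec4 a b c d zero                   = a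
  vec4 a b c d (suc zero)             = b
  vec4 a b c d (suc (suc zero))       = c
  vec4 a b c d (suc (suc (suc zero))) = d

  vec4-≡ : ∀ {A : Set} {a b c d : A} (f : Fin 4 → A) →
    f zero ≡ a → f (suc zero) ≡ b → f (suc (suc zero)) ≡ c → f (suc (suc (suc zero))) ≡ d → ∀ i → f i ≡ vec4 a b c d i
  vec4-≡ f p q r s zero                   = p
  vec4-≡ f p q r s (suc zero)             = q
  vec4-≡ f p q r s (suc (suc zero))       = r
  vec4-≡ f p q r s (suc (suc (suc zero))) = s

  ∀Bool? : ∀ {P : Bool → Set} → (∀ b → Dec (P b)) → Dec (∀ b → P b)
  ∀Bool? {P} P? = map′ (λ { (f , t) false → f ; (f , t) true → t }) (λ p → p false , p true) (P? false ×-dec P? true)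

  select : Bool → ℕ → ℤ
  select b k = if b then + k else 0ℤ

  rows4-det : (M : Fin 4 → Fin 4 → ℤ) {r₀ r₁ r₂ r₃ : Fin 4 → ℤ} →
    (∀ j → M zero j ≡ r₀ j) → (∀ j → M (suc zero) j ≡ r₁ j) → (∀ j → M (suc (suc zero)) j ≡ r₂ j) →
    (∀ j → M (suc (suc (suc zero))) j ≡ r₃ j) → Z.det 4 M ≡ 0ℤ → Z.det 4 (vec4 r₀ r₁ r₂ r₃) ≡ 0ℤ
  rows4-det M {r₀} {r₁} {r₂} {r₃} p q r s det≡0 = trans (Z.det-cong 4 (vec4 r₀ r₁ r₂ r₃) M λ where
    zero j                   → sym (p j)
    (suc zero) j             → sym (q j)
    (suc (suc zero)) j       → sym (r j)
    (suc (suc (suc zero))) j → sym (s j)) det≡0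

  -- The identity modulo 2.
  diameter-two : Bool → Bool → Bool → Bool → Bool → Bool → Fin 4 → Fin 4 → ℤ
  diameter-two a b c d e f = vec4
    (vec4 1ℤ (select a 2) (select b 2) (select c 2))
    (vec4 (select a 2) 1ℤ (select d 2) (select e 2))
    (vec4 (select b 2) (select d 2) 1ℤ (select f 2))
    (vec4 (select c 2) (select e 2) (select f 2) 1ℤ)

  diameter-two-det : ∀ a b c d e f → Z.det 4 (diameter-two a b c d e f) ≢ 0ℤ
  diameter-two-det = toWitness {a? = ∀Bool? λ a → ∀Bool? λ b → ∀Bool? λ c → ∀Bool? λ d → ∀Bool? λ e → ∀Bool? λ f →
    ¬? (Z.det 4 (diameter-two a b c d e f) ℤ.≟ 0ℤ)} _

  universal : Bool → Bool → Bool → Fin 4 → Fin 4 → ℤ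
  universal a b c = vec4
    (vec4 1ℤ 1ℤ 1ℤ 1ℤ)
    (vec4 1ℤ 1ℤ (select a 2) (select b 2))
    (vec4 1ℤ (select a 2) 1ℤ (select c 2))
    (vec4 1ℤ (select b 2) (select c 2) 1ℤ)

  -- Subtracting the row of ones from the others leaves a symmetric 3 × 3 block with zero diagonal
  -- and entries ±1 elsewhere. Its determinant is twice the product of the three entries above the
  -- diagonal.
  universal-det : ∀ a b c → Z.det 4 (universal a b c) ≢ 0ℤ
  universal-det = toWitness {a? = ∀Bool? λ a → ∀Bool? λ b → ∀Bool? λ c → ¬? (Z.det 4 (universal a b c) ℤ.≟ 0ℤ)} _

  -- The vertices are u, y, x, v in this order, with y next to u and x next to v on a diametral
  -- path. `a` is the entry of u and x, `b` that of y and v, and `d` the diameter.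
  geodesic-minor : ℤ → ℤ → ℤ → Fin 4 → Fin 4 → ℤ
  geodesic-minor a b d = vec4 (vec4 1ℤ 0ℤ a d) (vec4 0ℤ 1ℤ 0ℤ b) (vec4 a 0ℤ 1ℤ 0ℤ) (vec4 d b 0ℤ 1ℤ)

  private
    -- The recursion of `Z.det` repeated on solver expressions, so that its interpretation is the
    -- determinant by computation and the solver can prove the closed formula.
    detP : ∀ {k} n → (Fin n → Fin n → Polynomial k) → Polynomial k
    sumP : ∀ {k} n → (Fin n → Polynomial k) → Polynomial k
    sgP : ∀ {k} → ℕ → Polynomial k
    sumP zero    f = con 0ℤ
    sumP (suc n) f = f zero :+ sumP n (λ i → f (suc i))
    sgP zero    = con 1ℤ
    sgP (suc k) = :- sgP k
    detP zero    M = con 1ℤ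
    detP (suc n) M = sumP (suc n) (λ j → sgP (toℕ j) :* (M zero j :* detP n (λ r c → M (suc r) (punchIn j c))))

  geodesic-det : ∀ a b d → Z.det 4 (geodesic-minor a b d) ≡
    (1ℤ ℤ.- a ℤ.* a) ℤ.* (1ℤ ℤ.- b ℤ.* b) ℤ.- d ℤ.* d
  geodesic-det = solve 3 (λ a b d →
    detP 4 (vec4 (vec4 (con 1ℤ) (con 0ℤ) a d) (vec4 (con 0ℤ) (con 1ℤ) (con 0ℤ) b) (vec4 a (con 0ℤ) (con 1ℤ) (con 0ℤ)) (vec4 d b (con 0ℤ) (con 1ℤ)))
    := (con 1ℤ :- a :* a) :* (con 1ℤ :- b :* b) :- d :* d) refl

  private
    square-pos : ∀ n → + n ℤ.* + n ≡ + (n ℕ.* n)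
    square-pos n = sym (ℤ.pos-* n n)

    -- With D = 3 + x this reads (1 - (D-1)²)² - D² = D² ((D-2)² - 1) = D² (D-1) (D-3), whose only
    -- zero with D ≥ 3 is D = 3.
    factorisation : ∀ x → (1ℤ ℤ.- (+ 2 ℤ.+ x) ℤ.* (+ 2 ℤ.+ x)) ℤ.* (1ℤ ℤ.- (+ 2 ℤ.+ x) ℤ.* (+ 2 ℤ.+ x)) ℤ.- (+ 3 ℤ.+ x) ℤ.* (+ 3 ℤ.+ x)
      ≡ x ℤ.* ((+ 3 ℤ.+ x) ℤ.* ((+ 2 ℤ.+ x) ℤ.* (+ 3 ℤ.+ x)))
    factorisation = solve 1 (λ x → (con 1ℤ :- (con (+ 2) :+ x) :* (con (+ 2) :+ x)) :* (con 1ℤ :- (con (+ 2) :+ x) :* (con (+ 2) :+ x))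
        :- (con (+ 3) :+ x) :* (con (+ 3) :+ x)
      := x :* ((con (+ 3) :+ x) :* ((con (+ 2) :+ x) :* (con (+ 3) :+ x)))) refl

    factor≡0 : ∀ e → (+ e) ℤ.* ((+ 3 ℤ.+ + e) ℤ.* ((+ 2 ℤ.+ + e) ℤ.* (+ 3 ℤ.+ + e))) ≡ 0ℤ → e ≡ 0
    factor≡0 e eq with ℤ.i*j≡0⇒i≡0∨j≡0 (+ e) {(+ 3 ℤ.+ + e) ℤ.* ((+ 2 ℤ.+ + e) ℤ.* (+ 3 ℤ.+ + e))} eq
    ... | inj₁ e≡0 = ℤ.+-injective e≡0
    ... | inj₂ eq₁ with ℤ.i*j≡0⇒i≡0∨j≡0 (+ 3 ℤ.+ + e) {(+ 2 ℤ.+ + e) ℤ.* (+ 3 ℤ.+ + e)} eq₁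
    ...   | inj₂ eq₂ with ℤ.i*j≡0⇒i≡0∨j≡0 (+ 2 ℤ.+ + e) {+ 3 ℤ.+ + e} eq₂
    ...     | inj₁ ()
    ...     | inj₂ ()

    -- In these cases the determinant is 1 − D² or 1 − (D−1)² − D² with D = 3 + e.
    one-sided : ∀ e x → 1ℤ ℤ.- + x ℤ.- + (3 ℕ.+ e) ℤ.* + (3 ℕ.+ e) ≢ 0ℤ
    one-sided e x eq with ℤ.+-injective {1} {(3 ℕ.+ e) ℕ.* (3 ℕ.+ e) ℕ.+ x} (trans
      (solve 2 (λ x z → con 1ℤ := (con 1ℤ :- x :- z) :+ z :+ x) refl (+ x) (+ (3 ℕ.+ e) ℤ.* + (3 ℕ.+ e)))
      (trans (cong (λ t → t ℤ.+ + (3 ℕ.+ e) ℤ.* + (3 ℕ.+ e) ℤ.+ + x) eq)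
        (cong (ℤ._+ + x) (trans (ℤ.+-identityˡ _) (square-pos (3 ℕ.+ e))))))
    ... | ()

  geodesic-forces : ∀ e p q → Z.det 4 (geodesic-minor (select p (2 ℕ.+ e)) (select q (2 ℕ.+ e)) (+ (3 ℕ.+ e))) ≡ 0ℤ →
    e ≡ 0 × p ≡ true × q ≡ true
  geodesic-forces e p q det≡0 = cases p q (trans (sym (geodesic-det (select p (2 ℕ.+ e)) (select q (2 ℕ.+ e)) (+ (3 ℕ.+ e)))) det≡0)
    where
    a² : ℕ
    a² = (2 ℕ.+ e) ℕ.* (2 ℕ.+ e)
    D² : ℤ
    D² = + (3 ℕ.+ e) ℤ.* + (3 ℕ.+ e)
    value : Bool → Bool → ℤ
    value p q = (1ℤ ℤ.- select p (2 ℕ.+ e) ℤ.* select p (2 ℕ.+ e)) ℤ.* (1ℤ ℤ.- select q (2 ℕ.+ e) ℤ.* select q (2 ℕ.+ e)) ℤ.- D²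
    cases : ∀ p q → value p q ≡ 0ℤ → e ≡ 0 × p ≡ true × q ≡ true
    cases true  true  eq = factor≡0 e (trans (sym (factorisation (+ e))) eq) , refl , refl
    cases false false eq = contradiction eq (one-sided e 0)
    cases true  false eq = contradiction (trans (cong (ℤ._- D²) (trans (cong (λ t → 1ℤ ℤ.- t) (sym (square-pos (2 ℕ.+ e))))
      (sym (ℤ.*-identityʳ (1ℤ ℤ.- + (2 ℕ.+ e) ℤ.* + (2 ℕ.+ e)))))) eq) (one-sided e a²)
    cases false true  eq = contradiction (trans (cong (ℤ._- D²) (trans (cong (λ t → 1ℤ ℤ.- t) (sym (square-pos (2 ℕ.+ e))))
      (sym (ℤ.*-identityˡ (1ℤ ℤ.- + (2 ℕ.+ e) ℤ.* + (2 ℕ.+ e)))))) eq) (one-sided e a²)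

  -- A fifth vertex w beside the path u, y, x, v of diameter 3, with α, β, γ, δ its entries against
  -- u, y, x, v. Rows are u, y, x, v and columns u, y, x, w; in `extra-principal` rows and columns
  -- are both u, y, x, w.
  extra-mixed : ℤ → ℤ → ℤ → ℤ → Fin 4 → Fin 4 → ℤ
  extra-mixed α β γ δ = vec4 (vec4 1ℤ 0ℤ (+ 2) α) (vec4 0ℤ 1ℤ 0ℤ β) (vec4 (+ 2) 0ℤ 1ℤ γ) (vec4 (+ 3) (+ 2) 0ℤ δ)

  extra-principal : ℤ → ℤ → ℤ → Fin 4 → Fin 4 → ℤ
  extra-principal α β γ = vec4 (vec4 1ℤ 0ℤ (+ 2) α) (vec4 0ℤ 1ℤ 0ℤ β) (vec4 (+ 2) 0ℤ 1ℤ γ) (vec4 α β γ 1ℤ)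

  -- The principal minor is 3β² - 3 - (α² - 4αγ + γ²). Over the admissible values it vanishes only
  -- for α = 3, β = 2, γ = 0, the entries of v itself. The mixed minor is then 3(1 - δ), which is
  -- nonzero because δ is 0 or 3. Here `k` stands for the minimum of 3 and the eccentricity of w.
  extra-vertex : ∀ c p q r s → let k = if c then 2 else 3 in
    ¬ (Z.det 4 (extra-mixed (select p k) (select q 2) (select r 2) (select s k)) ≡ 0ℤ ×
       Z.det 4 (extra-principal (select p k) (select q 2) (select r 2)) ≡ 0ℤ)
  extra-vertex = toWitness {a? = ∀Bool? λ c → ∀Bool? λ p → ∀Bool? λ q → ∀Bool? λ r → ∀Bool? λ s → ¬?
    ((Z.det 4 (extra-mixed (select p (if c then 2 else 3)) (select q 2) (select r 2) (select s (if c then 2 else 3))) ℤ.≟ 0ℤ) ×-dec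
     (Z.det 4 (extra-principal (select p (if c then 2 else 3)) (select q 2) (select r 2)) ℤ.≟ 0ℤ))} _

-- Graphs whose 4 × 4 minors vanish

module Classify where

  open import Defs hiding (sym; det)
  import Defs
  open Ranks using (module Z)
  open Polynomials using (module PD)
  open Distances
  open Spectra
  open Minors
  open import Data.Nat as ℕ using (ℕ; zero; suc; _≤_; _<_; _⊓_; z≤n; s≤s)
  import Data.Nat.Properties as ℕ
  open import Data.Integer as ℤ using (+_; 0ℤ; 1ℤ)
  open import Data.Fin as Fin using (Fin; zero; suc; toℕ)
  import Data.Fin.Properties as Fin
  open import Data.Fin.Permutation using (Permutation′; transpose; _∘ₚ_; _⟨$⟩ʳ_; _⟨$⟩ˡ_; inverseˡ)
  open import Data.Bool using (Bool; true; false; if_then_else_; not; _∧_; _∨_)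
  open import Data.Bool.Properties using (∨-zeroʳ)
  open import Data.Product using (∃; _×_; _,_; proj₁; proj₂)
  open import Data.Sum using (_⊎_; inj₁; inj₂)
  open import Function using (_∘_)
  open import Function.Bundles using (mk↔ₛ′)
  open import Relation.Nullary using (Dec; yes; no; ¬_; contradiction)
  open import Relation.Binary.PropositionalEquality as ≡ using (_≡_; _≢_; refl; sym; trans; cong; cong₂; subst)

  module Classification {m} (G : Graph (4 ℕ.+ m)) (E : Eccentricities G)
    (minors : ∀ (s t : Fin 4 → Fin (4 ℕ.+ m)) → Z.det 4 (λ i j → Eccentricities.b E (s i) (t j)) ≡ 0ℤ) where
    open Eccentricities E

    Vertex : Set
    Vertex = Fin (4 ℕ.+ m)

    entry-select : ∀ {u v} k → u ≢ v → ε u ⊓ ε v ≡ k → ∃ λ c → b u v ≡ select c k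
    entry-select k u≢v min≡k = proj₁ e , trans (proj₂ e) (cong (λ k → if proj₁ e then + k else 0ℤ) min≡k)
      where e = entry u≢v

    d≢0⇒≢ : ∀ {u v k} → d u v ≡ suc k → u ≢ v
    d≢0⇒≢ {u} eq refl with trans (sym eq) (d-refl u)
    ... | ()

    d≤ε′ : ∀ u v → d u v ≤ ε v
    d≤ε′ u v = subst (_≤ ε v) (d-sym v u) (d≤ε v u)

    ε-pos : ∀ {u v} → u ≢ v → 1 ≤ ε u
    ε-pos {u} {v} u≢v = ℕ.≤-trans (d-pos u≢v) (d≤ε u v)

    transposed : ∀ {u v x} → b u v ≡ x → b v u ≡ x
    transposed {u} {v} eq = trans (b-sym v u) eq

    radius-two-impossible : ¬ (∀ z → ε z ≡ 2)
    radius-two-impossible ε≡2 = diameter-two-det (proj₁ b₀₁) (proj₁ b₀₂) (proj₁ b₀₃) (proj₁ b₁₂) (proj₁ b₁₃) (proj₁ b₂₃)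
      (rows4-det (λ i j → b (s i) (s j))
        (vec4-≡ (λ j → b v₀ (s j)) (b-diag v₀) (proj₂ b₀₁) (proj₂ b₀₂) (proj₂ b₀₃))
        (vec4-≡ (λ j → b v₁ (s j)) (transposed (proj₂ b₀₁)) (b-diag v₁) (proj₂ b₁₂) (proj₂ b₁₃))
        (vec4-≡ (λ j → b v₂ (s j)) (transposed (proj₂ b₀₂)) (transposed (proj₂ b₁₂)) (b-diag v₂) (proj₂ b₂₃))
        (vec4-≡ (λ j → b v₃ (s j)) (transposed (proj₂ b₀₃)) (transposed (proj₂ b₁₃)) (transposed (proj₂ b₂₃)) (b-diag v₃))
        (minors s s))
      where
      v₀ v₁ v₂ v₃ : Vertex
      v₀ = zero
      v₁ = suc zero
      v₂ = suc (suc zero)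
      v₃ = suc (suc (suc zero))
      s : Fin 4 → Vertex
      s = vec4 v₀ v₁ v₂ v₃
      e : ∀ {u v} → u ≢ v → ∃ λ c → b u v ≡ select c 2
      e {u} {v} u≢v = entry-select 2 u≢v (cong₂ _⊓_ (ε≡2 u) (ε≡2 v))
      b₀₁ : ∃ λ c → b v₀ v₁ ≡ select c 2
      b₀₁ = e λ ()
      b₀₂ : ∃ λ c → b v₀ v₂ ≡ select c 2
      b₀₂ = e λ ()
      b₀₃ : ∃ λ c → b v₀ v₃ ≡ select c 2
      b₀₃ = e λ ()
      b₁₂ : ∃ λ c → b v₁ v₂ ≡ select c 2
      b₁₂ = e λ ()
      b₁₃ : ∃ λ c → b v₁ v₃ ≡ select c 2
      b₁₃ = e λ ()
      b₂₃ : ∃ λ c → b v₂ v₃ ≡ select c 2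
      b₂₃ = e λ ()

    module DiameterTwo (u v w : Vertex) (duv : d u v ≡ 2) (ε≤2 : ∀ z → ε z ≤ 2) (εw≤1 : ε w ≤ 1) where

      u≢v : u ≢ v
      u≢v = d≢0⇒≢ duv

      εu : ε u ≡ 2
      εu = ℕ.≤-antisym (ε≤2 u) (subst (_≤ ε u) duv (d≤ε u v))

      εv : ε v ≡ 2
      εv = ℕ.≤-antisym (ε≤2 v) (subst (_≤ ε v) duv (d≤ε′ u v))

      ≢w : ∀ {z} → ε z ≡ 2 → w ≢ z
      ≢w εz refl = contradiction (subst (_≤ 1) εz εw≤1) λ { (s≤s ()) }

      εw : ε w ≡ 1
      εw = ℕ.≤-antisym εw≤1 (ε-pos (≢w εu))

      others-universal : ∀ x → x ≢ u → x ≢ v → ε x ≡ 1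
      others-universal x x≢u x≢v = by-cases (ε x ℕ.≤? 1)
        where
        module _ (εx : ε x ≡ 2) where
          b₁ : ∃ λ c → b u v ≡ select c 2
          b₁ = entry-select 2 u≢v (cong₂ _⊓_ εu εv)
          b₂ : ∃ λ c → b u x ≡ select c 2
          b₂ = entry-select 2 (x≢u ∘ sym) (cong₂ _⊓_ εu εx)
          b₃ : ∃ λ c → b v x ≡ select c 2
          b₃ = entry-select 2 (x≢v ∘ sym) (cong₂ _⊓_ εv εx)
          s : Fin 4 → Vertex
          s = vec4 w u v x
          row : ∀ z → b w z ≡ 1ℤ
          row z = universal-row εw
          singular : Z.det 4 (universal (proj₁ b₁) (proj₁ b₂) (proj₁ b₃)) ≡ 0ℤ
          singular = rows4-det (λ i j → b (s i) (s j))
            (vec4-≡ (λ j → b w (s j)) (row w) (row u) (row v) (row x))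
            (vec4-≡ (λ j → b u (s j)) (transposed (row u)) (b-diag u) (proj₂ b₁) (proj₂ b₂))
            (vec4-≡ (λ j → b v (s j)) (transposed (row v)) (transposed (proj₂ b₁)) (b-diag v) (proj₂ b₃))
            (vec4-≡ (λ j → b x (s j)) (transposed (row x)) (transposed (proj₂ b₂)) (transposed (proj₂ b₃)) (b-diag x))
            (minors s s)
        by-cases : Dec (ε x ≤ 1) → ε x ≡ 1
        by-cases (yes εx≤1) = ℕ.≤-antisym εx≤1 (ε-pos x≢u)
        by-cases (no εx≰1)  = contradiction (singular εx) (universal-det (proj₁ (b₁ εx)) (proj₁ (b₂ εx)) (proj₁ (b₃ εx)))
          where
          εx : ε x ≡ 2
          εx = ℕ.≤-antisym (ε≤2 x) (ℕ.≰⇒> εx≰1)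

      adj-universal : ∀ {x z} → x ≢ u → x ≢ v → x ≢ z → adj G x z ≡ true
      adj-universal {x} {z} x≢u x≢v x≢z = d≡1⇒edge
        (ℕ.≤-antisym (subst (d x z ≤_) (others-universal x x≢u x≢v) (d≤ε x z)) (d-pos x≢z))

      v′ : Vertex
      v′ = transpose u zero ⟨$⟩ʳ v

      -- Moves `u` to 0 and `v` to 1. The first transposition may displace `v`, to `v′`; since `v′`
      -- is not 0, the second one leaves the image of `u` in place.
      π : Permutation′ (4 ℕ.+ m)
      π = transpose u zero ∘ₚ transpose v′ (suc zero)

      π-injective : ∀ {i j} → π ⟨$⟩ʳ i ≡ π ⟨$⟩ʳ j → i ≡ j
      π-injective eq = trans (sym (inverseˡ π)) (trans (cong (π ⟨$⟩ˡ_) eq) (inverseˡ π))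

      zero≢v′ : zero ≢ v′
      zero≢v′ 0≡v′ = u≢v (trans (sym (inverseˡ (transpose u zero))) (trans
        (cong (transpose u zero ⟨$⟩ˡ_) (trans (PD.transpose-i u zero) 0≡v′)) (inverseˡ (transpose u zero))))

      πu : π ⟨$⟩ʳ u ≡ zero
      πu = trans (cong (transpose v′ (suc zero) ⟨$⟩ʳ_) (PD.transpose-i u zero)) (PD.transpose-≢ v′ (suc zero) zero≢v′ (λ ()))

      πv : π ⟨$⟩ʳ v ≡ suc zero
      πv = PD.transpose-i v′ (suc zero)

      big-π : ∀ {i} → i ≢ u → i ≢ v → big (π ⟨$⟩ʳ i) ≡ true
      big-π {i} i≢u i≢v = go (π ⟨$⟩ʳ i) (λ eq → i≢u (π-injective (trans eq (sym πu)))) (λ eq → i≢v (π-injective (trans eq (sym πv))))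
        where
        go : ∀ (k : Vertex) → k ≢ zero → k ≢ suc zero → big k ≡ true
        go zero          k≢0 _   = contradiction refl k≢0
        go (suc zero)    _   k≢1 = contradiction refl k≢1
        go (suc (suc k)) _   _   = refl

      non-adjacent : adj G u v ≡ false
      non-adjacent = d≢1⇒non-edge λ d≡1 → contradiction (trans (sym duv) d≡1) λ ()

      π-adj : ∀ i j → kj (π ⟨$⟩ʳ i) (π ⟨$⟩ʳ j) ≡ adj G i j
      π-adj i j = by-equality (i Fin.≟ j)
        where
        distinct : i ≢ j → not ((π ⟨$⟩ʳ i) ==F (π ⟨$⟩ʳ j)) ≡ true
        distinct i≢j = cong not (≢⇒==F (i≢j ∘ π-injective))
        first : i ≢ j → i ≢ u → i ≢ v → kj (π ⟨$⟩ʳ i) (π ⟨$⟩ʳ j) ≡ adj G i j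
        first i≢j i≢u i≢v = trans
          (cong₂ (λ a b → a ∧ (b ∨ big (π ⟨$⟩ʳ j))) (distinct i≢j) (big-π i≢u i≢v)) (sym (adj-universal i≢u i≢v i≢j))
        second : i ≢ j → j ≢ u → j ≢ v → kj (π ⟨$⟩ʳ i) (π ⟨$⟩ʳ j) ≡ adj G i j
        second i≢j j≢u j≢v = trans
          (cong₂ (λ a b → a ∧ (big (π ⟨$⟩ʳ i) ∨ b)) (distinct i≢j) (big-π j≢u j≢v))
          (trans (∨-zeroʳ (big (π ⟨$⟩ʳ i))) (sym (trans (Defs.Graph.sym G i j) (adj-universal j≢u j≢v (i≢j ∘ sym)))))
        pair : ∀ {i j} → i ≡ u → j ≡ v → kj (π ⟨$⟩ʳ i) (π ⟨$⟩ʳ j) ≡ adj G i j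
        pair refl refl = trans (cong₂ kj πu πv) (sym non-adjacent)
        pair′ : ∀ {i j} → i ≡ v → j ≡ u → kj (π ⟨$⟩ʳ i) (π ⟨$⟩ʳ j) ≡ adj G i j
        pair′ refl refl = trans (cong₂ kj πv πu) (sym (trans (Defs.Graph.sym G v u) non-adjacent))
        by-roles : i ≢ j → Dec (i ≡ u) → Dec (i ≡ v) → Dec (j ≡ u) → Dec (j ≡ v) → kj (π ⟨$⟩ʳ i) (π ⟨$⟩ʳ j) ≡ adj G i j
        by-roles i≢j (no i≢u)  (no i≢v)  _         _         = first i≢j i≢u i≢v
        by-roles i≢j _         _         (no j≢u)  (no j≢v)  = second i≢j j≢u j≢v
        by-roles i≢j (yes i≡u) _         (yes j≡u) _         = contradiction (trans i≡u (sym j≡u)) i≢j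
        by-roles i≢j (yes i≡u) _         (no _)    (yes j≡v) = pair i≡u j≡v
        by-roles i≢j (no _)    (yes i≡v) (yes j≡u) _         = pair′ i≡v j≡u
        by-roles i≢j (no _)    (yes i≡v) (no _)    (yes j≡v) = contradiction (trans i≡v (sym j≡v)) i≢j
        by-equality : Dec (i ≡ j) → kj (π ⟨$⟩ʳ i) (π ⟨$⟩ʳ j) ≡ adj G i j
        by-equality (yes refl) = trans (cong (λ b → not b ∧ (big (π ⟨$⟩ʳ i) ∨ big (π ⟨$⟩ʳ i))) (==F-refl (π ⟨$⟩ʳ i))) (sym (irrefl G i))
        by-equality (no i≢j)   = by-roles i≢j (i Fin.≟ u) (i Fin.≟ v) (j Fin.≟ u) (j Fin.≟ v)

      iso : Iso G (KJoin2K1 (2 ℕ.+ m))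
      iso = π , π-adj

    module DiameterThree (u y x v : Vertex)
      (duy : d u y ≡ 1) (dyx : d y x ≡ 1) (dxv : d x v ≡ 1) (dux : d u x ≡ 2) (dyv : d y v ≡ 2) (duv : d u v ≡ 3)
      (ε≤3 : ∀ z → ε z ≤ 3) (εx : ε x ≡ 2) (εy : ε y ≡ 2)
      (buy : b u y ≡ 0ℤ) (byx : b y x ≡ 0ℤ) (bxv : b x v ≡ 0ℤ) (bux : b u x ≡ + 2) (byv : b y v ≡ + 2) (buv : b u v ≡ + 3) where

      εu : ε u ≡ 3
      εu = ℕ.≤-antisym (ε≤3 u) (subst (_≤ ε u) duv (d≤ε u v))

      εv : ε v ≡ 3
      εv = ℕ.≤-antisym (ε≤3 v) (subst (_≤ ε v) duv (d≤ε′ u v))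

      -- A vertex of eccentricity at most 1 would connect `u` and `v` by a walk of length at most 2.
      2≤ε : ∀ w → 2 ≤ ε w
      2≤ε w = by-cases (2 ℕ.≤? ε w)
        where
        by-cases : Dec (2 ≤ ε w) → 2 ≤ ε w
        by-cases (yes p) = p
        by-cases (no ≰) = contradiction (ℕ.≤-trans (subst (_≤ d u w ℕ.+ d w v) duv (d-triangle u w v))
          (ℕ.+-mono-≤ (ℕ.≤-trans (d≤ε′ u w) εw≤1) (ℕ.≤-trans (d≤ε w v) εw≤1))) λ { (s≤s (s≤s ())) }
          where
          εw≤1 : ε w ≤ 1
          εw≤1 = ℕ.≤-pred (ℕ.≰⇒> ≰)

      ε-value : ∀ w → ∃ λ c → ε w ≡ (if c then 2 else 3)
      ε-value w = by-cases (ε w ℕ.≟ 2)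
        where
        by-cases : Dec (ε w ≡ 2) → ∃ λ c → ε w ≡ (if c then 2 else 3)
        by-cases (yes eq) = true , eq
        by-cases (no ≢2)  = false , ℕ.≤-antisym (ε≤3 w) (ℕ.≤∧≢⇒< (2≤ε w) (≢2 ∘ sym))

      -- The eccentricity of `w` is 2 or 3, so each of its entries against the path is 0 or a known
      -- minimum, and the finite check applies to two minors.
      no-other-vertex : ∀ w → w ≢ u → w ≢ y → w ≢ x → w ≢ v → ∀ {P : Set} → P
      no-other-vertex w w≢u w≢y w≢x w≢v = contradiction (mixed , principal)
        (extra-vertex c (proj₁ α) (proj₁ β) (proj₁ γ) (proj₁ δ))
        where
        c : Bool
        c = proj₁ (ε-value w)
        k : ℕ
        k = if c then 2 else 3
        3⊓ : ∀ c → 3 ⊓ (if c then 2 else 3) ≡ (if c then 2 else 3)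
        3⊓ true  = refl
        3⊓ false = refl
        2⊓ : ∀ c → 2 ⊓ (if c then 2 else 3) ≡ 2
        2⊓ true  = refl
        2⊓ false = refl
        α : ∃ λ p → b u w ≡ select p k
        α = entry-select k (w≢u ∘ sym) (trans (cong₂ _⊓_ εu (proj₂ (ε-value w))) (3⊓ c))
        β : ∃ λ p → b y w ≡ select p 2
        β = entry-select 2 (w≢y ∘ sym) (trans (cong₂ _⊓_ εy (proj₂ (ε-value w))) (2⊓ c))
        γ : ∃ λ p → b x w ≡ select p 2
        γ = entry-select 2 (w≢x ∘ sym) (trans (cong₂ _⊓_ εx (proj₂ (ε-value w))) (2⊓ c))
        δ : ∃ λ p → b v w ≡ select p k
        δ = entry-select k (w≢v ∘ sym) (trans (cong₂ _⊓_ εv (proj₂ (ε-value w))) (3⊓ c))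
        cols : Fin 4 → Vertex
        cols = vec4 u y x w
        rows : Fin 4 → Vertex
        rows = vec4 u y x v
        row-u : ∀ j → b u (cols j) ≡ vec4 1ℤ 0ℤ (+ 2) (select (proj₁ α) k) j
        row-u = vec4-≡ (λ j → b u (cols j)) (b-diag u) buy bux (proj₂ α)
        row-y : ∀ j → b y (cols j) ≡ vec4 0ℤ 1ℤ 0ℤ (select (proj₁ β) 2) j
        row-y = vec4-≡ (λ j → b y (cols j)) (transposed buy) (b-diag y) byx (proj₂ β)
        row-x : ∀ j → b x (cols j) ≡ vec4 (+ 2) 0ℤ 1ℤ (select (proj₁ γ) 2) j
        row-x = vec4-≡ (λ j → b x (cols j)) (transposed bux) (transposed byx) (b-diag x) (proj₂ γ)
        row-v : ∀ j → b v (cols j) ≡ vec4 (+ 3) (+ 2) 0ℤ (select (proj₁ δ) k) j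
        row-v = vec4-≡ (λ j → b v (cols j)) (transposed buv) (transposed byv) (transposed bxv) (proj₂ δ)
        row-w : ∀ j → b w (cols j) ≡ vec4 (select (proj₁ α) k) (select (proj₁ β) 2) (select (proj₁ γ) 2) 1ℤ j
        row-w = vec4-≡ (λ j → b w (cols j)) (transposed (proj₂ α)) (transposed (proj₂ β)) (transposed (proj₂ γ)) (b-diag w)
        mixed : Z.det 4 (extra-mixed (select (proj₁ α) k) (select (proj₁ β) 2) (select (proj₁ γ) 2) (select (proj₁ δ) k)) ≡ 0ℤ
        mixed = rows4-det (λ i j → b (rows i) (cols j)) row-u row-y row-x row-v (minors rows cols)
        principal : Z.det 4 (extra-principal (select (proj₁ α) k) (select (proj₁ β) 2) (select (proj₁ γ) 2)) ≡ 0ℤ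
        principal = rows4-det (λ i j → b (cols i) (cols j)) row-u row-y row-x row-w (minors cols cols)

      h : Fin 4 → Vertex
      h = vec4 u y x v

      -- The distance from `u` reads off the position on the path, which makes `h` injective.
      d-u-h : ∀ a → d u (h a) ≡ toℕ a
      d-u-h zero                   = d-refl u
      d-u-h (suc zero)             = duy
      d-u-h (suc (suc zero))       = dux
      d-u-h (suc (suc (suc zero))) = duv

      h-injective : ∀ {a c} → h a ≡ h c → a ≡ c
      h-injective {a} {c} eq = Fin.toℕ-injective (trans (sym (d-u-h a)) (trans (cong (d u) eq) (d-u-h c)))

      position : ∀ w → ∃ λ a → h a ≡ w
      position w = by-cases (w Fin.≟ u) (w Fin.≟ y) (w Fin.≟ x) (w Fin.≟ v)
        where
        by-cases : Dec (w ≡ u) → Dec (w ≡ y) → Dec (w ≡ x) → Dec (w ≡ v) → ∃ λ a → h a ≡ w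
        by-cases (yes eq) _ _ _ = zero , sym eq
        by-cases _ (yes eq) _ _ = suc zero , sym eq
        by-cases _ _ (yes eq) _ = suc (suc zero) , sym eq
        by-cases _ _ _ (yes eq) = suc (suc (suc zero)) , sym eq
        by-cases (no w≢u) (no w≢y) (no w≢x) (no w≢v) = no-other-vertex w w≢u w≢y w≢x w≢v

      non-edge : ∀ {s t k} → d s t ≡ suc (suc k) → adj G s t ≡ false
      non-edge eq = d≢1⇒non-edge λ d≡1 → contradiction (trans (sym eq) d≡1) λ ()

      flip : ∀ {s t c} → adj G s t ≡ c → adj G t s ≡ c
      flip {s} {t} eq = trans (Defs.Graph.sym G t s) eq

      h-adj : ∀ a c → adj G (h a) (h c) ≡ p4adj a c
      h-adj zero                   zero                   = irrefl G u
      h-adj zero                   (suc zero)             = d≡1⇒edge duy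
      h-adj zero                   (suc (suc zero))       = non-edge dux
      h-adj zero                   (suc (suc (suc zero))) = non-edge duv
      h-adj (suc zero)             zero                   = flip (d≡1⇒edge duy)
      h-adj (suc zero)             (suc zero)             = irrefl G y
      h-adj (suc zero)             (suc (suc zero))       = d≡1⇒edge dyx
      h-adj (suc zero)             (suc (suc (suc zero))) = non-edge dyv
      h-adj (suc (suc zero))       zero                   = flip (non-edge dux)
      h-adj (suc (suc zero))       (suc zero)             = flip (d≡1⇒edge dyx)
      h-adj (suc (suc zero))       (suc (suc zero))       = irrefl G x
      h-adj (suc (suc zero))       (suc (suc (suc zero))) = d≡1⇒edge dxv
      h-adj (suc (suc (suc zero))) zero                   = flip (non-edge duv)
      h-adj (suc (suc (suc zero))) (suc zero)             = flip (non-edge dyv)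
      h-adj (suc (suc (suc zero))) (suc (suc zero))       = flip (d≡1⇒edge dxv)
      h-adj (suc (suc (suc zero))) (suc (suc (suc zero))) = irrefl G v

      iso : Iso G P4
      iso = mk↔ₛ′ (λ w → proj₁ (position w)) h (λ a → h-injective (proj₂ (position (h a)))) (λ w → proj₂ (position w)) ,
        λ i j → trans (sym (h-adj (proj₁ (position i)) (proj₁ (position j)))) (cong₂ (adj G) (proj₂ (position i)) (proj₂ (position j)))

    module LargeDiameter (e : ℕ) (u v : Vertex) (duv : d u v ≡ 3 ℕ.+ e) (ε≤ : ∀ z → ε z ≤ 3 ℕ.+ e) where

      D : ℕ
      D = 3 ℕ.+ e

      εu : ε u ≡ D
      εu = ℕ.≤-antisym (ε≤ u) (subst (_≤ ε u) duv (d≤ε u v))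

      εv : ε v ≡ D
      εv = ℕ.≤-antisym (ε≤ v) (subst (_≤ ε v) duv (d≤ε′ u v))

      x : Vertex
      x = proj₁ (predecessor duv)

      dux : d u x ≡ 2 ℕ.+ e
      dux = proj₁ (proj₂ (predecessor duv))

      dxv : d x v ≡ 1
      dxv = d-edge (proj₂ (proj₂ (predecessor duv)))

      dxu : d x u ≡ 2 ℕ.+ e
      dxu = trans (d-sym x u) dux

      -- `predecessor` returns a neighbour of the far endpoint, so the vertex next to `u` is found
      -- by going from `x` back to `u`.
      y : Vertex
      y = proj₁ (predecessor dxu)

      dyx : d y x ≡ 1 ℕ.+ e
      dyx = trans (d-sym y x) (proj₁ (proj₂ (predecessor dxu)))

      duy : d u y ≡ 1
      duy = trans (d-sym u y) (d-edge (proj₂ (proj₂ (predecessor dxu))))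

      dyv : d y v ≡ 2 ℕ.+ e
      dyv = ℕ.≤-antisym
        (subst (d y v ≤_) (trans (cong₂ ℕ._+_ dyx dxv) (ℕ.+-comm (1 ℕ.+ e) 1)) (d-triangle y x v))
        (ℕ.≤-pred (subst (_≤ 1 ℕ.+ d y v) duv (subst (λ k → d u v ≤ k ℕ.+ d y v) duy (d-triangle u y v))))

      εx≥ : 2 ℕ.+ e ≤ ε x
      εx≥ = subst (_≤ ε x) dux (d≤ε′ u x)

      εy≥ : 2 ℕ.+ e ≤ ε y
      εy≥ = subst (_≤ ε y) dyv (d≤ε y v)

      -- Every path vertex considered has eccentricity at least D - 1, so any smaller nonzero
      -- distance lies strictly below both eccentricities.
      vanishing : ∀ {s t} k → d s t ≡ suc k → suc k < 2 ℕ.+ e → 2 ℕ.+ e ≤ ε s → 2 ℕ.+ e ≤ ε t → b s t ≡ 0ℤ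
      vanishing {s} {t} k eq k< s≥ t≥ = entry-< (d≢0⇒≢ eq)
        (subst (_< ε s) (sym eq) (ℕ.<-≤-trans k< s≥)) (subst (_< ε t) (sym eq) (ℕ.<-≤-trans k< t≥))

      D≥ : ∀ {z} → ε z ≡ D → 2 ℕ.+ e ≤ ε z
      D≥ eq = subst (2 ℕ.+ e ≤_) (sym eq) (ℕ.n≤1+n _)

      buy : b u y ≡ 0ℤ
      buy = vanishing 0 duy (s≤s (s≤s z≤n)) (D≥ εu) εy≥

      byx : b y x ≡ 0ℤ
      byx = vanishing e dyx ℕ.≤-refl εy≥ εx≥

      bxv : b x v ≡ 0ℤ
      bxv = vanishing 0 dxv (s≤s (s≤s z≤n)) εx≥ (D≥ εv)

      buv : b u v ≡ + D
      buv = trans (entry-≡ (d≢0⇒≢ duv) (trans duv (sym (trans (cong₂ _⊓_ εu εv) (ℕ.⊓-idem D))))) (cong +_ duv)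

      -- The distance D - 1 is below the eccentricity of `s`, so it appears in the matrix exactly
      -- when `t` has eccentricity D - 1. That equality is recorded because the case D = 3 needs the
      -- eccentricities of `x` and `y`.
      next-to-peripheral : ∀ {s t} → d s t ≡ 2 ℕ.+ e → ε s ≡ D → 2 ℕ.+ e ≤ ε t →
        ∃ λ p → b s t ≡ select p (2 ℕ.+ e) × (p ≡ true → ε t ≡ 2 ℕ.+ e)
      next-to-peripheral {s} {t} dst εs εt≥ = by-cases (ε t ℕ.≟ 2 ℕ.+ e)
        where
        by-cases : Dec (ε t ≡ 2 ℕ.+ e) → ∃ λ p → b s t ≡ select p (2 ℕ.+ e) × (p ≡ true → ε t ≡ 2 ℕ.+ e)
        by-cases (yes εt) = true , trans (entry-≡ (d≢0⇒≢ dst) (trans dst (sym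
            (trans (cong₂ _⊓_ εs εt) (ℕ.m≥n⇒m⊓n≡n (ℕ.n≤1+n (2 ℕ.+ e))))))) (cong +_ dst) , λ _ → εt
        by-cases (no εt≢) = false , entry-< (d≢0⇒≢ dst) (subst₂′ dst εs ℕ.≤-refl)
            (subst (_< ε t) (sym dst) (ℕ.≤∧≢⇒< εt≥ (εt≢ ∘ sym))) , λ ()
          where
          subst₂′ : ∀ {a b c k} → a ≡ k → b ≡ c → k < c → a < b
          subst₂′ refl refl p = p

      p : ∃ λ p → b u x ≡ select p (2 ℕ.+ e) × (p ≡ true → ε x ≡ 2 ℕ.+ e)
      p = next-to-peripheral dux εu εx≥

      q : ∃ λ q → b v y ≡ select q (2 ℕ.+ e) × (q ≡ true → ε y ≡ 2 ℕ.+ e)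
      q = next-to-peripheral (trans (d-sym v y) dyv) εv εy≥

      singular : Z.det 4 (geodesic-minor (select (proj₁ p) (2 ℕ.+ e)) (select (proj₁ q) (2 ℕ.+ e)) (+ D)) ≡ 0ℤ
      singular = rows4-det (λ i j → b (s i) (s j))
        (vec4-≡ (λ j → b u (s j)) (b-diag u) buy bux buv)
        (vec4-≡ (λ j → b y (s j)) (transposed buy) (b-diag y) byx (transposed bvy))
        (vec4-≡ (λ j → b x (s j)) (transposed bux) (transposed byx) (b-diag x) bxv)
        (vec4-≡ (λ j → b v (s j)) (transposed buv) bvy (transposed bxv) (b-diag v))
        (minors s s)
        where
        s : Fin 4 → Vertex
        s = vec4 u y x v
        bux : b u x ≡ select (proj₁ p) (2 ℕ.+ e)
        bux = proj₁ (proj₂ p)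
        bvy : b v y ≡ select (proj₁ q) (2 ℕ.+ e)
        bvy = proj₁ (proj₂ q)

      iso : Iso G P4
      iso = from (geodesic-forces e (proj₁ p) (proj₁ q) singular)
        where
        from : e ≡ 0 × proj₁ p ≡ true × proj₁ q ≡ true → Iso G P4
        from (e≡0 , p≡ , q≡) = DiameterThree.iso u y x v duy (+e≡ dyx) dxv (+e≡ dux) (+e≡ dyv) (+e≡ duv)
            (λ z → subst (ε z ≤_) (cong (3 ℕ.+_) e≡0) (ε≤ z))
            (+e≡ (proj₂ (proj₂ p) p≡)) (+e≡ (proj₂ (proj₂ q) q≡)) buy byx bxv
            (trans (proj₁ (proj₂ p)) (cong₂ select p≡ (cong (2 ℕ.+_) e≡0)))
            (transposed (trans (proj₁ (proj₂ q)) (cong₂ select q≡ (cong (2 ℕ.+_) e≡0))))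
            (trans buv (cong (λ e → + (3 ℕ.+ e)) e≡0))
          where
          +e≡ : ∀ {a k} → a ≡ k ℕ.+ e → a ≡ k
          +e≡ {a} {k} eq = trans eq (trans (cong (k ℕ.+_) e≡0) (ℕ.+-identityʳ k))

    classify : ∀ u v → d u v ≡ ε u → (∀ z → ε z ≤ ε u) → 2 ≤ ε u → Iso G P4 ⊎ Iso G (KJoin2K1 (2 ℕ.+ m))
    classify u v duv ε≤ = by-diameter (ε u) duv ε≤
      where
      by-radius : d u v ≡ 2 → (∀ z → ε z ≤ 2) → Dec (∃ λ w → ε w ≤ 1) → Iso G (KJoin2K1 (2 ℕ.+ m))
      by-radius duv ε≤2 (yes (w , εw≤1)) = DiameterTwo.iso u v w duv ε≤2 εw≤1
      by-radius duv ε≤2 (no none) = contradiction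
        (λ z → ℕ.≤-antisym (ε≤2 z) (ℕ.≰⇒> λ εz≤1 → none (z , εz≤1))) radius-two-impossible
      by-diameter : ∀ k → d u v ≡ k → (∀ z → ε z ≤ k) → 2 ≤ k → Iso G P4 ⊎ Iso G (KJoin2K1 (2 ℕ.+ m))
      by-diameter (suc zero)          duv ε≤ (s≤s ())
      by-diameter (suc (suc zero))    duv ε≤ _ = inj₂ (by-radius duv ε≤ (Fin.any? (λ w → ε w ℕ.≤? 1)))
      by-diameter (suc (suc (suc e))) duv ε≤ _ = inj₁ (LargeDiameter.iso e u v duv ε≤)

-- Multiplicities and the classification

module Characterisation where

  open import Defs hiding (sym; det)
  import Defs
  open Polynomials
  open Distances
  open Spectra
  open Minors
  open Classify
  open import Data.Nat as ℕ using (ℕ; zero; suc; _≤_; _⊓_; z≤n; s≤s; _∸_)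
  import Data.Nat.Properties as ℕ
  open import Data.Integer as ℤ using (ℤ; +_; 0ℤ; 1ℤ; -1ℤ; -[1+_])
  open import Data.Fin as Fin using (Fin; zero; suc; toℕ)
  import Data.Fin.Properties as Fin
  open import Data.Fin.Permutation using (↔⇒≡)
  open import Data.Bool as Bool using (true; not; _∧_; _∨_)
  open import Data.List using ([]; _∷_)
  open import Data.Product using (∃; _×_; _,_; proj₁; proj₂)
  open import Data.Sum using (_⊎_; inj₁; inj₂; swap)
  open import Function.Bundles using (_⇔_; mk⇔)
  open import Relation.Nullary using (Dec; yes; no; ¬_; contradiction)
  open import Relation.Binary.PropositionalEquality as ≡ using (_≡_; _≢_; refl; sym; trans; cong; cong₂; subst)
  open PR using (y^_∣_)
  open Ranks using (module Z; Factor)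
  open import Algebra.Properties.Semiring.Exp (CommutativeRing.semiring polyRing) using (_^_)

  module _ {m} (G : Graph (4 ℕ.+ m)) (conn : Connected G) where

    module _ (E : Eccentricities G) where
      open Eccentricities E

      complete⇒rank-one : (∀ z → ε z ≤ 1) → ∀ i j → b i j ≡ b zero j
      complete⇒rank-one ε≤1 i j = trans (universal-row (ε≡1 i)) (sym (universal-row (ε≡1 zero)))
        where
        ε≥1 : ∀ z → 1 ≤ ε z
        ε≥1 zero    = ℕ.≤-trans (d-pos {zero} {suc zero} λ ()) (d≤ε zero (suc zero))
        ε≥1 (suc z) = ℕ.≤-trans (d-pos {suc z} {zero} λ ()) (d≤ε (suc z) zero)
        ε≡1 : ∀ z → ε z ≡ 1
        ε≡1 z = ℕ.≤-antisym (ε≤1 z) (ε≥1 z)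

      minors-via : (∀ (s t : Fin 4 → Fin (4 ℕ.+ m)) → Z.det 4 (λ i j → B G (s i) (t j)) ≡ 0ℤ) →
        ∀ (s t : Fin 4 → Fin (4 ℕ.+ m)) → Z.det 4 (λ i j → b (s i) (t j)) ≡ 0ℤ
      minors-via minors s t = trans (Z.det-cong 4 (λ i j → b (s i) (t j)) (λ i j → B G (s i) (t j)) (λ i j → b≡B (s i) (t j))) (minors s t)

    E : Eccentricities G
    E = eccentricities G conn

    -- With n = 4 + m, equal rows throughout make y^(n-1) divide, and n - 1 = (1 + m) + 2 exceeds
    -- the assumed multiplicity.
    not-complete : EccMultMinusOne G (1 ℕ.+ m) → ¬ (∀ z → ecc G z ≤ 1)
    not-complete mult ε≤1 = proj₂ (proj₂ exact) (PR.y^∣-excess (1 ℕ.+ m) 1 (proj₁ exact) (proj₁ divides , λ i →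
        trans (sym (proj₁ (proj₂ exact) i)) (proj₂ divides i)))
      where
      exact : ∃ λ q → (eccCharPoly G ≈P ((yP ^ (1 ℕ.+ m)) *P q)) × ev q ≢ 0ℤ
      exact = rootMult⇒∣ G conn {1 ℕ.+ m} mult
      divides : y^ ((1 ℕ.+ m) ℕ.+ 2) ∣ eccCharPoly G
      divides = subst (λ k → y^ k ∣ eccCharPoly G) (ℕ.+-comm 2 (1 ℕ.+ m))
        (y^∣eccCharPoly G conn 1 zero (s≤s z≤n) (λ i _ j → complete⇒rank-one E ε≤1 i j))

    minors-vanish : EccMultMinusOne G (1 ℕ.+ m) → ∀ (s t : Fin 4 → Fin (4 ℕ.+ m)) → Z.det 4 (λ i j → B G (s i) (t j)) ≡ 0ℤ
    minors-vanish mult s t = vanishing-minors (B G) (proj₂ (proj₂ bound)) (s≤s r≤3) s t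
      where
      exact : ∃ λ q → (eccCharPoly G ≈P ((yP ^ (1 ℕ.+ m)) *P q)) × ev q ≢ 0ℤ
      exact = rootMult⇒∣ G conn {1 ℕ.+ m} mult
      bound : ∃ λ r → (r ℕ.+ (1 ℕ.+ m) ≤ 4 ℕ.+ m) × Factor r (B G)
      bound = low-rank G conn (1 ℕ.+ m) (proj₁ exact , proj₁ (proj₂ exact))
      r≤3 : proj₁ bound ≤ 3
      r≤3 = ℕ.+-cancelʳ-≤ (1 ℕ.+ m) (proj₁ bound) 3 (subst (proj₁ bound ℕ.+ (1 ℕ.+ m) ≤_) (sym (ℕ.+-suc 3 m)) (proj₁ (proj₂ bound)))

    forward : EccMultMinusOne G (1 ℕ.+ m) → Iso G P4 ⊎ Iso G (KJoin2K1 (2 ℕ.+ m))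
    forward mult = by-diameter (2 ℕ.≤? ecc G u)
      where
      u-max = maxFin-attained (ecc G)
      u : Fin (4 ℕ.+ m)
      u = proj₁ u-max
      ε≤ : ∀ z → ecc G z ≤ ecc G u
      ε≤ z = subst (ecc G z ≤_) (sym (proj₂ u-max)) (maxFin-≥ (ecc G) z)
      v-max = maxFin-attained (dist G u)
      by-diameter : Dec (2 ≤ ecc G u) → Iso G P4 ⊎ Iso G (KJoin2K1 (2 ℕ.+ m))
      by-diameter (yes 2≤ε) = Classification.classify G E (minors-via E (minors-vanish mult)) u (proj₁ v-max) (proj₂ v-max) ε≤ 2≤ε
      by-diameter (no 2≰ε)  = contradiction (λ z → ℕ.≤-trans (ε≤ z) (ℕ.≤-pred (ℕ.≰⇒> 2≰ε))) (not-complete mult)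

  -- Multiplicity of -1 for K_{n-2} ∨ 2K_1 and P₄

  module Hub {n} (K : Graph n) (hub : Fin n) (hub-adj : ∀ j → hub ≢ j → adj K hub j ≡ true) where

    reach-two : ∀ i j → Reach K 2 i j
    reach-two i j = by-cases (hub Fin.≟ i) (hub Fin.≟ j)
      where
      to-hub : hub ≢ i → Reach K 1 i hub
      to-hub hub≢i = reach-sym K 1 {hub} {i} (reach-edge K {hub} {i} (hub-adj i hub≢i))
      by-cases : Dec (hub ≡ i) → Dec (hub ≡ j) → Reach K 2 i j
      by-cases (no hub≢i)  (no hub≢j)  = reach-step K 1 {i} {hub} {j} (to-hub hub≢i) (hub-adj j hub≢j)
      by-cases (no hub≢i)  (yes refl)  = reach-suc K 1 {i} {j} (to-hub hub≢i)
      by-cases (yes refl)  (no hub≢j)  = reach-suc K 1 {i} {j} (reach-edge K {i} {j} (hub-adj j hub≢j))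
      by-cases (yes refl)  (yes refl)  = reach-refl K 2 i

    conn : Connected K
    conn i j = 2 , reach-two i j

    d≤2 : ∀ i j → dist K i j ≤ 2
    d≤2 i j = Distance.d-≤ K conn {i} {j} 2 (reach-two i j)

    ecc≤2 : ∀ i → ecc K i ≤ 2
    ecc≤2 i = maxFin-lub (dist K i) (d≤2 i)

    ecc-dominating : ∀ i → (∀ j → i ≢ j → adj K i j ≡ true) → ecc K i ≤ 1
    ecc-dominating i i-adj = maxFin-lub (dist K i) λ j → by-cases j (i Fin.≟ j)
      where
      by-cases : ∀ j → Dec (i ≡ j) → dist K i j ≤ 1
      by-cases j (yes refl) = subst (_≤ 1) (sym (Distance.d-refl K conn j)) z≤n
      by-cases j (no i≢j)   = ℕ.≤-reflexive (Distance.d-edge K conn {i} {j} (i-adj j i≢j))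

  -- The graph is a variable known only through its adjacency, so that its distances and its
  -- characteristic polynomial stay symbolic.
  module KJoin {m} (K : Graph (4 ℕ.+ m)) (K-adj : ∀ i j → adj K i j ≡ kj i j) where

    adj-big : ∀ i j → i ≢ j → big i ≡ true → adj K i j ≡ true
    adj-big i j i≢j p = trans (K-adj i j) (trans (cong (λ c → not c ∧ (big i ∨ big j)) (≢⇒==F i≢j)) (cong (_∨ big j) p))

    hub : Fin (4 ℕ.+ m)
    hub = suc (suc zero)

    open Hub K hub (λ j hub≢j → adj-big hub j hub≢j refl)

    ecc-big : ∀ i → ecc K (suc (suc i)) ≤ 1
    ecc-big i = ecc-dominating (suc (suc i)) (λ j i≢j → adj-big (suc (suc i)) j i≢j refl)

    triple : Fin 3 → Fin (4 ℕ.+ m)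
    triple zero             = zero
    triple (suc zero)       = suc zero
    triple (suc (suc zero)) = suc (suc zero)

    module _ (E : Eccentricities K) (d≤2 : ∀ i j → Eccentricities.d E i j ≤ 2)
      (ε≤2 : ∀ i → Eccentricities.ε E i ≤ 2) (ε-big : ∀ i → Eccentricities.ε E (suc (suc i)) ≤ 1) where
      open Eccentricities E

      row-big : ∀ i j → b (suc (suc i)) j ≡ 1ℤ
      row-big i j = universal-row (ℕ.≤-antisym (ε-big i) (ℕ.≤-trans (d-pos {suc (suc i)} {zero} λ ()) (d≤ε (suc (suc i)) zero)))

      d₀₁ : d zero (suc zero) ≡ 2
      d₀₁ = ℕ.≤-antisym (d≤2 zero (suc zero)) (ℕ.≤∧≢⇒< (d-pos λ ()) λ 1≡d → contradiction (trans (sym (K-adj zero (suc zero))) (d≡1⇒edge (sym 1≡d))) λ ())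

      b₀₁ : b zero (suc zero) ≡ + 2
      b₀₁ = trans (entry-≡ (λ ()) (trans d₀₁ (sym (cong₂ _⊓_ (ε₀ zero (suc zero) d₀₁) (ε₀ (suc zero) zero (trans (d-sym (suc zero) zero) d₀₁)))))) (cong +_ d₀₁)
        where
        ε₀ : ∀ i j → d i j ≡ 2 → ε i ≡ 2
        ε₀ i j eq = ℕ.≤-antisym (ε≤2 i) (subst (_≤ ε i) eq (d≤ε i j))

      core : Fin 3 → Fin 3 → ℤ
      core zero       zero       = 1ℤ
      core (suc zero) (suc zero) = 1ℤ
      core zero       (suc zero) = + 2
      core (suc zero) zero       = + 2
      core _          _          = 1ℤ

      core-≡ : ∀ i j → b (triple i) (triple j) ≡ core i j
      core-≡ zero             zero             = b-diag zero
      core-≡ zero             (suc zero)       = b₀₁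
      core-≡ zero             (suc (suc zero)) = trans (b-sym _ _) (row-big zero zero)
      core-≡ (suc zero)       zero             = trans (b-sym _ _) b₀₁
      core-≡ (suc zero)       (suc zero)       = b-diag (suc zero)
      core-≡ (suc zero)       (suc (suc zero)) = trans (b-sym _ _) (row-big zero (suc zero))
      core-≡ (suc (suc zero)) zero             = row-big zero zero
      core-≡ (suc (suc zero)) (suc zero)       = row-big zero (suc zero)
      core-≡ (suc (suc zero)) (suc (suc zero)) = row-big zero (suc (suc zero))

      -- The two vertices of 2K_1 together with one vertex of the clique give the minor -1, so the
      -- rank is at least 3.
      3-minor : ¬ (Z.det 3 (λ i j → B K (triple i) (triple j)) ≡ 0ℤ)
      3-minor eq = contradiction (trans (sym (Z.det-cong 3 (λ i j → B K (triple i) (triple j)) core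
        (λ i j → trans (sym (b≡B (triple i) (triple j))) (core-≡ i j)))) eq) λ ()

      -- All vertices of index at least 2 have a row of ones. The threshold is 3 because row 2 is
      -- kept as the row to be subtracted.
      equal-rows : ∀ i → 3 ≤ toℕ i → ∀ j → B K i j ≡ B K hub j
      equal-rows (suc zero) (s≤s ()) j
      equal-rows (suc (suc i)) _ j = trans (sym (b≡B (suc (suc i)) j)) (trans (trans (row-big i j) (sym (row-big zero j))) (b≡B hub j))

    EK : Eccentricities K
    EK = eccentricities K conn

    divides : y^ (1 ℕ.+ m) ∣ eccCharPoly K
    divides = y^∣eccCharPoly K conn 3 hub (s≤s (s≤s (s≤s z≤n))) (equal-rows EK d≤2 ecc≤2 ecc-big)

    mult : EccMultMinusOne K (1 ℕ.+ m)
    mult = exact-mult K conn (1 ℕ.+ m) divides λ (r , r+k≤n , F) → 3-minor EK d≤2 ecc≤2 ecc-big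
      (vanishing-minors (B K) F (s≤s (ℕ.+-cancelʳ-≤ (2 ℕ.+ m) r 2 r+k≤n)) triple triple)

  -- The spectrum of 𝒜(P₄) is {4, 1, −1, −4}.
  P4-mult : EccMultMinusOne P4 1
  P4-mult = (+ 16 ∷ -[1+ 15 ] ∷ -1ℤ ∷ 1ℤ ∷ []) , agree , λ ()
    where
    agree : eccCharPoly P4 ≈P (powP yP 1 *P (+ 16 ∷ -[1+ 15 ] ∷ -1ℤ ∷ 1ℤ ∷ []))
    agree zero                               = refl
    agree (suc zero)                         = refl
    agree (suc (suc zero))                   = refl
    agree (suc (suc (suc zero)))             = refl
    agree (suc (suc (suc (suc zero))))       = refl
    agree (suc (suc (suc (suc (suc zero))))) = refl
    agree (suc (suc (suc (suc (suc (suc i)))))) = refl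

  -- The coefficient of x² is minus the sum of the squares of the entries above the diagonal: -(9 +
  -- 4 + 4) = -17 for P₄ and -(4 + 5 · 1) = -9 for K_2 ∨ 2K_1.
  P4≢KJoin : ¬ (eccCharPoly P4 ≈P eccCharPoly (KJoin2K1 2))
  P4≢KJoin eq = contradiction (eq 2) λ ()

  KJoin-mult : ∀ m → EccMultMinusOne (KJoin2K1 (2 ℕ.+ m)) (1 ℕ.+ m)
  KJoin-mult m = KJoin.mult (KJoin2K1 (2 ℕ.+ m)) (λ i j → refl)

  -- Stated for an arbitrary graph in place of P₄, so that no characteristic polynomial is evaluated.
  iso⇒mult : ∀ {n k} {H : Graph n} → EccMultMinusOne H k → ∀ {l} (G : Graph l) → Iso G H → EccMultMinusOne G k
  iso⇒mult {n} {k} {H} mult {l} G iso = go (↔⇒≡ (proj₁ iso)) G iso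
    where
    go : ∀ {l} → l ≡ n → (G : Graph l) → Iso G H → EccMultMinusOne G k
    go refl G iso = rootMult-cong G H {k} (iso⇒charPoly G H iso) mult

  iso⇒charPoly′ : ∀ {l n} (G : Graph l) (H : Graph n) → Iso G H → eccCharPoly G ≈P eccCharPoly H
  iso⇒charPoly′ {l} {n} G H iso = go (↔⇒≡ (proj₁ iso)) G iso
    where
    go : ∀ {l} → l ≡ n → (G : Graph l) → Iso G H → eccCharPoly G ≈P eccCharPoly H
    go refl G iso = iso⇒charPoly G H iso

  backward : ∀ {m} (G : Graph (4 ℕ.+ m)) → Iso G P4 ⊎ Iso G (KJoin2K1 (2 ℕ.+ m)) → EccMultMinusOne G (1 ℕ.+ m)
  backward {m} G (inj₂ iso) = iso⇒mult {4 ℕ.+ m} {1 ℕ.+ m} {KJoin2K1 (2 ℕ.+ m)} (KJoin-mult m) G iso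
  backward {m} G (inj₁ iso) = go m (↔⇒≡ (proj₁ iso)) (iso⇒mult {4} {1} {P4} P4-mult G iso)
    where
    go : ∀ m → 4 ℕ.+ m ≡ 4 → EccMultMinusOne G 1 → EccMultMinusOne G (1 ℕ.+ m)
    go zero    _  mult = mult
    go (suc m) () _

  -- Determination by the spectrum

  determined : ∀ {l k n} (H : Graph l) (K : Graph k) (L : Graph n) → eccCharPoly H ≈P eccCharPoly K →
    ¬ (eccCharPoly K ≈P eccCharPoly L) → Iso H K ⊎ Iso H L → Iso H K
  determined H K L H≈K K≉L (inj₁ iso) = iso
  determined H K L H≈K K≉L (inj₂ iso) = contradiction
    (≈P-trans (eccCharPoly K) (eccCharPoly H) (eccCharPoly L) (≈P-sym (eccCharPoly H) (eccCharPoly K) H≈K) (iso⇒charPoly′ H L iso)) K≉L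

  P4-determined : ∀ {k} (H : Graph k) → Connected H → eccCharPoly H ≈P eccCharPoly P4 → Iso H P4
  P4-determined H conn H≈P4 = go (charPoly-order (eccMatrix H) (eccMatrix P4) H≈P4) H conn H≈P4
    where
    go : ∀ {k} → k ≡ 4 → (H : Graph k) → Connected H → eccCharPoly H ≈P eccCharPoly P4 → Iso H P4
    go refl H conn H≈P4 = determined H P4 (KJoin2K1 2) H≈P4 P4≢KJoin (forward H conn (rootMult-cong H P4 {1} H≈P4 P4-mult))

  -- Equal polynomials force equal orders, hence m = 0, where the coefficients of x² differ.
  KJoin≢P4 : ∀ m → ¬ (eccCharPoly (KJoin2K1 (2 ℕ.+ m)) ≈P eccCharPoly P4)
  KJoin≢P4 m K≈P4 = go m (charPoly-order (eccMatrix (KJoin2K1 (2 ℕ.+ m))) (eccMatrix P4) K≈P4) K≈P4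
    where
    go : ∀ m → 4 ℕ.+ m ≡ 4 → ¬ (eccCharPoly (KJoin2K1 (2 ℕ.+ m)) ≈P eccCharPoly P4)
    go zero    _  K≈P4 = P4≢KJoin (≈P-sym (eccCharPoly (KJoin2K1 2)) (eccCharPoly P4) K≈P4)
    go (suc m) () _

  KJoin-determined′ : ∀ m {k} (H : Graph k) → Connected H → eccCharPoly H ≈P eccCharPoly (KJoin2K1 (2 ℕ.+ m)) → Iso H (KJoin2K1 (2 ℕ.+ m))
  KJoin-determined′ m H conn H≈K = go (charPoly-order (eccMatrix H) (eccMatrix (KJoin2K1 (2 ℕ.+ m))) H≈K) H conn H≈K
    where
    go : ∀ {k} → k ≡ 4 ℕ.+ m → (H : Graph k) → Connected H → eccCharPoly H ≈P eccCharPoly (KJoin2K1 (2 ℕ.+ m)) → Iso H (KJoin2K1 (2 ℕ.+ m))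
    go refl H conn H≈K = determined H (KJoin2K1 (2 ℕ.+ m)) P4 H≈K (KJoin≢P4 m)
      (swap (forward H conn (rootMult-cong H (KJoin2K1 (2 ℕ.+ m)) {1 ℕ.+ m} H≈K (KJoin-mult m))))

  -- The orders enter as equations, so that matching on them replaces the truncated differences n ∸
  -- 3 and n ∸ 2 by sums with m = n - 4.
  characterisation′ : ∀ m {n k l} → n ≡ 4 ℕ.+ m → k ≡ 1 ℕ.+ m → l ≡ 2 ℕ.+ m → (G : Graph n) → Connected G →
    (EccMultMinusOne G k ⇔ (Iso G P4 ⊎ Iso G (KJoin2K1 l)))
  characterisation′ m refl refl refl G conn = mk⇔ (forward G conn) (backward G)

  KJoin-determined : ∀ n → 4 ≤ n → ∀ {k} (H : Graph k) → Connected H →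
    eccCharPoly H ≈P eccCharPoly (KJoin2K1 (n ∸ 2)) → Iso H (KJoin2K1 (n ∸ 2))
  KJoin-determined n 4≤n = shifted (n ∸ 4) (ℕ.+-∸-assoc 2 4≤n)
    where
    shifted : ∀ m {l} → l ≡ 2 ℕ.+ m → ∀ {k} (H : Graph k) → Connected H →
      eccCharPoly H ≈P eccCharPoly (KJoin2K1 l) → Iso H (KJoin2K1 l)
    shifted m refl = KJoin-determined′ m

  characterisation : ∀ n → 4 ≤ n → (G : Graph n) → Connected G →
    (EccMultMinusOne G (n ∸ 3) ⇔ (Iso G P4 ⊎ Iso G (KJoin2K1 (n ∸ 2))))
  characterisation n 4≤n = characterisation′ (n ∸ 4) (sym (ℕ.m+[n∸m]≡n 4≤n)) (ℕ.+-∸-assoc 1 4≤n) (ℕ.+-∸-assoc 2 4≤n)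

open import Defs
open import Data.Nat using (ℕ; _≤_; _∸_)
open import Data.Product using (_×_; _,_)
open import Data.Sum using (_⊎_)
open import Function.Bundles using (_⇔_)

theorem3p3 : (n : ℕ) → 4 ≤ n → (G : Graph n) → Connected G →
    (EccMultMinusOne G (n ∸ 3) ⇔ (Iso G P4 ⊎ Iso G (KJoin2K1 (n ∸ 2))))
    × (∀ {k} (H : Graph k) → Connected H →
    eccCharPoly H ≈P eccCharPoly P4 → Iso H P4)
    × (∀ {k} (H : Graph k) → Connected H →
    eccCharPoly H ≈P eccCharPoly (KJoin2K1 (n ∸ 2)) → Iso H (KJoin2K1 (n ∸ 2)))
theorem3p3 n 4≤n G conn =
  Characterisation.characterisation n 4≤n G conn , Characterisation.P4-determined , Characterisation.KJoin-determined n 4≤n
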